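{- Let $t > 1$ be a fixed integer. There exists $N = N(t)$ such that for all $n \ge N$, $$\operatorname{sat}(K_{n,n},K_{t-1,t}) = (2t-3)n - (t-1)(t-2).$$ Moreover, an $n$ by $n$ bipartite graph $G$ is $K_{t-1,t}$-saturated with exactly $\operatorname{sat}(K_{n,n},K_{t-1,t})$ edges if and only if $G \in \mathcal{F}^n_{t-1,t}$.
   Context: An $n$ by $n$ bipartite graph $G$ has fixed vertex classes $U$, $U'$ with $|U|=|U'|=n$. For a bipartite graph $H$ (here $H=K_{s,t}$, unordered, so a copy may have its $s$-side in either $U$ or $U'$), $G$ is $H$-saturated if $G$ contains no subgraph isomorphic to $H$, but adding any missing edge between $U$ and $U'$ to $G$ creates a copy of $H$. $\operatorname{sat}(K_{n,n},H)$ denotes the minimum number of edges of an $H$-saturated $n$ by $n$ bipartite graph. For $s<t$, $\mathcal{F}^n_{s,t}$ denotes the collection of $K_{s,t}$-free $n$ by $n$ bipartite graphs in which one of the two vertex classes contains a set $S$ of $s-1$ vertices such that every vertex of $S$ is adjacent to all $n$ vertices of the other class, and every other vertex in the same class as $S$ has degree exactly $t-1$. -}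

module Defs where

open import Data.Nat using (ℕ; zero; suc; _+_; _∸_; _≤_)
open import Data.Bool using (Bool; true; false; if_then_else_)
open import Data.Fin using (Fin)
open import Data.Fin.Subset using (Subset; _∈_; _∉_; ∣_∣)
open import Data.Product using (Σ; _×_; ∃-syntax)
open import Data.Sum using (_⊎_)
open import Relation.Nullary using (¬_)
open import Relation.Binary.PropositionalEquality using (_≡_)
open import Function.Definitions using (Injective)

-- An n by n bipartite graph with vertex classes U = Fin n (first argument)
-- and U' = Fin n (second argument): G u u' ≡ true iff uu' is an edge.
BipGraph : ℕ → Set
BipGraph n = Fin n → Fin n → Bool

transpose : ∀ {n} → BipGraph n → BipGraph n
transpose G u' u = G u u'

sumFin : (n : ℕ) → (Fin n → ℕ) → ℕ
sumFin zero    f = 0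
sumFin (suc n) f = f Fin.zero + sumFin n (λ i → f (Fin.suc i))

bit : Bool → ℕ
bit true  = 1
bit false = 0

degree : ∀ {n} → BipGraph n → Fin n → ℕ
degree {n} G u = sumFin n (λ u' → bit (G u u'))

edges : ∀ {n} → BipGraph n → ℕ
edges {n} G = sumFin n (λ u → degree G u)

addEdge : ∀ {n} → BipGraph n → Fin n → Fin n → BipGraph n
addEdge G u u' x y with x Data.Fin.≟ u | y Data.Fin.≟ u'
... | Relation.Nullary.yes _ | Relation.Nullary.yes _ = true
... | _ | _ = G x y

ContainsKOriented : ∀ {n} → BipGraph n → ℕ → ℕ → Set
ContainsKOriented {n} G s t =
  Σ (Fin s → Fin n) λ f → Σ (Fin t → Fin n) λ g →
    Injective _≡_ _≡_ f × Injective _≡_ _≡_ g ×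
    (∀ i j → G (f i) (g j) ≡ true)

ContainsK : ∀ {n} → BipGraph n → ℕ → ℕ → Set
ContainsK G s t = ContainsKOriented G s t ⊎ ContainsKOriented (transpose G) s t

Saturated : ∀ {n} → BipGraph n → ℕ → ℕ → Set
Saturated G s t =
  ¬ ContainsK G s t ×
  (∀ u u' → G u u' ≡ false → ContainsK (addEdge G u u') s t)

IsSatNumber : ℕ → ℕ → ℕ → ℕ → Set
IsSatNumber n s t m =
  (∃[ G ] (Saturated {n} G s t × edges G ≡ m)) ×
  (∀ (G : BipGraph n) → Saturated G s t → m ≤ edges G)

FamilyOriented : ∀ {n} → BipGraph n → ℕ → ℕ → Set
FamilyOriented {n} G s t =
  Σ (Subset n) λ S →
    ∣ S ∣ ≡ s ∸ 1 ×
    (∀ u → u ∈ S → ∀ u' → G u u' ≡ true) ×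
    (∀ u → u ∉ S → degree G u ≡ t ∸ 1)

InFamily : ∀ {n} → BipGraph n → ℕ → ℕ → Set
InFamily G s t =
  ¬ ContainsK G s t × (FamilyOriented G s t ⊎ FamilyOriented (transpose G) s t)

{-# OPTIONS --safe #-}
module Submission where

open import Defs
open import Data.Bool using (Bool; true; false; _∧_; _∨_; not)
open import Data.Bool.Properties using (∧-zeroʳ)
open import Data.Empty using (⊥; ⊥-elim)
open import Data.Fin using (Fin; zero; suc; toℕ; _≟_)
open import Data.Fin.Properties using (suc-injective)
open import Data.Fin.Subset as Subset using (Subset; ∣_∣)
open import Data.List using (_∷_; [])
open import Data.Nat using (ℕ; zero; suc; _+_; _*_; _∸_; _^_; _≤_; _<_; _≤ᵇ_; _<ᵇ_; z≤n; s≤s; >-nonZero)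
open import Data.Nat.Properties hiding (suc-injective; _≟_)
open import Data.Nat.Tactic.RingSolver using (solve; solve-∀)
open import Data.Product using (Σ; _×_; _,_; proj₁; proj₂; ∃-syntax)
open import Data.Sum using (_⊎_; inj₁; inj₂; swap)
import Data.Vec as Vec
open import Data.Vec.Properties using (lookup∘tabulate; lookup⇒[]=; []=⇒lookup)
open import Function.Bundles using (_⇔_; mk⇔)
open import Function.Definitions using (Injective)
open import Relation.Binary.PropositionalEquality using (_≡_; _≢_; refl; sym; trans; cong; cong₂; subst; subst₂; module ≡-Reasoning)
open import Relation.Nullary using (¬_; yes; no; does)

-- Write t = r + 2. A saturated graph with at most r n + (r + 1)(n − r) edges has all degrees at least r.
-- If some vertex y has degree r, every vertex outside S = N(y) has r + 1 neighbours in the common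
-- neighbourhood of S, and counting edges leaves no room for anything but the extremal family.
--
-- Otherwise all degrees are at least r + 1. A missing edge u y between vertices of bounded degree is completed
-- through r vertices of linear degree next to u or next to y, up to negligibly many exceptions. Hence in one
-- class almost every vertex has r such neighbours, which accounts for r n edges, and almost every vertex of the
-- other class has degree exactly r + 1. This forces an r-set S, in one of the classes, whose common
-- neighbourhood is nearly the whole other class.
--
-- Let E′ be the set of vertices not adjacent to all of S. If E′ is empty, the edge count gives the family. If not,
-- the edges missing between S and E′ can only be paid for when an r-set S′ of the other class is nearly full as
-- well and complete to S; let E be its exceptional set. If E is empty we are again in the family, and if
-- neither is empty every exceptional vertex has exactly r + 1 non-exceptional neighbours, the vertices left
-- unmatched outside S and S′ must be completed through edges between E and E′, and there are too few of these.

-- A completion has two shapes, r vertices next to `y` and r + 1 next to `u` or the reverse, and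
-- nothing says in advance which class carries the dominating set. A vertex of degree r excludes one
-- shape; without such a vertex both survive, so statements are made for `G` and reused for `G ᵀ`.
-- The search for `S` is approximate: sets of order n / K are discarded, with K depending on r only.
-- It rests on one consequence of freeness: a vertex of bounded degree shares r + 1 neighbours with
-- boundedly many others, so few pairs have a completion whose r-side leaves the vertices of linear
-- degree. The rest is exact: the bound r n + (r + 1)(n - r) leaves no room for discarding, and
-- every count is compared with it term by term. Its side conditions only ask that n exceed a
-- multiple of the number of exceptional vertices plus a constant, both depending on r. The
-- approximate part reaches this by taking K large, after which N is chosen.

-- A ≤ B gives x ≤ y once x + B + k ≡ y + A, which the ring solver can check.
lin : ∀ {A B x y} k → A ≤ B → x + B + k ≡ y + A → x ≤ y
lin {A} {B} {x} {y} k A≤B eq = +-cancelʳ-≤ A x y (begin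
  x + A     ≤⟨ +-monoʳ-≤ x A≤B ⟩
  x + B     ≤⟨ m≤m+n _ k ⟩
  x + B + k ≡⟨ eq ⟩
  y + A     ∎)
  where open ≤-Reasoning

_⊕_ : ∀ {a b c d} → a ≤ b → c ≤ d → a + c ≤ b + d
_⊕_ = +-mono-≤
infixl 6 _⊕_

_⊗_ : ∀ {a b} k → a ≤ b → k * a ≤ k * b
k ⊗ h = *-monoʳ-≤ k h
infixl 7 _⊗_

bool-cases : (b : Bool) → b ≡ true ⊎ b ≡ false
bool-cases true  = inj₁ refl
bool-cases false = inj₂ refl

true≢false : ∀ {b} {A : Set} → b ≡ true → b ≡ false → A
true≢false refl ()

∧-intro : ∀ {a b} → a ≡ true → b ≡ true → a ∧ b ≡ true
∧-intro refl refl = refl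

∧-left : ∀ {a b} → a ∧ b ≡ true → a ≡ true
∧-left {true} _ = refl

∧-right : ∀ {a b} → a ∧ b ≡ true → b ≡ true
∧-right {true} h = h

not-true : ∀ {b} → b ≡ false → not b ≡ true
not-true refl = refl

not-false : ∀ {b} → not b ≡ true → b ≡ false
not-false {false} _ = refl

≤ᵇ-true : ∀ {a b} → a ≤ b → (a ≤ᵇ b) ≡ true
≤ᵇ-true {a} {b} h with a ≤ᵇ b | ≤⇒≤ᵇ h
... | true | _ = refl

≤ᵇ-true⁻¹ : ∀ {a b} → (a ≤ᵇ b) ≡ true → a ≤ b
≤ᵇ-true⁻¹ {a} {b} h = ≤ᵇ⇒≤ a b (subst Data.Bool.T (sym h) _)

≤ᵇ-false⁻¹ : ∀ {a b} → (a ≤ᵇ b) ≡ false → b < a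
≤ᵇ-false⁻¹ h = ≰⇒> λ a≤b → true≢false (≤ᵇ-true a≤b) h

-- Finite sets as Boolean predicates, with sums and cardinalities

Pred : ℕ → Set
Pred n = Fin n → Bool

infix 4 _∈_ _∉_ _⊆_
_∈_ _∉_ : ∀ {n} → Fin n → Pred n → Set
x ∈ P = P x ≡ true
x ∉ P = P x ≡ false

_⊆_ : ∀ {n} → Pred n → Pred n → Set
P ⊆ Q = ∀ x → x ∈ P → x ∈ Q

infixl 7 _∩_ _∖_
_∩_ _∖_ : ∀ {n} → Pred n → Pred n → Pred n
(P ∩ Q) x = P x ∧ Q x
(P ∖ Q) x = P x ∧ not (Q x)

∁ : ∀ {n} → Pred n → Pred n
∁ P x = not (P x)

full : ∀ {n} → Pred n
full _ = true

⟦_⟧ : ∀ {n} → Fin n → Pred n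
⟦ x ⟧ y = does (x ≟ y)

opaque
  ∑ : ∀ {n} → (Fin n → ℕ) → ℕ
  ∑ {n} = sumFin n

  ∑-cong : ∀ {n} {f g : Fin n → ℕ} → (∀ x → f x ≡ g x) → ∑ f ≡ ∑ g
  ∑-cong {zero}  h = refl
  ∑-cong {suc n} h = cong₂ _+_ (h zero) (∑-cong λ x → h (suc x))

  ∑-mono : ∀ {n} {f g : Fin n → ℕ} → (∀ x → f x ≤ g x) → ∑ f ≤ ∑ g
  ∑-mono {zero}  h = z≤n
  ∑-mono {suc n} h = h zero ⊕ ∑-mono λ x → h (suc x)

  ∑-+ : ∀ {n} (f g : Fin n → ℕ) → ∑ (λ x → f x + g x) ≡ ∑ f + ∑ g
  ∑-+ {zero}  f g = refl
  ∑-+ {suc n} f g = trans (cong (f zero + g zero +_) (∑-+ (λ x → f (suc x)) (λ x → g (suc x))))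
    (interchange (f zero) (g zero) (∑ λ x → f (suc x)) (∑ λ x → g (suc x)))
    where
    interchange : ∀ a b c d → a + b + (c + d) ≡ a + c + (b + d)
    interchange = solve-∀

  ∑-* : ∀ {n} c (f : Fin n → ℕ) → ∑ (λ x → c * f x) ≡ c * ∑ f
  ∑-* {zero}  c f = sym (*-zeroʳ c)
  ∑-* {suc n} c f = trans (cong (c * f zero +_) (∑-* c λ x → f (suc x))) (sym (*-distribˡ-+ c _ _))

  ∑-0 : ∀ n → ∑ {n} (λ _ → 0) ≡ 0
  ∑-0 zero    = refl
  ∑-0 (suc n) = ∑-0 n

  ∑-swap : ∀ {m n} (f : Fin m → Fin n → ℕ) → ∑ (λ x → ∑ (f x)) ≡ ∑ (λ y → ∑ λ x → f x y)
  ∑-swap {zero}  {n} f = sym (∑-0 n)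
  ∑-swap {suc m} f = trans (cong (∑ (f zero) +_) (∑-swap λ x → f (suc x))) (sym (∑-+ (f zero) _))

  ∑-< : ∀ {n} {f g : Fin n → ℕ} → ∑ f < ∑ g → ∃[ x ] f x < g x
  ∑-< {suc n} {f} {g} h with f zero <? g zero
  ... | yes p = zero , p
  ... | no ¬p with ∑-< {n} (+-cancelˡ-< (g zero) _ _ (≤-<-trans (+-monoˡ-≤ _ (≮⇒≥ ¬p)) h))
  ...   | x , q = suc x , q

  ∑-term : ∀ {n} (f : Fin n → ℕ) x → f x ≤ ∑ f
  ∑-term f zero    = m≤m+n _ _
  ∑-term f (suc x) = ≤-trans (∑-term (λ y → f (suc y)) x) (m≤n+m _ _)

  edges-∑ : ∀ {n} (G : BipGraph n) → edges G ≡ ∑ (degree G)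
  edges-∑ G = refl

bit-true : ∀ {b} → 1 ≤ bit b → b ≡ true
bit-true {true} _ = refl

bit-mono : ∀ {a b} → (a ≡ true → b ≡ true) → bit a ≤ bit b
bit-mono {false} h = z≤n
bit-mono {true} {b} h rewrite h refl = ≤-refl

bit-∧ : ∀ a b → bit (a ∧ b) ≡ bit a * bit b
bit-∧ true  b = sym (+-identityʳ _)
bit-∧ false b = refl

⟦⟧-refl : ∀ {n} (x : Fin n) → x ∈ ⟦ x ⟧
⟦⟧-refl x with x ≟ x
... | yes _ = refl
... | no ¬p = ⊥-elim (¬p refl)

⟦⟧-≡ : ∀ {n} {x y : Fin n} → y ∈ ⟦ x ⟧ → x ≡ y
⟦⟧-≡ {x = x} {y} h with x ≟ y
... | yes p = p

⟦⟧-≢ : ∀ {n} {x y : Fin n} → x ≢ y → y ∉ ⟦ x ⟧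
⟦⟧-≢ {x = x} {y} h with x ≟ y
... | yes p = ⊥-elim (h p)
... | no _ = refl

opaque
  unfolding ∑

  # : ∀ {n} → Pred n → ℕ
  # P = ∑ λ x → bit (P x)

  #-⟦⟧ : ∀ {n} (x : Fin n) → # ⟦ x ⟧ ≡ 1
  #-⟦⟧ {suc n} zero    = cong suc (∑-0 n)
  #-⟦⟧ {suc n} (suc x) = trans (∑-cong λ y → cong bit (pt y)) (#-⟦⟧ x)
    where
    pt : ∀ y → ⟦ suc x ⟧ (suc y) ≡ ⟦ x ⟧ y
    pt y with x ≟ y
    ... | yes _ = refl
    ... | no  _ = refl

opaque
  unfolding #

  ∑[_] : ∀ {n} → Pred n → (Fin n → ℕ) → ℕ
  ∑[ P ] f = ∑ λ x → bit (P x) * f x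

  #-mono : ∀ {n} {P Q : Pred n} → P ⊆ Q → # P ≤ # Q
  #-mono h = ∑-mono λ x → bit-mono (h x)

  #-full : ∀ n → # {n} full ≡ n
  #-full zero    = refl
  #-full (suc n) = cong suc (#-full n)

  #-split : ∀ {n} (P Q : Pred n) → # P ≡ # (P ∩ Q) + # (P ∖ Q)
  #-split P Q = trans (∑-cong λ x → pt (P x) (Q x)) (∑-+ (λ x → bit ((P ∩ Q) x)) (λ x → bit ((P ∖ Q) x)))
    where
    pt : ∀ a b → bit a ≡ bit (a ∧ b) + bit (a ∧ not b)
    pt false b     = refl
    pt true  true  = refl
    pt true  false = refl

  #-∪ : ∀ {n} {P Q R : Pred n} → (∀ x → x ∈ P → x ∈ Q ⊎ x ∈ R) → # P ≤ # Q + # R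
  #-∪ {P = P} {Q} {R} h = ≤-trans (∑-mono λ x → pt (P x) (h x)) (≤-reflexive (∑-+ (λ x → bit (Q x)) (λ x → bit (R x))))
    where
    pt : ∀ a {b c} → (a ≡ true → b ≡ true ⊎ c ≡ true) → bit a ≤ bit b + bit c
    pt false h = z≤n
    pt true h with h refl
    ... | inj₁ refl = m≤m+n _ _
    ... | inj₂ refl = m≤n+m _ _

  #-∃ : ∀ {n} {P : Pred n} → 1 ≤ # P → ∃[ x ] x ∈ P
  #-∃ {n} {P} h with ∑-< {f = λ _ → 0} {g = λ x → bit (P x)} (subst (_< # P) (sym (∑-0 n)) h)
  ... | x , p = x , bit-true p

  #-∈ : ∀ {n} {P : Pred n} x → x ∈ P → 1 ≤ # P
  #-∈ {P = P} x h = ≤-trans (≤-reflexive (cong bit (sym h))) (∑-term (λ y → bit (P y)) x)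

  ∑[]-mono : ∀ {n} {P : Pred n} {f g} → (∀ x → x ∈ P → f x ≤ g x) → ∑[ P ] f ≤ ∑[ P ] g
  ∑[]-mono {P = P} {f} {g} h = ∑-mono pt
    where
    pt : ∀ x → bit (P x) * f x ≤ bit (P x) * g x
    pt x with P x | h x
    ... | true  | q = 1 ⊗ q refl
    ... | false | _ = z≤n

  ∑[]-⊆ : ∀ {n} {P Q : Pred n} f → P ⊆ Q → ∑[ P ] f ≤ ∑[ Q ] f
  ∑[]-⊆ f h = ∑-mono λ x → *-monoˡ-≤ (f x) (bit-mono (h x))

  ∑[]-const : ∀ {n} (P : Pred n) c → ∑[ P ] (λ _ → c) ≡ c * # P
  ∑[]-const P c = trans (∑-cong λ x → *-comm (bit (P x)) c) (∑-* c λ x → bit (P x))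

  ∑[]-+ : ∀ {n} (P : Pred n) f g → ∑[ P ] (λ x → f x + g x) ≡ ∑[ P ] f + ∑[ P ] g
  ∑[]-+ P f g = trans (∑-cong λ x → *-distribˡ-+ (bit (P x)) (f x) (g x)) (∑-+ (λ x → bit (P x) * f x) (λ x → bit (P x) * g x))

  ∑[]-* : ∀ {n} (P : Pred n) c f → ∑[ P ] (λ x → c * f x) ≡ c * ∑[ P ] f
  ∑[]-* P c f = trans (∑-cong λ x → comm (bit (P x)) c (f x)) (∑-* c λ x → bit (P x) * f x)
    where
    comm : ∀ a b c → a * (b * c) ≡ b * (a * c)
    comm = solve-∀

  ∑[]-full : ∀ {n} (f : Fin n → ℕ) → ∑[ full ] f ≡ ∑ f
  ∑[]-full f = ∑-cong λ x → +-identityʳ (f x)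

  ∑[]-split : ∀ {n} (P Q : Pred n) f → ∑[ P ] f ≡ ∑[ P ∩ Q ] f + ∑[ P ∖ Q ] f
  ∑[]-split P Q f = trans (∑-cong λ x → pt (P x) (Q x) (f x)) (∑-+ (λ x → bit ((P ∩ Q) x) * f x) (λ x → bit ((P ∖ Q) x) * f x))
    where
    pt : ∀ a b c → bit a * c ≡ bit (a ∧ b) * c + bit (a ∧ not b) * c
    pt false b     c = refl
    pt true  true  c = sym (+-identityʳ _)
    pt true  false c = refl

  ∑[]-< : ∀ {n} {P : Pred n} {f g} → ∑[ P ] f < ∑[ P ] g → ∃[ x ] (x ∈ P × f x < g x)
  ∑[]-< {P = P} h with ∑-< h
  ... | x , p with P x in eq
  ...   | true = x , eq , +-cancelʳ-< 0 _ _ p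

  ∑[]-term : ∀ {n} {P : Pred n} f {x} → x ∈ P → f x ≤ ∑[ P ] f
  ∑[]-term {P = P} f {x} h = ≤-trans (≤-reflexive (trans (sym (+-identityʳ _)) (cong (λ b → bit b * f x) (sym h))))
    (∑-term (λ y → bit (P y) * f y) x)

  #-sum : ∀ {n} (P : Pred n) → # P ≡ sumFin n (λ x → bit (P x))
  #-sum P = refl

  ∑[]-∩ : ∀ {n} (P Q : Pred n) f → ∑[ P ∩ Q ] f ≡ ∑[ P ] (λ x → bit (Q x) * f x)
  ∑[]-∩ P Q f = ∑-cong λ x → trans (cong (_* f x) (bit-∧ (P x) (Q x))) (*-assoc (bit (P x)) (bit (Q x)) (f x))

  #-cong : ∀ {n} {P Q : Pred n} → (∀ x → P x ≡ Q x) → # P ≡ # Q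
  #-cong h = ∑-cong λ x → cong bit (h x)

#≤n : ∀ {n} (P : Pred n) → # P ≤ n
#≤n {n} P = ≤-trans (#-mono {P = P} {full} λ _ _ → refl) (≤-reflexive (#-full n))

#-∁ : ∀ {n} (P : Pred n) → # P + # (∁ P) ≡ n
#-∁ {n} P = trans (sym (#-split full P)) (#-full n)

#-∪₃ : ∀ {n} {P Q R S : Pred n} → (∀ x → x ∈ P → x ∈ Q ⊎ x ∈ R ⊎ x ∈ S) → # P ≤ # Q + # R + # S
#-∪₃ {P = P} {Q} {R} {S} h = begin
  # P                          ≡⟨ #-split P Q ⟩
  # (P ∩ Q) + # (P ∖ Q)        ≤⟨ #-mono (λ x → ∧-right {P x}) ⊕ #-∪ (λ x → pt x) ⟩
  # Q + (# R + # S)            ≡⟨ sym (+-assoc (# Q) _ _) ⟩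
  # Q + # R + # S              ∎
  where
  open ≤-Reasoning
  pt : ∀ x → x ∈ P ∖ Q → x ∈ R ⊎ x ∈ S
  pt x q with h x (∧-left q)
  ... | inj₁ a = true≢false a (not-false (∧-right {P x} q))
  ... | inj₂ a = a

#-0 : ∀ {n} {P : Pred n} → # P ≡ 0 → ∀ x → x ∉ P
#-0 {P = P} h x with bool-cases (P x)
... | inj₂ p = p
... | inj₁ p = ⊥-elim (<-irrefl (sym h) (#-∈ {P = P} x p))

#-⊆-≥ : ∀ {n} {P Q : Pred n} → P ⊆ Q → # Q ≤ # P → Q ⊆ P
#-⊆-≥ {P = P} {Q} h le x q with bool-cases (P x)
... | inj₁ p = p
... | inj₂ p = ⊥-elim (<-irrefl refl (begin-strict
  # P                      ≤⟨ #-mono (λ y r → ∧-intro (h y r) r) ⟩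
  # (Q ∩ P)                <⟨ m<m+n _ (#-∈ {P = Q ∖ P} x (∧-intro q (not-true p))) ⟩
  # (Q ∩ P) + # (Q ∖ P)    ≡⟨ sym (#-split Q P) ⟩
  # Q                      ≤⟨ le ⟩
  # P                      ∎))
  where open ≤-Reasoning

#-remove : ∀ {n} {P : Pred n} x → x ∈ P → # P ≡ suc (# (P ∖ ⟦ x ⟧))
#-remove {P = P} x h = trans (#-split P ⟦ x ⟧) (cong (_+ # (P ∖ ⟦ x ⟧)) (trans (#-cong pt) (#-⟦⟧ x)))
  where
  pt : ∀ y → (P ∩ ⟦ x ⟧) y ≡ ⟦ x ⟧ y
  pt y with x ≟ y
  ... | yes refl = ∧-intro h refl
  ... | no _ with P y
  ...   | true  = refl
  ...   | false = refl

_∪⟦_⟧ : ∀ {n} → Pred n → Fin n → Pred n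
(P ∪⟦ x ⟧) y = P y ∨ ⟦ x ⟧ y

∪-old : ∀ {n} {P : Pred n} {x y} → y ∈ P → y ∈ P ∪⟦ x ⟧
∪-old {P = P} {x} {y} h rewrite h = refl

∪-new : ∀ {n} {P : Pred n} {x} → x ∈ P ∪⟦ x ⟧
∪-new {P = P} {x} rewrite ⟦⟧-refl x with P x
... | true  = refl
... | false = refl

∪-case : ∀ {n} {P : Pred n} {x y} → y ∈ P ∪⟦ x ⟧ → y ∈ P ⊎ x ≡ y
∪-case {P = P} {x} {y} h with P y
... | true  = inj₁ refl
... | false = inj₂ (⟦⟧-≡ h)

#-insert : ∀ {n} {P : Pred n} {x} → x ∉ P → # (P ∪⟦ x ⟧) ≡ suc (# P)
#-insert {P = P} {x} h = trans (#-remove {P = P ∪⟦ x ⟧} x (∪-new {P = P})) (cong suc (#-cong pt))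
  where
  pt : ∀ y → ((P ∪⟦ x ⟧) ∖ ⟦ x ⟧) y ≡ P y
  pt y with x ≟ y
  ... | yes refl rewrite h = refl
  ... | no _ with P y
  ...   | true  = refl
  ...   | false = refl


#-remove-≥ : ∀ {n k} {P : Pred n} x → suc k ≤ # P → k ≤ # (P ∖ ⟦ x ⟧)
#-remove-≥ {P = P} x h with bool-cases (P x)
... | inj₁ p = ≤-pred (subst (_ ≤_) (#-remove {P = P} x p) h)
... | inj₂ p = ≤-trans (≤-trans (n≤1+n _) h) (#-mono {P = P} λ y q → ∧-intro q (not-true (⟦⟧-≢ {x = x} {y} λ { refl → true≢false q p })))

∑[]-cong : ∀ {n} {P : Pred n} {f g} → (∀ x → x ∈ P → f x ≡ g x) → ∑[ P ] f ≡ ∑[ P ] g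
∑[]-cong h = ≤-antisym (∑[]-mono λ x p → ≤-reflexive (h x p)) (∑[]-mono λ x p → ≤-reflexive (sym (h x p)))

∑[]-strict : ∀ {n} {P : Pred n} {f g} → (∀ x → x ∈ P → f x ≤ g x) → ∀ {x} → x ∈ P → f x < g x → ∑[ P ] f < ∑[ P ] g
∑[]-strict {P = P} {f} {g} h {x} p lt = begin-strict
  ∑[ P ] f                                <⟨ n<1+n _ ⟩
  1 + ∑[ P ] f                            ≤⟨ +-monoˡ-≤ _ (≤-trans (≤-reflexive (sym (cong bit (⟦⟧-refl x)))) (∑[]-term (λ y → bit (⟦ x ⟧ y)) p)) ⟩
  ∑[ P ] (λ y → bit (⟦ x ⟧ y)) + ∑[ P ] f ≡⟨ sym (∑[]-+ P _ _) ⟩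
  ∑[ P ] (λ y → bit (⟦ x ⟧ y) + f y)      ≤⟨ ∑[]-mono pt ⟩
  ∑[ P ] g                                ∎
  where
  open ≤-Reasoning
  pt : ∀ y → y ∈ P → bit (⟦ x ⟧ y) + f y ≤ g y
  pt y q with x ≟ y
  ... | yes refl = lt
  ... | no _ = h y q

-- One strict term would make the sums strictly ordered. This is how exact degrees are read off from
-- an edge count that is attained.
∑[]-tight : ∀ {n} {P : Pred n} {f g} → (∀ x → x ∈ P → f x ≤ g x) → ∑[ P ] g ≤ ∑[ P ] f → ∀ x → x ∈ P → g x ≤ f x
∑[]-tight h le x p = ≮⇒≥ λ lt → <⇒≱ (∑[]-strict h p lt) le

allB : ∀ {n} → Pred n → Bool
allB {zero}  P = true
allB {suc n} P = P zero ∧ allB (λ x → P (suc x))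

allB-elim : ∀ {n} {P : Pred n} → allB P ≡ true → ∀ x → x ∈ P
allB-elim h zero    = ∧-left h
allB-elim {P = P} h (suc x) = allB-elim (∧-right {P zero} h) x

allB-intro : ∀ {n} {P : Pred n} → (∀ x → x ∈ P) → allB P ≡ true
allB-intro {zero}  h = refl
allB-intro {suc n} h = ∧-intro (h zero) (allB-intro λ x → h (suc x))

allB-false : ∀ {n} {P : Pred n} → allB P ≡ false → ∃[ x ] x ∉ P
allB-false {suc n} {P} h with P zero in eq
... | false = zero , eq
... | true with allB-false {n} h
...   | x , p = suc x , p

-- Degrees and common neighbourhoods

-- G may be any relation between the two classes, not only the graph under study.
_ᵀ : ∀ {n} → BipGraph n → BipGraph n
_ᵀ = transpose

opaque
  unfolding ∑ # ∑[_]

  deg : ∀ {n} → BipGraph n → Pred n → Fin n → ℕ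
  deg G Q x = # λ y → Q y ∧ G x y

  degree-full : ∀ {n} (G : BipGraph n) x → degree G x ≡ deg G full x
  degree-full G x = refl

  deg-# : ∀ {n} (G : BipGraph n) Q x → deg G Q x ≡ # (Q ∩ G x)
  deg-# G Q x = refl

  handshake : ∀ {n} (G : BipGraph n) (P Q : Pred n) → ∑[ P ] (deg G Q) ≡ ∑[ Q ] (deg (G ᵀ) P)
  handshake G P Q = trans (∑-cong λ x → sym (∑-* (bit (P x)) λ y → bit (Q y ∧ G x y)))
    (trans (∑-swap λ x y → bit (P x) * bit (Q y ∧ G x y))
    (∑-cong λ y → trans (∑-cong λ x → pt (P x) (Q y) (G x y)) (∑-* (bit (Q y)) λ x → bit (P x ∧ G x y))))
    where
    pt : ∀ a b c → bit a * bit (b ∧ c) ≡ bit b * bit (a ∧ c)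
    pt true  true  c = refl
    pt true  false c = refl
    pt false true  c = refl
    pt false false c = refl

  deg-mono : ∀ {n} (G : BipGraph n) {P Q : Pred n} x → P ⊆ Q → deg G P x ≤ deg G Q x
  deg-mono G {P} x h = #-mono {P = P ∩ G x} λ y p → ∧-intro (h y (∧-left p)) (∧-right {P y} p)

  deg≤# : ∀ {n} (G : BipGraph n) (P : Pred n) x → deg G P x ≤ # P
  deg≤# G P x = #-mono {P = P ∩ G x} λ y → ∧-left

  deg-split : ∀ {n} (G : BipGraph n) (P Q : Pred n) x → deg G P x ≡ deg G (P ∩ Q) x + deg G (P ∖ Q) x
  deg-split G P Q x = trans (∑-cong λ y → pt (P y) (Q y) (G x y)) (∑-+ (λ y → bit ((P ∩ Q) y ∧ G x y)) (λ y → bit ((P ∖ Q) y ∧ G x y)))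
    where
    pt : ∀ a b c → bit (a ∧ c) ≡ bit ((a ∧ b) ∧ c) + bit ((a ∧ not b) ∧ c)
    pt false b     c = refl
    pt true  true  c = sym (+-identityʳ _)
    pt true  false c = refl

edges-deg : ∀ {n} (G : BipGraph n) → edges G ≡ ∑[ full ] (deg G full)
edges-deg G = trans (edges-∑ G) (trans (∑-cong (degree-full G)) (sym (∑[]-full _)))

edges-ᵀ : ∀ {n} (G : BipGraph n) → edges (G ᵀ) ≡ edges G
edges-ᵀ G = trans (edges-deg (G ᵀ)) (trans (sym (handshake G full full)) (sym (edges-deg G)))

-- Each vertex of `B` receives an edge from `A`, and the sum counts these edges. Exceptional sets
-- are bounded this way throughout.
#≤∑deg : ∀ {n} (G : BipGraph n) (A B : Pred n) → (∀ y → y ∈ B → 1 ≤ deg (G ᵀ) A y) → # B ≤ ∑[ A ] (deg G B)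
#≤∑deg G A B h = begin
  # B                     ≡⟨ sym (trans (∑[]-const B 1) (+-identityʳ _)) ⟩
  ∑[ B ] (λ _ → 1)        ≤⟨ ∑[]-mono h ⟩
  ∑[ B ] (deg (G ᵀ) A)    ≡⟨ sym (handshake G A B) ⟩
  ∑[ A ] (deg G B)        ∎
  where open ≤-Reasoning

opaque
  nb : ∀ {n} → BipGraph n → Pred n → Pred n
  nb G S y = allB λ x → not (S x ∧ not (G x y))

  nb-adj : ∀ {n} {G : BipGraph n} {S x y} → y ∈ nb G S → x ∈ S → G x y ≡ true
  nb-adj {G = G} {S} {x} {y} h s with S x | G x y | allB-elim h x
  nb-adj {G = G} {S} {x} {y} h s | true | true | _ = refl

  nb-intro : ∀ {n} {G : BipGraph n} {S y} → (∀ x → x ∈ S → G x y ≡ true) → y ∈ nb G S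
  nb-intro {G = G} {S} {y} h = allB-intro pt
    where
    pt : ∀ x → not (S x ∧ not (G x y)) ≡ true
    pt x with S x | h x
    ... | false | _ = refl
    ... | true  | q rewrite q refl = refl

  nb-false : ∀ {n} {G : BipGraph n} {S y} → y ∉ nb G S → ∃[ x ] (x ∈ S × G x y ≡ false)
  nb-false {G = G} {S} {y} h with allB-false h
  ... | x , p with S x in eq | G x y in eq′
  ...   | true | false = x , eq , eq′

Complete : ∀ {n} → BipGraph n → Pred n → Pred n → Set
Complete G X Y = ∀ x y → x ∈ X → y ∈ Y → G x y ≡ true

#-unique : ∀ {n} {P : Pred n} {x y} → # P ≤ 1 → x ∈ P → y ∈ P → x ≡ y
#-unique {P = P} {x} {y} h p q with x ≟ y
... | yes e = e
... | no ¬e = ⊥-elim (<-irrefl refl (begin-strict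
  1                       <⟨ s≤s (#-∈ {P = P ∖ ⟦ x ⟧} y (∧-intro q (not-true (⟦⟧-≢ ¬e)))) ⟩
  suc (# (P ∖ ⟦ x ⟧))     ≡⟨ sym (#-remove x p) ⟩
  # P                     ≤⟨ h ⟩
  1                       ∎))
  where open ≤-Reasoning

⊆-deg : ∀ {n} {G : BipGraph n} {X P : Pred n} {u} → X ⊆ P → (∀ y → y ∈ X → G u y ≡ true) → # X ≤ deg G P u
⊆-deg {G = G} {X} {P} {u} s a = ≤-trans (#-mono {P = X} {P ∩ G u} λ y q → ∧-intro (s y q) (a y q)) (≤-reflexive (sym (deg-# G P u)))

deg-∃ : ∀ {n} {G : BipGraph n} {P : Pred n} {u} → 1 ≤ deg G P u → ∃[ y ] (y ∈ P × G u y ≡ true)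
deg-∃ {G = G} {P} {u} h with #-∃ {P = P ∩ G u} (≤-trans h (≤-reflexive (deg-# G P u)))
... | y , q = y , ∧-left q , ∧-right {P y} q

deg-∈ : ∀ {n} {G : BipGraph n} {P : Pred n} {u y} → y ∈ P → G u y ≡ true → 1 ≤ deg G P u
deg-∈ {G = G} {P} {u} {y} p a = ≤-trans (#-∈ {P = P ∩ G u} y (∧-intro p a)) (≤-reflexive (sym (deg-# G P u)))

deg-unique : ∀ {n} {G : BipGraph n} {P : Pred n} {u x y} → deg G P u ≤ 1 →
  x ∈ P → G u x ≡ true → y ∈ P → G u y ≡ true → x ≡ y
deg-unique {G = G} {P} {u} h p a q b = #-unique {P = P ∩ G u} (≤-trans (≤-reflexive (sym (deg-# G P u))) h) (∧-intro p a) (∧-intro q b)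

deg-∪ : ∀ {n} (G : BipGraph n) {P Q R : Pred n} u → (∀ y → y ∈ P → G u y ≡ true → y ∈ Q ⊎ y ∈ R) → deg G P u ≤ deg G Q u + deg G R u
deg-∪ G {P} {Q} {R} u h = begin
  deg G P u                        ≡⟨ deg-# G P u ⟩
  # (P ∩ G u)                      ≤⟨ #-∪ {Q = Q ∩ G u} {R ∩ G u} pt ⟩
  # (Q ∩ G u) + # (R ∩ G u)        ≡⟨ cong₂ _+_ (sym (deg-# G Q u)) (sym (deg-# G R u)) ⟩
  deg G Q u + deg G R u            ∎
  where
  open ≤-Reasoning
  pt : ∀ y → y ∈ P ∩ G u → y ∈ Q ∩ G u ⊎ y ∈ R ∩ G u
  pt y q with h y (∧-left q) (∧-right {P y} q)
  ... | inj₁ a = inj₁ (∧-intro a (∧-right {P y} q))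
  ... | inj₂ a = inj₂ (∧-intro a (∧-right {P y} q))

∈-or-∉ : ∀ {n} (P : Pred n) x → x ∈ P ⊎ x ∈ ∁ P
∈-or-∉ P x with P x
... | true  = inj₁ refl
... | false = inj₂ refl

∁-∉ : ∀ {n} {P : Pred n} {x} → x ∈ ∁ P → x ∉ P
∁-∉ = not-false

∖-∉ : ∀ {n} {P Q : Pred n} {x} → x ∈ P ∖ Q → x ∉ Q
∖-∉ {P = P} {Q} {x} h = not-false (∧-right {P x} h)

∖-intro : ∀ {n} {P Q : Pred n} {x} → x ∈ P → x ∉ Q → x ∈ P ∖ Q
∖-intro p q = ∧-intro p (not-true q)

-- Saturation in terms of sets

choose : ∀ {n} k (P : Pred n) → k ≤ # P → Σ (Fin k → Fin n) λ f → Injective _≡_ _≡_ f × (∀ i → f i ∈ P)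
choose zero    P h = (λ ()) , (λ { {()} }) , λ ()
choose (suc k) P h with #-∃ (≤-trans (s≤s z≤n) h)
... | x , p with choose k (P ∖ ⟦ x ⟧) (#-remove-≥ x h)
...   | f , inj , mem = g , g-inj , g-mem
  where
  g : Fin (suc k) → Fin _
  g zero    = x
  g (suc i) = f i
  new : ∀ i → x ≡ f i → ⊥
  new i refl = true≢false (⟦⟧-refl x) (not-false (∧-right {P (f i)} (mem i)))
  g-inj : Injective _≡_ _≡_ g
  g-inj {zero}  {zero}  _ = refl
  g-inj {zero}  {suc j} e = ⊥-elim (new j e)
  g-inj {suc i} {zero}  e = ⊥-elim (new i (sym e))
  g-inj {suc i} {suc j} e = cong suc (inj e)
  g-mem : ∀ i → g i ∈ P
  g-mem zero    = p
  g-mem (suc i) = ∧-left (mem i)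

image : ∀ {n k} → (Fin k → Fin n) → Pred n
image {k = zero}  f x = false
image {k = suc k} f   = image (λ i → f (suc i)) ∪⟦ f zero ⟧

image-∋ : ∀ {n k} (f : Fin k → Fin n) i → f i ∈ image f
image-∋ f zero    = ∪-new {P = image λ i → f (suc i)}
image-∋ f (suc i) = ∪-old {P = image λ i → f (suc i)} {f zero} (image-∋ (λ j → f (suc j)) i)

image-elim : ∀ {n k} (f : Fin k → Fin n) {x} → x ∈ image f → ∃[ i ] f i ≡ x
image-elim {k = suc k} f h with ∪-case {P = image λ i → f (suc i)} h
... | inj₂ e = zero , e
... | inj₁ p with image-elim (λ i → f (suc i)) p
...   | i , e = suc i , e

#-image : ∀ {n k} (f : Fin k → Fin n) → Injective _≡_ _≡_ f → k ≤ # (image f)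
#-image {k = zero}  f inj = z≤n
#-image {k = suc k} f inj = ≤-trans (s≤s (#-image (λ i → f (suc i)) λ e → suc-injective (inj e)))
  (≤-reflexive (sym (#-insert new)))
  where
  new : f zero ∉ image λ i → f (suc i)
  new with bool-cases (image (λ i → f (suc i)) (f zero))
  ... | inj₂ q = q
  ... | inj₁ q with image-elim (λ i → f (suc i)) q
  ...   | i , e with inj e
  ...     | ()

-- X and X′ are the sides of the copy of K_{r+1,r+2} created by the edge u y, without u and y themselves.
record Completion {n} (r : ℕ) (G : BipGraph n) (u y : Fin n) : Set where
  field
    X X′  : Pred n
    X-adj : ∀ x → x ∈ X → G x y ≡ true
    X′-adj : ∀ z → z ∈ X′ → G u z ≡ true
    cpl   : Complete G X X′
    size  : (r ≤ # X × suc r ≤ # X′) ⊎ (suc r ≤ # X × r ≤ # X′)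

-- Sets of at least the required size replace embeddings. The two freeness fields are the two
-- placements of the sides in the classes, so transposition merely exchanges them.
record Sat {n} (r : ℕ) (G : BipGraph n) : Set where
  field
    free  : ∀ X X′ → Complete G X X′ → suc r ≤ # X → 2 + r ≤ # X′ → ⊥
    freeᵀ : ∀ X X′ → Complete G X X′ → 2 + r ≤ # X → suc r ≤ # X′ → ⊥
    comp  : ∀ u y → G u y ≡ false → Completion r G u y

Completion-ᵀ : ∀ {n r} {G : BipGraph n} {u y} → Completion r G u y → Completion r (G ᵀ) y u
Completion-ᵀ c = record
  { X = X′ ; X′ = X ; X-adj = X′-adj ; X′-adj = X-adj ; cpl = λ x y p q → cpl y x q p ; size = sw size }
  where
  open Completion c
  sw : ∀ {A B C D : Set} → (A × B) ⊎ (C × D) → (D × C) ⊎ (B × A)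
  sw (inj₁ (a , b)) = inj₂ (b , a)
  sw (inj₂ (c , d)) = inj₁ (d , c)

Sat-ᵀ : ∀ {n r} {G : BipGraph n} → Sat r G → Sat r (G ᵀ)
Sat-ᵀ s = record
  { free  = λ X X′ c p q → freeᵀ X′ X (λ x y a b → c y x b a) q p
  ; freeᵀ = λ X X′ c p q → free X′ X (λ x y a b → c y x b a) q p
  ; comp  = λ u y h → Completion-ᵀ (comp y u h) }
  where open Sat s

addEdge-elim : ∀ {n} (G : BipGraph n) u y {x z} → addEdge G u y x z ≡ true → (x ≡ u × z ≡ y) ⊎ G x z ≡ true
addEdge-elim G u y {x} {z} h with x ≟ u | z ≟ y
... | yes p | yes q = inj₁ (p , q)
... | yes _ | no _  = inj₂ h
... | no _  | yes _ = inj₂ h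
... | no _  | no _  = inj₂ h

KOriented-ᵀ : ∀ {n} {G : BipGraph n} {s t} → ContainsKOriented (G ᵀ) s t → ContainsKOriented G t s
KOriented-ᵀ (f , g , fi , gi , h) = g , f , gi , fi , λ i j → h j i

module _ {n} {G : BipGraph n} {r : ℕ} (free : ¬ ContainsK G (suc r) (2 + r)) where

  complete-free : ∀ X X′ → Complete G X X′ → suc r ≤ # X → 2 + r ≤ # X′ → ⊥
  complete-free X X′ c p q with choose (suc r) X p | choose (2 + r) X′ q
  ... | f , fi , fm | g , gi , gm = free (inj₁ (f , g , fi , gi , λ i j → c _ _ (fm i) (gm j)))

  complete-freeᵀ : ∀ X X′ → Complete G X X′ → 2 + r ≤ # X → suc r ≤ # X′ → ⊥
  complete-freeᵀ X X′ c p q with choose (2 + r) X p | choose (suc r) X′ q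
  ... | f , fi , fm | g , gi , gm = free (inj₂ (g , f , gi , fi , λ i j → c _ _ (fm j) (gm i)))

record Bipartition {n} (G : BipGraph n) (u y : Fin n) (a b : ℕ) : Set where
  field
    Y Y′   : Pred n
    Y-adj  : ∀ x → x ∈ Y → G x y ≡ true
    Y′-adj : ∀ z → z ∈ Y′ → G u z ≡ true
    Ycpl   : Complete G Y Y′
    Y-size : a ≤ # Y
    Y′-size : b ≤ # Y′

-- A copy that misses `u` or `y` does not use the new edge and already lies in `G`. So both ends
-- occur in it, and deleting them leaves one vertex fewer on each side.
split-edge : ∀ {n} {G : BipGraph n} {u y a b} → ¬ ContainsKOriented G (suc a) (suc b) →
  ContainsKOriented (addEdge G u y) (suc a) (suc b) → Bipartition G u y a b
split-edge {G = G} {u} {y} {a} {b} no-K (f , g , fi , gi , h) with bool-cases (image f u) | bool-cases (image g y)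
... | inj₂ p | _ = ⊥-elim (no-K (f , g , fi , gi , λ i j → old i j))
  where
  old : ∀ i j → G (f i) (g j) ≡ true
  old i j with addEdge-elim G u y (h i j)
  ... | inj₂ q = q
  ... | inj₁ (e , _) = true≢false (subst (_∈ image f) e (image-∋ f i)) p
... | inj₁ _ | inj₂ p = ⊥-elim (no-K (f , g , fi , gi , λ i j → old i j))
  where
  old : ∀ i j → G (f i) (g j) ≡ true
  old i j with addEdge-elim G u y (h i j)
  ... | inj₂ q = q
  ... | inj₁ (_ , e) = true≢false (subst (_∈ image g) e (image-∋ g j)) p
... | inj₁ p | inj₁ q with image-elim f p | image-elim g q
...   | i₀ , ei | j₀ , ej = record
  { Y = image f ∖ ⟦ u ⟧ ; Y′ = image g ∖ ⟦ y ⟧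
  ; Y-adj = λ x m → adj₁ x m ; Y′-adj = λ z m → adj₂ z m ; Ycpl = λ x z m m′ → adj₃ x z m m′
  ; Y-size = #-remove-≥ u (#-image f fi) ; Y′-size = #-remove-≥ y (#-image g gi) }
  where
  away : ∀ {P : Pred _} {v x} → x ∈ P ∖ ⟦ v ⟧ → x ≡ v → ⊥
  away {P} {v} {x} m refl = true≢false (⟦⟧-refl x) (not-false (∧-right {P x} m))
  adj₁ : ∀ x → x ∈ image f ∖ ⟦ u ⟧ → G x y ≡ true
  adj₁ x m with image-elim f (∧-left m)
  ... | i , e with addEdge-elim G u y (h i j₀)
  ...   | inj₁ (e′ , _) = ⊥-elim (away {image f} m (trans (sym e) e′))
  ...   | inj₂ r = subst₂ (λ a b → G a b ≡ true) e ej r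
  adj₂ : ∀ z → z ∈ image g ∖ ⟦ y ⟧ → G u z ≡ true
  adj₂ z m with image-elim g (∧-left m)
  ... | j , e with addEdge-elim G u y (h i₀ j)
  ...   | inj₁ (_ , e′) = ⊥-elim (away {image g} m (trans (sym e) e′))
  ...   | inj₂ r = subst₂ (λ a b → G a b ≡ true) ei e r
  adj₃ : Complete G (image f ∖ ⟦ u ⟧) (image g ∖ ⟦ y ⟧)
  adj₃ x z m m′ with image-elim f (∧-left m) | image-elim g (∧-left m′)
  ... | i , e | j , e₂ with addEdge-elim G u y (h i j)
  ...   | inj₁ (e′ , _) = ⊥-elim (away {image f} m (trans (sym e) e′))
  ...   | inj₂ r = subst₂ (λ a b → G a b ≡ true) e e₂ r

saturated⇒Sat : ∀ {n r} {G : BipGraph n} → Saturated G (suc r) (2 + r) → Sat r G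
saturated⇒Sat {r = r} {G} (no-K , add) = record
  { free = complete-free no-K ; freeᵀ = complete-freeᵀ no-K ; comp = comp′ }
  where
  comp′ : ∀ u y → G u y ≡ false → Completion r G u y
  comp′ u y h with add u y h
  ... | inj₁ k = record { X = Y ; X′ = Y′ ; X-adj = Y-adj ; X′-adj = Y′-adj ; cpl = Ycpl ; size = inj₁ (Y-size , Y′-size) }
    where open Bipartition (split-edge {G = G} {u} {y} (λ c → no-K (inj₁ c)) k)
  ... | inj₂ k = record { X = Y ; X′ = Y′ ; X-adj = Y-adj ; X′-adj = Y′-adj ; cpl = Ycpl ; size = inj₂ (Y-size , Y′-size) }
    where open Bipartition (split-edge {G = G} {u} {y} (λ c → no-K (inj₂ (KOriented-ᵀ {G = G ᵀ} c))) (KOriented-ᵀ {G = addEdge G u y} k))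

Fam : ∀ {n} → ℕ → BipGraph n → Set
Fam {n} r G = Σ (Pred n) λ S → # S ≡ r × (∀ u → u ∈ S → ∀ y → G u y ≡ true) × (∀ u → u ∉ S → deg G full u ≡ suc r)

module _ {n} {r : ℕ} {G : BipGraph n} (sat : Sat r G) where
  open Sat sat

  nb-small : ∀ {S} → suc r ≤ # S → # (nb G S) ≤ suc r
  nb-small {S} h = ≮⇒≥ (free S (nb G S) (λ x y p q → nb-adj q p) h)

  -- A vertex with a missing edge has the side `X′` of a completion among its neighbours; a vertex
  -- without one has degree n.
  min-degree : r ≤ n → ∀ u → r ≤ deg G full u
  min-degree r≤n u with bool-cases (allB (G u))
  ... | inj₁ a = ≤-trans r≤n (≤-trans (≤-reflexive (sym (#-full n)))
    (≤-trans (#-mono {P = full} {full ∩ G u} λ y _ → allB-elim a y) (≤-reflexive (sym (deg-# G full u)))))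
  ... | inj₂ a with allB-false a
  ...   | y , q = ≤-trans (sz size) (≤-trans (#-mono {P = X′} {full ∩ G u} X′-adj) (≤-reflexive (sym (deg-# G full u))))
    where
    open Completion (comp u y q)
    sz : (r ≤ # X × suc r ≤ # X′) ⊎ (suc r ≤ # X × r ≤ # X′) → r ≤ # X′
    sz (inj₁ (_ , b)) = ≤-trans (n≤1+n r) b
    sz (inj₂ (_ , b)) = b

contra-< : ∀ {k} {A : Set} → suc k ≤ k → A
contra-< h = ⊥-elim (<-irrefl refl h)

data Inclusion {n} (P Q : Pred n) : Set where
  inside  : P ⊆ Q → Inclusion P Q
  outside : ∀ x → x ∈ P → x ∉ Q → Inclusion P Q

⊆? : ∀ {n} (P Q : Pred n) → Inclusion P Q
⊆? P Q with bool-cases (allB λ x → not (P x ∧ not (Q x)))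
... | inj₁ h = inside pt
  where
  pt : P ⊆ Q
  pt x p with bool-cases (Q x)
  ... | inj₁ q = q
  ... | inj₂ q = true≢false (∧-intro p (not-true q)) (not-false (allB-elim h x))
... | inj₂ h with allB-false h
...   | x , q = outside x (∧-left (not-not q)) (not-false (∧-right {P x} (not-not q)))
  where
  not-not : ∀ {b} → not b ≡ false → b ≡ true
  not-not {true} _ = refl

-- S dominates its common neighbourhood so tightly that any further vertex sees at most r + 1 of it.
deg-nb : ∀ {n r} {G : BipGraph n} (sat : Sat r G) {S} → # S ≡ r → ∀ {u} → u ∉ S → deg G (nb G S) u ≤ suc r
deg-nb {G = G} sat {S} hS {u} u∉S = ≤-trans (≤-reflexive (deg-# G _ u))
  (≮⇒≥ λ big → Sat.free sat (S ∪⟦ u ⟧) (nb G S ∩ G u) c (≤-reflexive (sym (trans (#-insert {P = S} u∉S) (cong suc hS)))) big)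
  where
  c : Complete G (S ∪⟦ u ⟧) (nb G S ∩ G u)
  c x y p q with ∪-case {P = S} {u} {x} p
  ... | inj₁ s    = nb-adj {G = G} {S} (∧-left q) s
  ... | inj₂ refl = ∧-right {nb G S y} q

-- Two nearly full sets

record TwoSided {n} (r : ℕ) (G : BipGraph n) (S S′ : Pred n) : Set where
  field
    sat   : Sat r G
    mind  : ∀ u → suc r ≤ deg G full u
    mind′ : ∀ y → suc r ≤ deg (G ᵀ) full y
    hS    : # S ≡ r
    hS′   : # S′ ≡ r
    cpl   : Complete G S S′
    few   : edges G ≤ r * n + suc r * (n ∸ r)
    r≤n   : r ≤ n
    large : (2 + r) * (# (∁ (nb (G ᵀ) S′)) + # (∁ (nb G S))) + r < n

TwoSided-ᵀ : ∀ {n r} {G : BipGraph n} {S S′} → TwoSided r G S S′ → TwoSided r (G ᵀ) S′ S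
TwoSided-ᵀ {n} {r} {G} {S} {S′} t = record
  { sat = Sat-ᵀ sat ; mind = mind′ ; mind′ = mind ; hS = hS′ ; hS′ = hS
  ; cpl = λ x y p q → cpl y x q p ; few = ≤-trans (≤-reflexive (edges-ᵀ G)) few ; r≤n = r≤n
  ; large = subst (λ k → (2 + r) * k + r < n) (+-comm (# (∁ (nb (G ᵀ) S′))) _) large }
  where open TwoSided t

module Core {n r} {G : BipGraph n} {S S′ : Pred n} (t : TwoSided r G S S′) where
  open TwoSided t
  F F′ E E′ F₁ F₁′ : Pred n
  F   = nb (G ᵀ) S′
  F′  = nb G S
  E   = ∁ F
  E′  = ∁ F′
  F₁  = F ∖ S
  F₁′ = F′ ∖ S′

  S⊆F : S ⊆ F
  S⊆F x p = nb-intro λ y q → cpl x y p q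

  S′⊆F′ : S′ ⊆ F′
  S′⊆F′ y q = nb-intro λ x p → cpl x y p q

  deg-F′ : ∀ {u} → u ∉ S → deg G F′ u ≤ suc r
  deg-F′ = deg-nb sat hS

  deg-F : ∀ {y} → y ∉ S′ → deg (G ᵀ) F y ≤ suc r
  deg-F = deg-nb (Sat-ᵀ sat) hS′

  F₁-S′ : ∀ {u} → u ∈ F → r ≤ deg G (F′ ∩ S′) u
  F₁-S′ {u} p = ≤-trans (≤-reflexive (sym hS′)) (⊆-deg {X = S′} (λ y q → ∧-intro (S′⊆F′ y q) q) λ y q → nb-adj {G = G ᵀ} {S′} p q)

  F₁-deg : ∀ {u} → u ∈ F₁ → r + deg G F₁′ u ≤ deg G F′ u
  F₁-deg {u} p = ≤-trans (+-monoˡ-≤ _ (F₁-S′ (∧-left p))) (≤-reflexive (sym (deg-split G F′ S′ u)))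

  -- The r vertices of `S′` already are neighbours of `u` in `F′`, and freeness allows one more. So
  -- the edges between `F₁` and `F₁′` form a matching.
  matching : ∀ {u} → u ∈ F₁ → deg G F₁′ u ≤ 1
  matching p = +-cancelˡ-≤ r _ _ (≤-trans (F₁-deg p) (≤-trans (deg-F′ (∖-∉ {P = F} {S} p)) (≤-reflexive (+-comm 1 r))))

  E∌S : ∀ {u} → u ∈ E → u ∉ S
  E∌S {u} p with bool-cases (S u)
  ... | inj₂ q = q
  ... | inj₁ q = true≢false (S⊆F u q) (∁-∉ {P = F} p)

  #F₁ : # F₁ + r + # E ≡ n
  #F₁ = trans (cong (_+ # E) (trans (+-comm (# F₁) r) (sym (trans (#-split F S) (cong (_+ # F₁) #F∩S))))) (#-∁ F)
    where
    #F∩S : # (F ∩ S) ≡ r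
    #F∩S = trans (≤-antisym (#-mono {P = F ∩ S} λ x q → ∧-right {F x} q) (#-mono {P = S} λ x q → ∧-intro (S⊆F x q) q)) hS

module Saturation {n r} {G : BipGraph n} {S S′ : Pred n} (t : TwoSided r G S S′) where
  open TwoSided t
  open Core t
  private module T = Core (TwoSided-ᵀ t)

  -- Spoiled vertices: those of `B₁` see `E′` directly, those of `B₂` have a partner that sees `E`.
  -- A vertex of `F₁` outside both has its completions confined to `S`, `S′` and its own matching
  -- edge.
  B′ : Pred n
  B′ y = F₁′ y ∧ (1 ≤ᵇ deg (G ᵀ) E y)

  B₁ B₂ : Pred n
  B₁ u = F₁ u ∧ (1 ≤ᵇ deg G E′ u)
  B₂ u = F₁ u ∧ (1 ≤ᵇ deg G B′ u)

  #B′ : # B′ ≤ suc r * # E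
  #B′ = ≤-trans (#≤∑deg G E B′ λ y q → ≤ᵇ-true⁻¹ (∧-right {F₁′ y} q))
    (≤-trans (∑[]-mono λ u p → ≤-trans (deg-mono G {B′} {F′} u (λ y q → ∧-left (∧-left q))) (deg-F′ (E∌S p))) (≤-reflexive (∑[]-const E (suc r))))

  #B₁ : # B₁ ≤ suc r * # E′
  #B₁ = ≤-trans (#≤∑deg (G ᵀ) E′ B₁ λ u p → ≤ᵇ-true⁻¹ (∧-right {F₁ u} p))
    (≤-trans (∑[]-mono λ y q → ≤-trans (deg-mono (G ᵀ) {B₁} {F} y (λ u p → ∧-left (∧-left p))) (deg-F (T.E∌S q))) (≤-reflexive (∑[]-const E′ (suc r))))

  #B₂ : # B₂ ≤ # B′
  #B₂ = ≤-trans (#≤∑deg (G ᵀ) B′ B₂ λ u p → ≤ᵇ-true⁻¹ (∧-right {F₁ u} p))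
    (≤-trans (∑[]-mono λ y q → ≤-trans (deg-mono (G ᵀ) {B₂} {F₁} y (λ u p → ∧-left p)) (T.matching (∧-left q))) (≤-reflexive (trans (∑[]-const B′ 1) (+-identityʳ _))))

  -- An exceptional vertex has at most r + 1 neighbours in the opposite common neighbourhood, so r +
  -- 1 times the number of exceptional vertices bounds the spoiled ones. The factor 2 + r in `large`
  -- also pays for removing `E` itself.
  generic : ∃[ u ] (u ∈ F₁ × u ∉ B₁ × u ∉ B₂)
  generic with #-∃ {P = (F₁ ∖ B₁) ∖ B₂} (+-cancelʳ-≤ (# B₁ + # B₂) 1 _ (≤-trans few-bad (#-∪₃′)))
    where
    arith : ∀ r n e e′ f b₁ b₂ b → b ≤ suc r * e → b₁ ≤ suc r * e′ → b₂ ≤ b → f + r + e ≡ n →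
      (2 + r) * (e + e′) + r < n → suc (b₁ + b₂) ≤ f
    arith r n e e′ f b₁ b₂ b h₁ h₂ h₃ refl h₅ = lin e′ (h₁ ⊕ h₂ ⊕ h₃ ⊕ h₅) (solve (r ∷ e ∷ e′ ∷ f ∷ b₁ ∷ b₂ ∷ b ∷ []))
    few-bad : suc (# B₁ + # B₂) ≤ # F₁
    few-bad = arith r n (# E) (# E′) (# F₁) (# B₁) (# B₂) (# B′) #B′ #B₁ #B₂ #F₁ large
    #-∪₃′ : # F₁ ≤ # ((F₁ ∖ B₁) ∖ B₂) + (# B₁ + # B₂)
    #-∪₃′ = ≤-trans (#-∪₃ {P = F₁} {(F₁ ∖ B₁) ∖ B₂} {B₁} {B₂} pt) (≤-reflexive (+-assoc (# ((F₁ ∖ B₁) ∖ B₂)) _ _))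
      where
      pt : ∀ u → u ∈ F₁ → u ∈ (F₁ ∖ B₁) ∖ B₂ ⊎ u ∈ B₁ ⊎ u ∈ B₂
      pt u p with bool-cases (B₁ u) | bool-cases (B₂ u)
      ... | inj₁ a | _      = inj₂ (inj₁ a)
      ... | inj₂ a | inj₁ b = inj₂ (inj₂ b)
      ... | inj₂ a | inj₂ b = inj₁ (∖-intro {P = F₁ ∖ B₁} {B₂} (∖-intro {P = F₁} {B₁} p a) b)
  ... | u , p = u , ∧-left (∧-left p) , ∖-∉ {P = F₁} {B₁} (∧-left p) , ∖-∉ {P = F₁ ∖ B₁} {B₂} p

  ∉B : ∀ {b c} → b ≡ true → b ∧ c ≡ false → c ≡ false
  ∉B refl h = h

  -- Complete `y` with a generic `u`. The neighbours of `u` are `S′` and a partner `z`, those of `z`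
  -- in question lie in `S` or equal `u`. If `X′` contains `z`, then `X` lies in `S`: too small, or
  -- all of `S`, which contradicts the choice of `y`. Otherwise `X′` is `S′`, and `X` supplies r + 1
  -- neighbours of `y` in `F`.
  E′-deg : ∀ {y} → y ∈ E′ → suc r ≤ deg (G ᵀ) F y
  E′-deg {y} y∈E′ with generic
  ... | u , u∈F₁ , u∉B₁ , u∉B₂ = go size
    where
    noE′ : deg G E′ u < 1
    noE′ = ≤ᵇ-false⁻¹ (∉B u∈F₁ u∉B₁)
    noB′ : deg G B′ u < 1
    noB′ = ≤ᵇ-false⁻¹ (∉B u∈F₁ u∉B₂)
    u≁y : G u y ≡ false
    u≁y with bool-cases (G u y)
    ... | inj₂ q = q
    ... | inj₁ q = ⊥-elim (<⇒≱ noE′ (deg-∈ {G = G} {E′} y∈E′ q))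
    partner : ∃[ z ] (z ∈ F₁′ × G u z ≡ true)
    partner = deg-∃ {G = G} {F₁′} (arith r (deg G full u) (deg G F′ u) (deg G E′ u) (deg G (F′ ∩ S′) u) (deg G F₁′ u)
      (mind u) (deg-split G full F′ u) (deg-split G F′ S′ u) noE′
      (≤-trans (deg≤# G _ u) (≤-trans (#-mono {P = F′ ∩ S′} λ z q → ∧-right {F′ z} q) (≤-reflexive hS′))))
      where
      arith : ∀ r d f e s g → suc r ≤ d → d ≡ f + e → f ≡ s + g → e < 1 → s ≤ r → 1 ≤ g
      arith r d f e s g h refl refl h₂ h₃ = lin 0 (h ⊕ h₂ ⊕ h₃) (solve (r ∷ e ∷ s ∷ g ∷ []))
    z = proj₁ partner
    z∈F₁′ = proj₁ (proj₂ partner)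
    u~z = proj₂ (proj₂ partner)
    z-noE : ∀ {x} → x ∈ E → G x z ≡ true → ⊥
    z-noE {x} p a = <⇒≱ noB′ (deg-∈ {G = G} {B′} (∧-intro z∈F₁′ (≤ᵇ-true (deg-∈ {G = G ᵀ} {E} p a))) u~z)
    open Completion (Sat.comp sat u y u≁y)
    X⊆S : z ∈ X′ → X ⊆ S
    X⊆S z∈X′ x p with bool-cases (S x) | ∈-or-∉ F x
    ... | inj₁ s | _ = s
    ... | inj₂ s | inj₂ e = ⊥-elim (z-noE e (Completion.cpl (Sat.comp sat u y u≁y) x z p z∈X′))
    ... | inj₂ s | inj₁ f with deg-unique {G = G ᵀ} {F₁} {z} (T.matching z∈F₁′) (∖-intro {P = F} {S} f s)
                                 (Completion.cpl (Sat.comp sat u y u≁y) x z p z∈X′) u∈F₁ u~z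
    ...   | refl = true≢false (X-adj x p) u≁y
    X′⊆S′ : z ∉ X′ → X′ ⊆ S′
    X′⊆S′ z∉X′ w q with bool-cases (S′ w) | ∈-or-∉ F′ w
    ... | inj₁ s | _ = s
    ... | inj₂ s | inj₂ e = ⊥-elim (<⇒≱ noE′ (deg-∈ {G = G} {E′} e (X′-adj w q)))
    ... | inj₂ s | inj₁ f with deg-unique {G = G} {F₁′} {u} (matching u∈F₁) (∖-intro {P = F′} {S′} f s) (X′-adj w q) z∈F₁′ u~z
    ...   | refl = true≢false q z∉X′
    go : (r ≤ # X × suc r ≤ # X′) ⊎ (suc r ≤ # X × r ≤ # X′) → suc r ≤ deg (G ᵀ) F y
    go s with bool-cases (X′ z)
    go (inj₁ (a , b)) | inj₁ z∈X′ = true≢false (nb-intro λ x p → X-adj x (#-⊆-≥ {P = X} (X⊆S z∈X′) (≤-trans (≤-reflexive hS) a) x p)) (∁-∉ {P = F′} y∈E′)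
    go (inj₂ (a , b)) | inj₁ z∈X′ = contra-< (≤-trans a (≤-trans (#-mono (X⊆S z∈X′)) (≤-reflexive hS)))
    go (inj₁ (a , b)) | inj₂ z∉X′ = contra-< (≤-trans b (≤-trans (#-mono (X′⊆S′ z∉X′)) (≤-reflexive hS′)))
    go (inj₂ (a , b)) | inj₂ z∉X′ = ≤-trans a (⊆-deg {G = G ᵀ} {X} {F}
      (λ x p → nb-intro λ w q → Completion.cpl (Sat.comp sat u y u≁y) x w p (#-⊆-≥ {P = X′} (X′⊆S′ z∉X′) (≤-trans (≤-reflexive hS′) b) w q)) X-adj)

module Counting {n r} {G : BipGraph n} {S S′ : Pred n} (t : TwoSided r G S S′) where
  open TwoSided t
  open Core t
  private
    module A = Saturation t
    module Aᵀ = Saturation (TwoSided-ᵀ t)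

  M : Pred n
  M u = F₁ u ∧ not (1 ≤ᵇ deg G F₁′ u)

  -- Five disjoint groups of edges: from `S` to `F′`, `F₁` to `F′`, `F` to `E′`, `E` to `F′`, and
  -- `E` to `E′`.
  edges≥ : r * # F′ + (r * # F₁ + ∑[ F₁ ] (deg G F₁′)) + suc r * # E′ + suc r * # E + ∑[ E ] (deg G E′) ≤ edges G
  edges≥ = begin
    r * # F′ + (r * # F₁ + ∑[ F₁ ] (deg G F₁′)) + suc r * # E′ + suc r * # E + ∑[ E ] (deg G E′)
      ≤⟨ sF ⊕ sF₁ ⊕ sE′ ⊕ sE ⊕ ≤-refl ⟩
    ∑[ F ∩ S ] (deg G F′) + ∑[ F₁ ] (deg G F′) + ∑[ F ] (deg G E′) + ∑[ E ] (deg G F′) + ∑[ E ] (deg G E′)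
      ≡⟨ reassoc (∑[ F ∩ S ] (deg G F′)) (∑[ F₁ ] (deg G F′)) (∑[ F ] (deg G E′)) (∑[ E ] (deg G F′)) (∑[ E ] (deg G E′)) (∑[]-split F S (deg G F′)) ⟩
    ∑[ F ] (deg G F′) + ∑[ F ] (deg G E′) + (∑[ E ] (deg G F′) + ∑[ E ] (deg G E′))
      ≡⟨ sym (cong₂ _+_ (trans (∑[]-cong λ u _ → deg-split G full F′ u) (∑[]-+ F _ _)) (trans (∑[]-cong λ u _ → deg-split G full F′ u) (∑[]-+ E _ _))) ⟩
    ∑[ F ] (deg G full) + ∑[ E ] (deg G full)
      ≡⟨ sym (trans (edges-deg G) (∑[]-split full F _)) ⟩
    edges G ∎
    where
    open ≤-Reasoning
    reassoc : ∀ a b c d e {s} → s ≡ a + b → a + b + c + d + e ≡ s + c + (d + e)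
    reassoc a b c d e refl = solve (a ∷ b ∷ c ∷ d ∷ e ∷ [])
    sF : r * # F′ ≤ ∑[ F ∩ S ] (deg G F′)
    sF = begin
      r * # F′                          ≡⟨ trans (*-comm r _) (cong (# F′ *_) (sym hS)) ⟩
      # F′ * # S                        ≤⟨ *-monoʳ-≤ (# F′) (#-mono {P = S} λ x q → ∧-intro (S⊆F x q) q) ⟩
      # F′ * # (F ∩ S)                  ≡⟨ sym (∑[]-const (F ∩ S) (# F′)) ⟩
      ∑[ F ∩ S ] (λ _ → # F′)           ≤⟨ ∑[]-mono (λ x p → ⊆-deg {G = G} {F′} (λ _ q → q) λ y q → nb-adj {G = G} {S} q (∧-right {F x} p)) ⟩
      ∑[ F ∩ S ] (deg G F′)             ∎
    sF₁ : r * # F₁ + ∑[ F₁ ] (deg G F₁′) ≤ ∑[ F₁ ] (deg G F′)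
    sF₁ = begin
      r * # F₁ + ∑[ F₁ ] (deg G F₁′)             ≡⟨ cong (_+ ∑[ F₁ ] (deg G F₁′)) (sym (∑[]-const F₁ r)) ⟩
      ∑[ F₁ ] (λ _ → r) + ∑[ F₁ ] (deg G F₁′)    ≡⟨ sym (∑[]-+ F₁ _ _) ⟩
      ∑[ F₁ ] (λ u → r + deg G F₁′ u)            ≤⟨ ∑[]-mono (λ u p → F₁-deg p) ⟩
      ∑[ F₁ ] (deg G F′)                         ∎
    sE′ : suc r * # E′ ≤ ∑[ F ] (deg G E′)
    sE′ = begin
      suc r * # E′               ≡⟨ sym (∑[]-const E′ (suc r)) ⟩
      ∑[ E′ ] (λ _ → suc r)      ≤⟨ ∑[]-mono (λ y q → A.E′-deg q) ⟩
      ∑[ E′ ] (deg (G ᵀ) F)      ≡⟨ sym (handshake G F E′) ⟩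
      ∑[ F ] (deg G E′)          ∎
    sE : suc r * # E ≤ ∑[ E ] (deg G F′)
    sE = ≤-trans (≤-reflexive (sym (∑[]-const E (suc r)))) (∑[]-mono λ u p → Aᵀ.E′-deg p)

  -- Relative to the allowed number of edges, every vertex of `E′` and every edge between `E` and
  -- `E′` costs one too many. Only a vertex of `F₁` that lacks its matching edge saves one.
  #M : # E′ + ∑[ E ] (deg G E′) ≤ # M
  #M = arith r (# F′) (# F₁) (# E′) (# E) n (n ∸ r) (edges G) (∑[ F₁ ] (deg G F₁′)) (∑[ E ] (deg G E′)) (# M) (# F₁⁺)
      edges≥ few #F₁ (#-∁ F′) (m∸n+n≡m r≤n) split matched
    where
    F₁⁺ : Pred n
    F₁⁺ u = F₁ u ∧ (1 ≤ᵇ deg G F₁′ u)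
    split : # F₁ ≤ # M + # F₁⁺
    split = #-∪ {P = F₁} {M} {F₁⁺} pt
      where
      pt : ∀ u → u ∈ F₁ → u ∈ M ⊎ u ∈ F₁⁺
      pt u p with bool-cases (1 ≤ᵇ deg G F₁′ u)
      ... | inj₁ q = inj₂ (∧-intro p q)
      ... | inj₂ q = inj₁ (∧-intro p (not-true q))
    matched : # F₁⁺ ≤ ∑[ F₁ ] (deg G F₁′)
    matched = begin
      # F₁⁺                     ≡⟨ sym (trans (∑[]-const F₁⁺ 1) (+-identityʳ _)) ⟩
      ∑[ F₁⁺ ] (λ _ → 1)        ≤⟨ ∑[]-mono (λ u p → ≤ᵇ-true⁻¹ (∧-right {F₁ u} p)) ⟩
      ∑[ F₁⁺ ] (deg G F₁′)      ≤⟨ ∑[]-⊆ {P = F₁⁺} {F₁} _ (λ u → ∧-left) ⟩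
      ∑[ F₁ ] (deg G F₁′)       ∎
      where open ≤-Reasoning
    arith : ∀ r f′ f₁ e′ e n k d μ ee m p → r * f′ + (r * f₁ + μ) + suc r * e′ + suc r * e + ee ≤ d →
      d ≤ r * n + suc r * k → f₁ + r + e ≡ n → f′ + e′ ≡ n → k + r ≡ n → f₁ ≤ m + p → p ≤ μ → e′ + ee ≤ m
    arith r f′ f₁ e′ e n k d μ ee m p h₁ h₂ n₁ n₂ n₃ h₃ h₄ with +-cancelʳ-≡ r k (f₁ + e) (trans n₃ (trans (sym n₁) (shift f₁ r e)))
      where
      shift : ∀ a b c → a + b + c ≡ a + c + b
      shift = solve-∀
    arith r f′ f₁ e′ e n k d μ ee m p h₁ h₂ n₁ refl n₃ h₃ h₄ | refl =
      lin 0 (h₁ ⊕ h₂ ⊕ h₃ ⊕ h₄) (solve (r ∷ f′ ∷ f₁ ∷ e′ ∷ e ∷ d ∷ μ ∷ ee ∷ m ∷ p ∷ []))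

module Contradiction {n r} {G : BipGraph n} {S S′ : Pred n} (t : TwoSided r G S S′) where
  open TwoSided t
  open Core t
  private
    module T = Core (TwoSided-ᵀ t)
    module C = Counting t
    module Cᵀ = Counting (TwoSided-ᵀ t)

  -- The vertices of `E′` that can occur in `X′` when two unmatched vertices are completed: the at
  -- least r vertices of `X` then come from `S` and `E`.
  Y′ : Pred n
  Y′ y = E′ y ∧ (r ≤ᵇ (deg (G ᵀ) S y + deg (G ᵀ) E y))

  isolated : ∀ {b d} → b ∧ not (1 ≤ᵇ d) ≡ true → 1 ≤ d → ⊥
  isolated {b} h p = true≢false (≤ᵇ-true p) (not-false (∧-right {b} h))

  -- Without matching edges, `X` lies in `S` and `E`, and `X′` in `S′` and `E′`. If `X` lay in `S`
  -- it would be all of `S`, and a vertex of `X′` in `E′` would see all of `S`. So `X` meets `E`,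
  -- and some vertex of `S′` is absent from `X′`. When `X′` has r + 1 vertices, two of them must
  -- then come from `E′`; when it has r, one does, but `X` has r + 1.
  trapped : ∀ {u z} → u ∈ C.M → z ∈ Cᵀ.M →
    (1 ≤ deg G Y′ u) × (2 ≤ deg G Y′ u ⊎ ∃[ y ] (y ∈ Y′ × suc r ≤ deg (G ᵀ) S y + deg (G ᵀ) E y))
  trapped {u} {z} u∈M z∈M = go size
    where
    u≁z : G u z ≡ false
    u≁z with bool-cases (G u z)
    ... | inj₂ q = q
    ... | inj₁ q = ⊥-elim (isolated {F₁ u} u∈M (deg-∈ {G = G} {F₁′} (∧-left z∈M) q))
    c = Sat.comp sat u z u≁z
    open Completion c hiding (cpl)
    X-loc : ∀ x → x ∈ X → x ∉ S → x ∈ E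
    X-loc x p s with ∈-or-∉ F x
    ... | inj₂ e = e
    ... | inj₁ f = ⊥-elim (isolated {F₁′ z} z∈M (deg-∈ {G = G ᵀ} {F₁} (∖-intro {P = F} {S} f s) (X-adj x p)))
    X′-loc : ∀ y → y ∈ X′ → y ∉ S′ → y ∈ E′
    X′-loc y p s with ∈-or-∉ F′ y
    ... | inj₂ e = e
    ... | inj₁ f = ⊥-elim (isolated {F₁ u} u∈M (deg-∈ {G = G} {F₁′} (∖-intro {P = F′} {S′} f s) (X′-adj y p)))
    X-count : ∀ {y} → y ∈ X′ → # X ≤ deg (G ᵀ) S y + deg (G ᵀ) E y
    X-count {y} q = ≤-trans (⊆-deg {G = G ᵀ} {X} {X} (λ _ p → p) λ x p → Completion.cpl c x y p q)
      (deg-∪ (G ᵀ) y λ x p _ → pt x p)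
      where
      pt : ∀ x → x ∈ X → x ∈ S ⊎ x ∈ E
      pt x p with bool-cases (S x)
      ... | inj₁ s = inj₁ s
      ... | inj₂ s = inj₂ (X-loc x p s)
    inY′ : r ≤ # X → ∀ y → y ∈ X′ → y ∉ S′ → y ∈ Y′
    inY′ h y q s = ∧-intro (X′-loc y q s) (≤ᵇ-true (≤-trans h (X-count q)))
    missing : ∀ x → x ∈ X → x ∉ S → ∃[ y ] (y ∈ S′ × y ∉ X′)
    missing x p s with nb-false {G = G ᵀ} {S′} (∁-∉ {P = F} (X-loc x p s))
    ... | y , q , a with bool-cases (X′ y)
    ...   | inj₂ b = y , q , b
    ...   | inj₁ b = true≢false (Completion.cpl c x y p b) a
    two : r ≤ # X → suc r ≤ # X′ → ∃[ y ] (y ∈ S′ × y ∉ X′) → 2 ≤ deg G Y′ u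
    two a b (y , q , q′) = ≤-trans (+-cancelˡ-≤ (# (X′ ∩ S′)) 2 _ (begin
        # (X′ ∩ S′) + 2              ≡⟨ +-comm _ 2 ⟩
        suc (suc (# (X′ ∩ S′)))      ≤⟨ s≤s (s≤s (#-mono {P = X′ ∩ S′} {S′ ∖ ⟦ y ⟧} sub)) ⟩
        suc (suc (# (S′ ∖ ⟦ y ⟧)))   ≡⟨ cong suc (sym (#-remove y q)) ⟩
        suc (# S′)                   ≡⟨ cong suc hS′ ⟩
        suc r                        ≤⟨ b ⟩
        # X′                         ≡⟨ #-split X′ S′ ⟩
        # (X′ ∩ S′) + # (X′ ∖ S′)    ∎))
      (⊆-deg {G = G} {X′ ∖ S′} (λ w m → inY′ a w (∧-left m) (∖-∉ {P = X′} {S′} m)) λ w m → X′-adj w (∧-left m))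
      where
      open ≤-Reasoning
      sub : X′ ∩ S′ ⊆ S′ ∖ ⟦ y ⟧
      sub w m = ∖-intro {P = S′} {⟦ y ⟧} (∧-right {X′ w} m) (⟦⟧-≢ {x = y} {w} λ { refl → true≢false (∧-left m) q′ })
    go : (r ≤ # X × suc r ≤ # X′) ⊎ (suc r ≤ # X × r ≤ # X′) →
      (1 ≤ deg G Y′ u) × (2 ≤ deg G Y′ u ⊎ ∃[ y ] (y ∈ Y′ × suc r ≤ deg (G ᵀ) S y + deg (G ᵀ) E y))
    go (inj₁ (a , b)) with ⊆? X S
    ... | outside x p s = ≤-trans (s≤s z≤n) d , inj₁ d
      where d = two a b (missing x p s)
    ... | inside h with ⊆? X′ S′
    ...   | inside h′ = contra-< (≤-trans b (≤-trans (#-mono h′) (≤-reflexive hS′)))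
    ...   | outside y q s = true≢false
      (nb-intro λ x p → Completion.cpl c x y (#-⊆-≥ {P = X} h (≤-trans (≤-reflexive hS) a) x p) q) (∁-∉ {P = F′} (X′-loc y q s))
    go (inj₂ (a , b)) with ⊆? X S
    ... | inside h = contra-< (≤-trans a (≤-trans (#-mono h) (≤-reflexive hS)))
    ... | outside x p s with ⊆? X′ S′
    ...   | outside y q s′ = deg-∈ {G = G} {Y′} y∈Y′ (X′-adj y q) , inj₂ (y , y∈Y′ , ≤-trans a (X-count q))
      where y∈Y′ = inY′ (≤-trans (n≤1+n r) a) y q s′
    ...   | inside h with missing x p s
    ...     | y , q , q′ = true≢false (#-⊆-≥ {P = X′} h (≤-trans (≤-reflexive hS′) b) y q) q′

  -- Of the at most r + 1 neighbours of `y` in `F`, those in `S` are at least r minus the neighbours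
  -- in `E`; the unmatched ones are among the rest.
  Y′-deg : ∀ y → y ∈ Y′ → deg (G ᵀ) C.M y ≤ 1 + deg (G ᵀ) E y
  Y′-deg y q = arith r (deg (G ᵀ) S y) (deg (G ᵀ) E y) (deg (G ᵀ) F y) (deg (G ᵀ) (F ∩ S) y) (deg (G ᵀ) F₁ y) (deg (G ᵀ) C.M y)
    (≤ᵇ-true⁻¹ (∧-right {E′ y} q)) (deg-F (T.E∌S (∧-left q))) (deg-split (G ᵀ) F S y)
    (deg-mono (G ᵀ) {S} {F ∩ S} y λ x p → ∧-intro (S⊆F x p) p) (deg-mono (G ᵀ) {C.M} {F₁} y λ x p → ∧-left p)
    where
    arith : ∀ r s e f s₁ f₁ m → r ≤ s + e → f ≤ suc r → f ≡ s₁ + f₁ → s ≤ s₁ → m ≤ f₁ → m ≤ 1 + e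
    arith r s e f s₁ f₁ m h₁ h₂ refl h₃ h₄ = lin 0 (h₁ ⊕ h₂ ⊕ h₃ ⊕ h₄) (solve (r ∷ s ∷ e ∷ s₁ ∷ f₁ ∷ m ∷ []))

  Y′-deg-strict : ∀ {y} → y ∈ Y′ → suc r ≤ deg (G ᵀ) S y + deg (G ᵀ) E y → deg (G ᵀ) C.M y < 1 + deg (G ᵀ) E y
  Y′-deg-strict {y} q h = arith r (deg (G ᵀ) S y) (deg (G ᵀ) E y) (deg (G ᵀ) F y) (deg (G ᵀ) (F ∩ S) y) (deg (G ᵀ) F₁ y) (deg (G ᵀ) C.M y)
    h (deg-F (T.E∌S (∧-left q))) (deg-split (G ᵀ) F S y)
    (deg-mono (G ᵀ) {S} {F ∩ S} y λ x p → ∧-intro (S⊆F x p) p) (deg-mono (G ᵀ) {C.M} {F₁} y λ x p → ∧-left p)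
    where
    arith : ∀ r s e f s₁ f₁ m → suc r ≤ s + e → f ≤ suc r → f ≡ s₁ + f₁ → s ≤ s₁ → m ≤ f₁ → m < 1 + e
    arith r s e f s₁ f₁ m h₁ h₂ refl h₃ h₄ = lin 0 (h₁ ⊕ h₂ ⊕ h₃ ⊕ h₄) (solve (r ∷ s ∷ e ∷ s₁ ∷ f₁ ∷ m ∷ []))

  Y′-total : ∑[ Y′ ] (λ y → 1 + deg (G ᵀ) E y) ≤ # C.M
  Y′-total = begin
    ∑[ Y′ ] (λ y → 1 + deg (G ᵀ) E y)          ≤⟨ ∑[]-⊆ {P = Y′} {E′} _ (λ y → ∧-left) ⟩
    ∑[ E′ ] (λ y → 1 + deg (G ᵀ) E y)          ≡⟨ ∑[]-+ E′ _ _ ⟩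
    ∑[ E′ ] (λ _ → 1) + ∑[ E′ ] (deg (G ᵀ) E)  ≡⟨ cong₂ _+_ (trans (∑[]-const E′ 1) (+-identityʳ _)) (sym (handshake G E E′)) ⟩
    # E′ + ∑[ E ] (deg G E′)                   ≤⟨ C.#M ⟩
    # C.M                                      ∎
    where open ≤-Reasoning

  -- Edges between the unmatched vertices and `Y′`, counted from either side, are at least and at
  -- most the number of unmatched vertices. Each alternative makes one of the two estimates strict.
  slack : ∀ {u z} → u ∈ C.M → z ∈ Cᵀ.M → 2 ≤ deg G Y′ u ⊎ ∃[ y ] (y ∈ Y′ × suc r ≤ deg (G ᵀ) S y + deg (G ᵀ) E y) → ⊥
  slack {u} {z} u∈M z∈M (inj₁ d) = <-irrefl refl (begin-strict
    # C.M                                ≡⟨ sym (trans (∑[]-const C.M 1) (+-identityʳ _)) ⟩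
    ∑[ C.M ] (λ _ → 1)                   <⟨ ∑[]-strict (λ v p → proj₁ (trapped p z∈M)) u∈M d ⟩
    ∑[ C.M ] (deg G Y′)                  ≡⟨ handshake G C.M Y′ ⟩
    ∑[ Y′ ] (deg (G ᵀ) C.M)              ≤⟨ ∑[]-mono Y′-deg ⟩
    ∑[ Y′ ] (λ y → 1 + deg (G ᵀ) E y)    ≤⟨ Y′-total ⟩
    # C.M                                ∎)
    where open ≤-Reasoning
  slack {u} {z} u∈M z∈M (inj₂ (y , y∈Y′ , d)) = <-irrefl refl (begin-strict
    # C.M                                ≡⟨ sym (trans (∑[]-const C.M 1) (+-identityʳ _)) ⟩
    ∑[ C.M ] (λ _ → 1)                   ≤⟨ ∑[]-mono (λ v p → proj₁ (trapped p z∈M)) ⟩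
    ∑[ C.M ] (deg G Y′)                  ≡⟨ handshake G C.M Y′ ⟩
    ∑[ Y′ ] (deg (G ᵀ) C.M)              <⟨ ∑[]-strict Y′-deg y∈Y′ (Y′-deg-strict y∈Y′ d) ⟩
    ∑[ Y′ ] (λ y → 1 + deg (G ᵀ) E y)    ≤⟨ Y′-total ⟩
    # C.M                                ∎)
    where open ≤-Reasoning

  impossible : 1 ≤ # E → 1 ≤ # E′ → ⊥
  impossible hE hE′ = slack (proj₂ u) (proj₂ z) (proj₂ (trapped (proj₂ u) (proj₂ z)))
    where
    u : ∃[ u ] u ∈ C.M
    u = #-∃ (≤-trans hE′ (≤-trans (m≤m+n _ _) C.#M))
    z : ∃[ z ] z ∈ Cᵀ.M
    z = #-∃ (≤-trans hE (≤-trans (m≤m+n _ _) Cᵀ.#M))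

scan : ∀ {n} {A : Set} {B : Fin n → Set} (P : Pred n) → (∀ x → x ∈ P → A ⊎ B x) → A ⊎ (∀ x → x ∈ P → B x)
scan {zero} P f = inj₂ λ ()
scan {suc n} {A} {B} P f with scan {n} {A} {λ x → B (suc x)} (λ x → P (suc x)) (λ x → f (suc x))
... | inj₁ a = inj₁ a
... | inj₂ g with P zero in eq
...   | false = inj₂ λ { zero p → true≢false p eq ; (suc x) p → g x p }
...   | true with f zero eq
...     | inj₁ a = inj₁ a
...     | inj₂ b = inj₂ λ { zero _ → b ; (suc x) p → g x p }

#-disjoint : ∀ {n} {A B P : Pred n} → A ⊆ P → B ⊆ P → (∀ x → x ∈ A → x ∉ B) → # A + # B ≤ # P
#-disjoint {A = A} {B} {P} a b d = begin
  # A + # B                  ≤⟨ #-mono {P = A} (λ x p → ∧-intro (a x p) p) ⊕ #-mono {P = B} (λ x p → ∖-intro {P = P} {A} (b x p) (out x p)) ⟩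
  # (P ∩ A) + # (P ∖ A)      ≡⟨ sym (#-split P A) ⟩
  # P                        ∎
  where
  open ≤-Reasoning
  out : ∀ x → x ∈ B → x ∉ A
  out x p with bool-cases (A x)
  ... | inj₂ q = q
  ... | inj₁ q = true≢false p (d x q)

#-overlap : ∀ {n} {A B P Q : Pred n} → A ⊆ P → B ⊆ P → A ∩ B ⊆ Q → # A + # B ≤ # P + # Q
#-overlap {A = A} {B} {P} {Q} a b i = begin
  # A + # B                          ≡⟨ cong (# A +_) (trans (#-split B A) (+-comm (# (B ∩ A)) _)) ⟩
  # A + (# (B ∖ A) + # (B ∩ A))      ≡⟨ sym (+-assoc (# A) _ _) ⟩
  # A + # (B ∖ A) + # (B ∩ A)        ≤⟨ #-disjoint {A = A} {B ∖ A} a (λ x p → b x (∧-left p)) (λ x p → trans (cong (λ a → B x ∧ not a) p) (∧-zeroʳ (B x))) ⊕ #-mono {P = B ∩ A} (λ x p → i x (∧-intro (∧-right {B x} p) (∧-left p))) ⟩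
  # P + # Q                          ∎
  where
  open ≤-Reasoning

-- One nearly full set

record OneSided {n} (r : ℕ) (G : BipGraph n) (S : Pred n) : Set where
  field
    sat   : Sat r G
    mind  : ∀ u → suc r ≤ deg G full u
    hS    : # S ≡ r
    few   : edges G ≤ r * n + suc r * (n ∸ r)
    r≤n   : r ≤ n
    large : 2 * (suc (r + r * r) * # (∁ (nb G S)) + suc r) + 2 < n

record Dual {n} (r : ℕ) (G : BipGraph n) (S : Pred n) (c : ℕ) : Set where
  field
    S′  : Pred n
    hS′ : # S′ ≡ r
    cpl : Complete G S S′
    bound : # (∁ (nb (G ᵀ) S′)) ≤ c

module Dualise {n r} {G : BipGraph n} {S : Pred n} (o : OneSided r G S) where
  open OneSided o

  -- Vertices of `T` attain the minimum degree, so a side of r + 1 vertices in a completion is their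
  -- whole neighbourhood. `Q` collects the vertices outside `S` with surplus degree.
  F′ E′ Q T : Pred n
  F′ = nb G S
  E′ = ∁ F′
  Q u = not (S u) ∧ (2 + r ≤ᵇ deg G full u)
  T u = not (S u) ∧ not (2 + r ≤ᵇ deg G full u)

  d : Fin n → ℕ
  d = deg G full

  e′ c : ℕ
  e′ = # E′
  -- Twice the number of vertices that `V-large` allows to be missing from `V`: double counting with
  -- weight two turns a loss in `V` into at most twice that loss in `Fp`.
  c = 2 * (suc (r + r * r) * e′ + suc r)

  T∌S : ∀ {u} → u ∈ T → u ∉ S
  T∌S p = not-false (∧-left p)

  Q∌S : ∀ {u} → u ∈ Q → u ∉ S
  Q∌S p = not-false (∧-left p)

  T-deg : ∀ {u} → u ∈ T → d u ≤ suc r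
  T-deg {u} p = ≤-pred (≤ᵇ-false⁻¹ (not-false (∧-right {not (S u)} p)))

  Q-deg : ∀ {u} → u ∈ Q → 2 + r ≤ d u
  Q-deg {u} p = ≤ᵇ-true⁻¹ (∧-right {not (S u)} p)

  deg-F′ : ∀ {u} → u ∉ S → deg G F′ u ≤ suc r
  deg-F′ = deg-nb sat hS

  T-or-Q : ∀ u → u ∉ S → u ∈ T ⊎ u ∈ Q
  T-or-Q u s with bool-cases (2 + r ≤ᵇ d u)
  ... | inj₁ q = inj₂ (∧-intro (not-true s) q)
  ... | inj₂ q = inj₁ (∧-intro (not-true s) (not-true q))

  σ : ℕ
  σ = ∑[ E′ ] (deg (G ᵀ) S)

  #∁S : # (∁ S) ≡ n ∸ r
  #∁S = trans (sym (m+n∸m≡n (# S) _)) (cong₂ _∸_ (#-∁ S) hS)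

  #Q+#T : # Q + # T ≡ n ∸ r
  #Q+#T = trans (sym (#-split (∁ S) λ u → 2 + r ≤ᵇ d u)) #∁S

  -- The edges from `S` to `F′` and degree r + 1 on `T` are already accounted for. What is left for
  -- the edges from `S` to `E′` and for `Q` is r per vertex of `E′` and r + 1 per vertex of `Q`.
  excess : σ + ∑[ Q ] d ≤ r * e′ + suc r * # Q
  excess = arith r n (n ∸ r) (# F′) e′ (# Q) (# T) σ (∑[ S ] d) (∑[ Q ] d) (∑[ T ] d) (edges G) dS dT few
      (trans (edges-deg G) (trans (∑[]-split full S d) (cong (∑[ S ] d +_) (∑[]-split (∁ S) (λ u → 2 + r ≤ᵇ d u) d)))) (#-∁ F′) #Q+#T
    where
    open ≤-Reasoning
    dS : r * # F′ + σ ≤ ∑[ S ] d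
    dS = begin
      r * # F′ + σ                                  ≡⟨ cong₂ _+_ (trans (cong (_* # F′) (sym hS)) (trans (*-comm (# S) _) (sym (∑[]-const S (# F′))))) (sym (handshake G S E′)) ⟩
      ∑[ S ] (λ _ → # F′) + ∑[ S ] (deg G E′)       ≤⟨ ∑[]-mono (λ x p → ⊆-deg {G = G} {F′} (λ _ q → q) λ y q → nb-adj {G = G} {S} q p) ⊕ ≤-refl ⟩
      ∑[ S ] (deg G F′) + ∑[ S ] (deg G E′)         ≡⟨ sym (trans (∑[]-cong λ x _ → deg-split G full F′ x) (∑[]-+ S _ _)) ⟩
      ∑[ S ] d                                      ∎
    dT : suc r * # T ≤ ∑[ T ] d
    dT = ≤-trans (≤-reflexive (sym (∑[]-const T (suc r)))) (∑[]-mono λ u _ → mind u)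
    arith : ∀ r n k f e q t σ a b c g → r * f + σ ≤ a → suc r * t ≤ c → g ≤ r * n + suc r * k →
      g ≡ a + (b + c) → f + e ≡ n → q + t ≡ k → σ + b ≤ r * e + suc r * q
    arith r n k f e q t σ a b c g h₁ h₂ h₃ refl refl refl = lin 0 (h₁ ⊕ h₂ ⊕ h₃) (solve (r ∷ f ∷ e ∷ q ∷ t ∷ σ ∷ a ∷ b ∷ c ∷ []))

  #Q : # Q ≤ r * e′
  #Q = arith r e′ (# Q) σ (∑[ Q ] d) excess (≤-trans (≤-reflexive (sym (∑[]-const Q (2 + r)))) (∑[]-mono λ u p → Q-deg p))
    where
    arith : ∀ r e q σ b → σ + b ≤ r * e + suc r * q → (2 + r) * q ≤ b → q ≤ r * e
    arith r e q σ b h₁ h₂ = lin σ (h₁ ⊕ h₂) (solve (r ∷ e ∷ q ∷ σ ∷ b ∷ []))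

  S⊆X⇒∉E′ : ∀ {y X} → r ≤ # X → X ⊆ S → (∀ x → x ∈ X → G x y ≡ true) → y ∈ E′ → ⊥
  S⊆X⇒∉E′ {y} {X} h s a e = true≢false (nb-intro {G = G} {S} λ x p → a x (#-⊆-≥ {P = X} s (≤-trans (≤-reflexive hS) h) x p)) (∁-∉ {P = F′} e)

  -- Here some `b` of `T` spends an edge on `E′`, so at most r of its neighbours lie in `F′`. These
  -- neighbours are the candidate for the dual set.
  module Attached {b} (b∈T : b ∈ T) (b~E′ : 1 ≤ deg G E′ b) where
    P′ V Fp : Pred n
    P′ = F′ ∩ G b
    V y = (F′ y ∧ not (1 ≤ᵇ deg (G ᵀ) Q y)) ∧ not (G b y)
    -- The second conjunct does not depend on `w`: it empties `Fp` when `P′` has fewer than r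
    -- vertices, so that one member of `Fp` certifies the size of `P′`.
    Fp w = nb (G ᵀ) P′ w ∧ (r ≤ᵇ # P′)

    R : BipGraph n
    R w y = (T w ∧ (r ≤ᵇ deg G (G b) w)) ∧ G w y

    #P′ : # P′ ≤ r
    #P′ = +-cancelʳ-≤ 1 _ _ (begin
      # P′ + 1                     ≤⟨ ≤-reflexive (sym (deg-# G F′ b)) ⊕ b~E′ ⟩
      deg G F′ b + deg G E′ b      ≡⟨ sym (deg-split G full F′ b) ⟩
      d b                          ≤⟨ T-deg b∈T ⟩
      suc r                        ≡⟨ +-comm 1 r ⟩
      r + 1                        ∎)
      where open ≤-Reasoning

    -- Losses: e′ for `E′`, at most (r + 1) r e′ for the neighbours of `Q`, and r + 1 for those of
    -- `b`.
    V-large : n ≤ # V + (suc (r + r * r) * e′ + suc r)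
    V-large = arith r n e′ (# Q) (# F′) (# V) (# VQ) (# Vb) (#-∁ F′) (#-∪₃ {P = F′} {V} {VQ} {Vb} pt) #VQ #Vb #Q
      where
      VQ Vb : Pred n
      VQ y = F′ y ∧ (1 ≤ᵇ deg (G ᵀ) Q y)
      Vb y = full y ∧ G b y
      pt : ∀ y → y ∈ F′ → y ∈ V ⊎ y ∈ VQ ⊎ y ∈ Vb
      pt y p with bool-cases (1 ≤ᵇ deg (G ᵀ) Q y) | bool-cases (G b y)
      ... | inj₁ q | _      = inj₂ (inj₁ (∧-intro p q))
      ... | inj₂ q | inj₁ a = inj₂ (inj₂ a)
      ... | inj₂ q | inj₂ a = inj₁ (∧-intro (∧-intro p (not-true q)) (not-true a))
      #VQ : # VQ ≤ suc r * # Q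
      #VQ = ≤-trans (#≤∑deg G Q VQ λ y q → ≤ᵇ-true⁻¹ (∧-right {F′ y} q))
        (≤-trans (∑[]-mono λ u p → ≤-trans (deg-mono G {VQ} {F′} u (λ y q → ∧-left q)) (deg-F′ (Q∌S p))) (≤-reflexive (∑[]-const Q (suc r))))
      #Vb : # Vb ≤ suc r
      #Vb = ≤-trans (≤-reflexive (sym (deg-# G full b))) (T-deg b∈T)
      arith : ∀ r n e q f v vq vb → f + e ≡ n → f ≤ v + vq + vb → vq ≤ suc r * q → vb ≤ suc r → q ≤ r * e →
        n ≤ v + (suc (r + r * r) * e + suc r)
      arith r n e q f v vq vb refl h₁ h₂ h₃ h₄ = lin 0 (h₁ ⊕ h₂ ⊕ h₃ ⊕ suc r ⊗ h₄) (solve (r ∷ e ∷ q ∷ f ∷ v ∷ vq ∷ vb ∷ []))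

    -- Such a `w` has degree at most r + 1 and shares r neighbours with `b`, while `V` avoids the
    -- neighbours of `b`.
    R-deg : ∀ w → deg R V w ≤ 1
    R-deg w with bool-cases (T w ∧ (r ≤ᵇ deg G (G b) w))
    ... | inj₂ q = ≤-trans (≤-reflexive (trans (deg-# R V w) (#-none λ y → none y))) z≤n
      where
      none : ∀ y → (V ∩ R w) y ≡ false
      none y rewrite q with V y
      ... | true  = refl
      ... | false = refl
      #-none : ∀ {P : Pred n} → (∀ y → P y ≡ false) → # P ≡ 0
      #-none {P} h with # P in eq
      ... | zero = refl
      ... | suc k with #-∃ {P = P} (≤-trans (s≤s z≤n) (≤-reflexive (sym eq)))
      ...   | x , p = true≢false p (h x)
    ... | inj₁ q = +-cancelˡ-≤ r _ _ (begin
      r + deg R V w                                       ≤⟨ ≤ᵇ-true⁻¹ (∧-right {T w} q) ⊕ sub ⟩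
      deg G (G b) w + deg G (∁ (G b)) w                   ≡⟨ sym (deg-split G full (G b) w) ⟩
      d w                                                 ≤⟨ T-deg (∧-left q) ⟩
      suc r                                               ≡⟨ +-comm 1 r ⟩
      r + 1                                               ∎)
      where
      open ≤-Reasoning
      sub : deg R V w ≤ deg G (∁ (G b)) w
      sub = ≤-trans (≤-reflexive (deg-# R V w)) (⊆-deg {G = G} {V ∩ R w}
        (λ y p → ∧-right {F′ y ∧ not (1 ≤ᵇ deg (G ᵀ) Q y)} (∧-left p)) λ y p → ∧-right {T w ∧ (r ≤ᵇ deg G (G b) w)} (∧-right {V y} p))

    -- Complete `b` with `y`. If `X′` has r + 1 vertices it is the whole neighbourhood of `b`: then
    -- `X` inside `S` contradicts the neighbour of `b` in `E′`, and a vertex of `X` outside `S`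
    -- would have degree r + 2. So `X` has r + 1 vertices. If `X′` leaves `F′`, two of them lie
    -- outside `S`; if not, `X′` equals `P′`, and one vertex outside `S` counts twice because it
    -- lies in `Fp`.
    V-twice : ∀ y → y ∈ V → 2 ≤ deg (R ᵀ) full y + deg (R ᵀ) Fp y
    V-twice y y∈V = go size
      where
      b≁y : G b y ≡ false
      b≁y = not-false (∧-right {F′ y ∧ not (1 ≤ᵇ deg (G ᵀ) Q y)} y∈V)
      k = Sat.comp sat b y b≁y
      open Completion k hiding (cpl)
      inT : ∀ x → x ∈ X → x ∉ S → x ∈ T
      inT x p s with T-or-Q x s
      ... | inj₁ t = t
      ... | inj₂ q = true≢false (≤ᵇ-true (deg-∈ {G = G ᵀ} {Q} q (X-adj x p))) (not-false (∧-right {F′ y} (∧-left y∈V)))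
      inR : r ≤ # X′ → ∀ x → x ∈ X → x ∉ S → R x y ≡ true
      inR h x p s = ∧-intro (∧-intro (inT x p s) (≤ᵇ-true (≤-trans h (⊆-deg {G = G} X′-adj λ z q → Completion.cpl k x z p q)))) (X-adj x p)
      go : (r ≤ # X × suc r ≤ # X′) ⊎ (suc r ≤ # X × r ≤ # X′) → 2 ≤ deg (R ᵀ) full y + deg (R ᵀ) Fp y
      go (inj₁ (a , h)) with ⊆? X S
      ... | inside s with deg-∃ {G = G} {E′} b~E′
      ...   | z , z∈E′ , b~z = ⊥-elim (S⊆X⇒∉E′ a s (λ x p → Completion.cpl k x z p
                (#-⊆-≥ {P = X′} {G b} X′-adj (≤-trans (≤-reflexive (sym (deg-# G full b))) (≤-trans (T-deg b∈T) h)) z b~z)) z∈E′)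
      go (inj₁ (a , h)) | outside x p s = contra-< (begin
        suc (suc r)               ≤⟨ s≤s h ⟩
        suc (# X′)                ≡⟨ sym (#-insert {P = X′} {y} y∉X′) ⟩
        # (X′ ∪⟦ y ⟧)             ≤⟨ ⊆-deg {G = G} {X′ ∪⟦ y ⟧} {full} (λ _ _ → refl) adj ⟩
        d x                       ≤⟨ T-deg (inT x p s) ⟩
        suc r                     ∎)
        where
        open ≤-Reasoning
        y∉X′ : y ∉ X′
        y∉X′ with bool-cases (X′ y)
        ... | inj₂ q = q
        ... | inj₁ q = true≢false (X′-adj y q) b≁y
        adj : ∀ z → z ∈ X′ ∪⟦ y ⟧ → G x z ≡ true
        adj z q with ∪-case {P = X′} {y} {z} q
        ... | inj₁ m    = Completion.cpl k x z p m
        ... | inj₂ refl = X-adj x p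
      go (inj₂ (a , h)) with ⊆? X′ F′
      ... | outside z q z∉F′ with nb-false {G = G} {S} z∉F′
      ...   | s , s∈S , s≁z = ≤-trans two (m≤m+n _ _)
        where
        open ≤-Reasoning
        sub : X ∩ S ⊆ S ∖ ⟦ s ⟧
        sub x m = ∖-intro {P = S} {⟦ s ⟧} (∧-right {X x} m)
          (⟦⟧-≢ {x = s} {x} λ { refl → true≢false (Completion.cpl k x z (∧-left m) q) s≁z })
        two : 2 ≤ deg (R ᵀ) full y
        two = ≤-trans (+-cancelˡ-≤ (# (X ∩ S)) 2 _ (begin
            # (X ∩ S) + 2              ≡⟨ +-comm _ 2 ⟩
            suc (suc (# (X ∩ S)))      ≤⟨ s≤s (s≤s (#-mono {P = X ∩ S} {S ∖ ⟦ s ⟧} sub)) ⟩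
            suc (suc (# (S ∖ ⟦ s ⟧)))  ≡⟨ cong suc (sym (#-remove s s∈S)) ⟩
            suc (# S)                  ≡⟨ cong suc hS ⟩
            suc r                      ≤⟨ a ⟩
            # X                        ≡⟨ #-split X S ⟩
            # (X ∩ S) + # (X ∖ S)      ∎))
          (⊆-deg {G = R ᵀ} {X ∖ S} {full} (λ _ _ → refl) λ x m → inR h x (∧-left m) (∖-∉ {P = X} {S} m))
      go (inj₂ (a , h)) | inside s with ⊆? X S
      ... | inside s′ = contra-< (≤-trans a (≤-trans (#-mono s′) (≤-reflexive hS)))
      ... | outside x p x∉S = deg-∈ {G = R ᵀ} {full} refl (inR h x p x∉S) ⊕ deg-∈ {G = R ᵀ} {Fp} x∈Fp (inR h x p x∉S)
        where
        X′⊆P′ : X′ ⊆ P′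
        X′⊆P′ z q = ∧-intro (s z q) (X′-adj z q)
        x∈Fp : x ∈ Fp
        x∈Fp = ∧-intro (nb-intro {G = G ᵀ} {P′} λ z q → Completion.cpl k x z p (#-⊆-≥ {P = X′} X′⊆P′ (≤-trans #P′ h) z q))
          (≤ᵇ-true (≤-trans h (#-mono X′⊆P′)))

    Fp-large : 2 * # V ≤ n + # Fp
    Fp-large = begin
      2 * # V                                               ≡⟨ sym (∑[]-const V 2) ⟩
      ∑[ V ] (λ _ → 2)                                      ≤⟨ ∑[]-mono V-twice ⟩
      ∑[ V ] (λ y → deg (R ᵀ) full y + deg (R ᵀ) Fp y)      ≡⟨ ∑[]-+ V _ _ ⟩
      ∑[ V ] (deg (R ᵀ) full) + ∑[ V ] (deg (R ᵀ) Fp)       ≡⟨ sym (cong₂ _+_ (handshake R full V) (handshake R Fp V)) ⟩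
      ∑[ full ] (deg R V) + ∑[ Fp ] (deg R V)               ≤⟨ ∑[]-mono (λ w _ → R-deg w) ⊕ ∑[]-mono (λ w _ → R-deg w) ⟩
      ∑[ full ] (λ _ → 1) + ∑[ Fp ] (λ _ → 1)               ≡⟨ cong₂ _+_ (trans (∑[]-const full 1) (trans (+-identityʳ _) (#-full n))) (trans (∑[]-const Fp 1) (+-identityʳ _)) ⟩
      n + # Fp                                              ∎
      where open ≤-Reasoning

    dual : Dual r G S c
    dual = record
      { S′ = P′
      ; hS′ = ≤-antisym #P′ (≤ᵇ-true⁻¹ (∧-right {nb (G ᵀ) P′ (proj₁ member)} (proj₂ member)))
      ; cpl = λ x y p q → nb-adj {G = G} {S} (∧-left q) p
      ; bound = arith₂ n (suc (r + r * r) * e′ + suc r) (# V) (# Fp) _ _ V-large Fp-large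
          (#-mono {P = Fp} {nb (G ᵀ) P′} λ w p → ∧-left p) (#-∁ (nb (G ᵀ) P′)) }
      where
      arith₁ : ∀ n k v f → n ≤ v + k → 2 * v ≤ n + f → 2 * k + 2 < n → 1 ≤ f
      arith₁ n k v f h₁ h₂ h₃ = lin 2 (2 ⊗ h₁ ⊕ h₂ ⊕ h₃) (solve (n ∷ k ∷ v ∷ f ∷ []))
      arith₂ : ∀ n k v f g h → n ≤ v + k → 2 * v ≤ n + f → f ≤ g → g + h ≡ n → h ≤ 2 * k
      arith₂ n k v f g h h₁ h₂ h₃ refl = lin 0 (2 ⊗ h₁ ⊕ h₂ ⊕ h₃) (solve (k ∷ v ∷ f ∷ g ∷ h ∷ []))
      member : ∃[ w ] w ∈ Fp
      member = #-∃ (arith₁ n (suc (r + r * r) * e′ + suc r) (# V) (# Fp) V-large Fp-large large)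

  -- Here the neighbours of `E′` lie in `S` or `Q` only, so missing edges at `E′` can be completed
  -- only with the help of `Q`, whose surplus degree is limited by `excess`.
  module Detached (noE′ : ∀ u → u ∈ T → deg G E′ u < 1) (hE′ : 1 ≤ e′) where

    record Fan (u y : Fin n) : Set where
      field
        P Z   : Pred n
        P⊆F′  : P ⊆ F′
        P-adj : ∀ z → z ∈ P → G u z ≡ true
        #P    : r ≤ # P
        Z⊆Q   : Z ⊆ Q
        Z-adj : ∀ x → x ∈ Z → G x y ≡ true
        Zcpl  : Complete G Z P
        #Z    : suc r ≤ deg (G ᵀ) S y + # Z

    T-F′ : ∀ {u y} → u ∈ T → G u y ≡ true → y ∈ F′
    T-F′ {u} {y} t a with ∈-or-∉ F′ y
    ... | inj₁ p = p
    ... | inj₂ p = ⊥-elim (<⇒≱ (noE′ u t) (deg-∈ {G = G} {E′} p a))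

    fan : ∀ {u y} → u ∈ T → y ∈ E′ → Fan u y
    fan {u} {y} u∈T y∈E′ = go size
      where
      u≁y : G u y ≡ false
      u≁y with bool-cases (G u y)
      ... | inj₂ q = q
      ... | inj₁ q = true≢false (T-F′ u∈T q) (∁-∉ {P = F′} y∈E′)
      k = Sat.comp sat u y u≁y
      open Completion k hiding (cpl)
      go : (r ≤ # X × suc r ≤ # X′) ⊎ (suc r ≤ # X × r ≤ # X′) → Fan u y
      go (inj₁ (a , h)) with ⊆? X S
      ... | inside s = ⊥-elim (S⊆X⇒∉E′ a s X-adj y∈E′)
      -- `S`, `x` and `u` are r + 2 vertices complete to the r + 1 vertices of `X′`, which lie in
      -- `F′`.
      ... | outside x p x∉S = ⊥-elim (Sat.freeᵀ sat ((S ∪⟦ x ⟧) ∪⟦ u ⟧) X′ all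
          (≤-reflexive (sym (trans (#-insert {P = S ∪⟦ x ⟧} {u} u∉) (cong suc (trans (#-insert {P = S} {x} x∉S) (cong suc hS)))))) h)
        where
        u∉ : u ∉ S ∪⟦ x ⟧
        u∉ with bool-cases ((S ∪⟦ x ⟧) u)
        ... | inj₂ q = q
        ... | inj₁ q with ∪-case {P = S} {x} {u} q
        ...   | inj₁ s    = true≢false s (T∌S u∈T)
        ...   | inj₂ refl = true≢false (X-adj x p) u≁y
        all : Complete G ((S ∪⟦ x ⟧) ∪⟦ u ⟧) X′
        all v z m q with ∪-case {P = S ∪⟦ x ⟧} {u} {v} m
        ... | inj₂ refl = X′-adj z q
        ... | inj₁ m′ with ∪-case {P = S} {x} {v} m′
        ...   | inj₂ refl = Completion.cpl k x z p q
        ...   | inj₁ s    = nb-adj {G = G} {S} (T-F′ u∈T (X′-adj z q)) s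
      go (inj₂ (a , h)) = record
        { P = X′ ; Z = X ∖ S ; P⊆F′ = λ z q → T-F′ u∈T (X′-adj z q) ; P-adj = X′-adj ; #P = h
        ; Z⊆Q = inQ ; Z-adj = λ x p → X-adj x (∧-left p) ; Zcpl = λ x z p q → Completion.cpl k x z (∧-left p) q
        ; #Z = ≤-trans a (≤-trans (≤-reflexive (#-split X S)) (⊆-deg {G = G ᵀ} {X ∩ S} (λ x p → ∧-right {X x} p) (λ x p → X-adj x (∧-left p)) ⊕ ≤-refl)) }
        where
        inQ : X ∖ S ⊆ Q
        inQ x p with T-or-Q x (∖-∉ {P = X} {S} p)
        ... | inj₂ q = q
        ... | inj₁ t = true≢false (T-F′ t (X-adj x (∧-left p))) (∁-∉ {P = F′} y∈E′)

    #T : 2 ≤ # T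
    #T = arith r n e′ (# Q) (# T) (n ∸ r) #Q #Q+#T (m∸n+n≡m r≤n) large
      where
      arith : ∀ r n e q t k → q ≤ r * e → q + t ≡ k → k + r ≡ n → 2 * (suc (r + r * r) * e + suc r) + 2 < n → 2 ≤ t
      arith r n e q t k h₁ refl refl h₂ = lin (2 * e + r * e + 2 * (r * r * e) + r + 3) (h₁ ⊕ h₂) (solve (r ∷ e ∷ q ∷ t ∷ []))

    #S∪T : ∀ {W : Pred n} → S ⊆ W → T ⊆ W → # T + r ≤ # W
    #S∪T {W} s t = ≤-trans (≤-reflexive (trans (+-comm (# T) r) (cong (_+ # T) (sym hS))))
      (#-disjoint {A = S} {T} s t λ x p → pt x p)
      where
      pt : ∀ x → x ∈ S → x ∉ T
      pt x p rewrite p = refl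

    u₀ : ∃[ u ] u ∈ T
    u₀ = #-∃ (≤-trans (s≤s z≤n) #T)

    C₁ C₂ : Pred n
    C₁ b = r ≤ᵇ deg G F′ b
    C₂ b = suc r ≤ᵇ deg G F′ b

    -- The sum of the conditions of two fans at `y`. A vertex used by one fan has r neighbours in
    -- `F′` and is counted once; a vertex used by both has r + 1 and is counted twice.
    Rich : Fin n → Set
    Rich y = 2 * suc r ≤ 2 * deg (G ᵀ) S y + (deg (G ᵀ) (Q ∩ C₁) y + deg (G ᵀ) (Q ∩ C₂) y)

    -- The common neighbourhood of the fan's `P` contains `S` and `T`, so it can miss only vertices
    -- of `Q`. It has at least r + 2 vertices, which by freeness limits `P` to r.
    spanning : ∀ {u y} (f : Fan u y) → T ⊆ nb (G ᵀ) (Fan.P f) → Dual r G S c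
    spanning f h = record
      { S′ = P ; hS′ = ≤-antisym #P≤r #P ; cpl = λ x z p q → nb-adj {G = G} {S} (P⊆F′ z q) p
      ; bound = arith n r e′ (# Q) (# T) (n ∸ r) _ _ #Q #Q+#T (m∸n+n≡m r≤n) (#S∪T S⊆ h) (#-∁ (nb (G ᵀ) P)) }
      where
      open Fan f
      S⊆ : S ⊆ nb (G ᵀ) P
      S⊆ x p = nb-intro λ z q → nb-adj {G = G} {S} (P⊆F′ z q) p
      #P≤r : # P ≤ r
      #P≤r = ≤-pred (≰⇒> λ big → Sat.freeᵀ sat (nb (G ᵀ) P) P (λ x z p q → nb-adj {G = G ᵀ} {P} p q)
        (≤-trans (#T ⊕ ≤-refl) (#S∪T S⊆ h)) big)
      arith : ∀ n r e q t k w v → q ≤ r * e → q + t ≡ k → k + r ≡ n → t + r ≤ w → w + v ≡ n → v ≤ 2 * (suc (r + r * r) * e + suc r)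
      arith n r e q t k w v h₁ refl refl h₂ h₃ = lin (2 * e + r * e + 2 * (r * r * e) + 2 * r + 2) (h₁ ⊕ h₂ ⊕ ≤-reflexive h₃) (solve (r ∷ e ∷ q ∷ t ∷ w ∷ v ∷ []))

    -- Two fans at y have different tips, so a vertex common to both sees r + 1 vertices of F′.
    two-fans : ∀ {u₁ u₂ y} (f₁ : Fan u₁ y) (f₂ : Fan u₂ y) z → z ∈ Fan.P f₁ → G u₂ z ≡ false → Rich y
    two-fans {u₁} {u₂} {y} f₁ f₂ z₀ z₀∈A u₂≁z₀ = arith r (deg (G ᵀ) S y) (# A.Z) (# B.Z) (deg (G ᵀ) (Q ∩ C₁) y) (deg (G ᵀ) (Q ∩ C₂) y) A.#Z B.#Z
        (≤-trans (#-overlap {A = A.Z} {B.Z} {(Q ∩ C₁) ∩ (G ᵀ) y} {(Q ∩ C₂) ∩ (G ᵀ) y} (in₁ f₁) (in₁ f₂) in₂)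
          (≤-reflexive (sym (cong₂ _+_ (deg-# (G ᵀ) (Q ∩ C₁) y) (deg-# (G ᵀ) (Q ∩ C₂) y)))))
      where
      module A = Fan f₁
      module B = Fan f₂
      in₁ : ∀ {u} (f : Fan u y) → Fan.Z f ⊆ (Q ∩ C₁) ∩ (G ᵀ) y
      in₁ f x p = ∧-intro (∧-intro (Z⊆Q x p) (≤ᵇ-true (≤-trans #P (⊆-deg {G = G} P⊆F′ λ z q → Zcpl x z p q)))) (Z-adj x p)
        where open Fan f
      z₀∉B : z₀ ∉ B.P
      z₀∉B with bool-cases (B.P z₀)
      ... | inj₂ q = q
      ... | inj₁ q = true≢false (B.P-adj z₀ q) u₂≁z₀
      sub : B.P ∪⟦ z₀ ⟧ ⊆ F′
      sub z m with ∪-case {P = B.P} {z₀} {z} m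
      ... | inj₁ q    = B.P⊆F′ z q
      ... | inj₂ refl = A.P⊆F′ z₀ z₀∈A
      adj : ∀ x → x ∈ A.Z → x ∈ B.Z → ∀ z → z ∈ B.P ∪⟦ z₀ ⟧ → G x z ≡ true
      adj x pa pb z m with ∪-case {P = B.P} {z₀} {z} m
      ... | inj₁ q    = B.Zcpl x z pb q
      ... | inj₂ refl = A.Zcpl x z₀ pa z₀∈A
      in₂ : A.Z ∩ B.Z ⊆ (Q ∩ C₂) ∩ (G ᵀ) y
      in₂ x p = ∧-intro (∧-intro (A.Z⊆Q x pa) (≤ᵇ-true (≤-trans (s≤s B.#P)
          (≤-trans (≤-reflexive (sym (#-insert {P = B.P} {z₀} z₀∉B))) (⊆-deg {G = G} {B.P ∪⟦ z₀ ⟧} sub (adj x pa pb)))))) (A.Z-adj x pa)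
        where
        pa = ∧-left {A.Z x} p
        pb = ∧-right {A.Z x} p
      arith : ∀ r s a b p q → suc r ≤ s + a → suc r ≤ s + b → a + b ≤ p + q → 2 * suc r ≤ 2 * s + (p + q)
      arith r s a b p q h₁ h₂ h₃ = lin 0 (h₁ ⊕ h₂ ⊕ h₃) (solve (r ∷ s ∷ a ∷ b ∷ p ∷ q ∷ []))

    local : ∀ y → y ∈ E′ → Dual r G S c ⊎ Rich y
    local y y∈E′ = go (⊆? T (nb (G ᵀ) (Fan.P f₀)))
      where
      f₀ = fan (proj₂ u₀) y∈E′
      go : Inclusion T (nb (G ᵀ) (Fan.P f₀)) → Dual r G S c ⊎ Rich y
      go (inside h) = inj₁ (spanning f₀ h)
      go (outside u₁ t₁ bad) = inj₂ (two-fans f₀ (fan t₁ y∈E′) (proj₁ w) (proj₁ (proj₂ w)) (proj₂ (proj₂ w)))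
        where
        w : ∃[ z ] (z ∈ Fan.P f₀ × G u₁ z ≡ false)
        w = nb-false {G = G ᵀ} {Fan.P f₀} bad

    -- With r + 1 neighbours in `F′`, the edges to `E′` are pure surplus and may be charged twice.
    -- With exactly r, one copy of the degree pays for them once and the other copy is at least r +
    -- 2.
    Q-charge : ∀ b → b ∈ Q → bit (C₁ b) * deg G E′ b + bit (C₂ b) * deg G E′ b + 2 * suc r ≤ 2 * d b
    Q-charge b p with bool-cases (C₁ b) | bool-cases (C₂ b)
    ... | inj₂ h₁ | inj₁ h₂ = ⊥-elim (<⇒≱ (≤ᵇ-false⁻¹ h₁) (≤-trans (n≤1+n r) (≤ᵇ-true⁻¹ h₂)))
    ... | inj₂ h₁ | inj₂ h₂ rewrite h₁ | h₂ = 2 ⊗ mind b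
    ... | inj₁ h₁ | inj₁ h₂ rewrite h₁ | h₂ = arith r (deg G F′ b) (deg G E′ b) (d b) (≤ᵇ-true⁻¹ h₂) (deg-split G full F′ b)
      where
      arith : ∀ r f e d → suc r ≤ f → d ≡ f + e → 1 * e + 1 * e + 2 * suc r ≤ 2 * d
      arith r f e _ h refl = lin 0 (2 ⊗ h) (solve (r ∷ f ∷ e ∷ []))
    ... | inj₁ h₁ | inj₂ h₂ rewrite h₁ | h₂ = arith r (deg G F′ b) (deg G E′ b) (d b) (≤ᵇ-true⁻¹ h₁) (Q-deg p) (deg-split G full F′ b)
      where
      arith : ∀ r f e d → r ≤ f → 2 + r ≤ d → d ≡ f + e → 1 * e + 0 * e + 2 * suc r ≤ 2 * d
      arith r f e _ h h₂ refl = lin 0 (h ⊕ h₂) (solve (r ∷ f ∷ e ∷ []))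

    dual : Dual r G S c
    dual with scan {A = Dual r G S c} {B = Rich} E′ local
    ... | inj₁ a = a
    -- Richness demands 2 (r + 1) per vertex of `E′`, whereas twice `excess`, with the charges on
    -- `Q`, leaves only 2 r.
    ... | inj₂ rich = ⊥-elim (contradiction′ r e′ (# Q) σ (∑[ Q ] d) (∑[ Q ∩ C₁ ] (deg G E′)) (∑[ Q ∩ C₂ ] (deg G E′)) excess charged total hE′)
      where
      open ≤-Reasoning
      ∩-∑ : ∀ C → ∑[ Q ∩ C ] (deg G E′) ≡ ∑[ Q ] (λ b → bit (C b) * deg G E′ b)
      ∩-∑ C = ∑[]-∩ Q C (deg G E′)
      charged : ∑[ Q ∩ C₁ ] (deg G E′) + ∑[ Q ∩ C₂ ] (deg G E′) + 2 * suc r * # Q ≤ 2 * ∑[ Q ] d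
      charged = begin
        ∑[ Q ∩ C₁ ] (deg G E′) + ∑[ Q ∩ C₂ ] (deg G E′) + 2 * suc r * # Q
          ≡⟨ cong₂ _+_ (cong₂ _+_ (∩-∑ C₁) (∩-∑ C₂)) (sym (∑[]-const Q (2 * suc r))) ⟩
        ∑[ Q ] (λ b → bit (C₁ b) * deg G E′ b) + ∑[ Q ] (λ b → bit (C₂ b) * deg G E′ b) + ∑[ Q ] (λ _ → 2 * suc r)
          ≡⟨ sym (trans (∑[]-+ Q _ _) (cong (_+ ∑[ Q ] (λ _ → 2 * suc r)) (∑[]-+ Q _ _))) ⟩
        ∑[ Q ] (λ b → bit (C₁ b) * deg G E′ b + bit (C₂ b) * deg G E′ b + 2 * suc r)
          ≤⟨ ∑[]-mono Q-charge ⟩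
        ∑[ Q ] (λ b → 2 * d b)
          ≡⟨ ∑[]-* Q 2 d ⟩
        2 * ∑[ Q ] d ∎
      total : 2 * suc r * e′ ≤ 2 * σ + (∑[ Q ∩ C₁ ] (deg G E′) + ∑[ Q ∩ C₂ ] (deg G E′))
      total = begin
        2 * suc r * e′                      ≡⟨ sym (∑[]-const E′ (2 * suc r)) ⟩
        ∑[ E′ ] (λ _ → 2 * suc r)           ≤⟨ ∑[]-mono rich ⟩
        ∑[ E′ ] (λ y → 2 * deg (G ᵀ) S y + (deg (G ᵀ) (Q ∩ C₁) y + deg (G ᵀ) (Q ∩ C₂) y))
          ≡⟨ trans (∑[]-+ E′ _ _) (cong₂ _+_ (∑[]-* E′ 2 _) (∑[]-+ E′ _ _)) ⟩
        2 * σ + (∑[ E′ ] (deg (G ᵀ) (Q ∩ C₁)) + ∑[ E′ ] (deg (G ᵀ) (Q ∩ C₂)))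
          ≡⟨ cong (2 * σ +_) (sym (cong₂ _+_ (handshake G (Q ∩ C₁) E′) (handshake G (Q ∩ C₂) E′))) ⟩
        2 * σ + (∑[ Q ∩ C₁ ] (deg G E′) + ∑[ Q ∩ C₂ ] (deg G E′)) ∎
      contradiction′ : ∀ r e q σ b w₁ w₂ → σ + b ≤ r * e + suc r * q → w₁ + w₂ + 2 * suc r * q ≤ 2 * b →
        2 * suc r * e ≤ 2 * σ + (w₁ + w₂) → 1 ≤ e → ⊥
      contradiction′ r e q σ b w₁ w₂ h₁ h₂ h₃ h₄ =
        <⇒≱ (≤-trans h₄ (m≤m+n e _)) (lin {x = 2 * e} {y = 0} 0 (2 ⊗ h₁ ⊕ h₂ ⊕ h₃) (solve (r ∷ e ∷ q ∷ σ ∷ b ∷ w₁ ∷ w₂ ∷ [])))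

  dual : 1 ≤ e′ → Dual r G S c
  dual hE′ with scan {A = Dual r G S c} {B = λ u → deg G E′ u < 1} T pt
    where
    pt : ∀ u → u ∈ T → Dual r G S c ⊎ deg G E′ u < 1
    pt u p with 1 ≤? deg G E′ u
    ... | yes q = inj₁ (Attached.dual p q)
    ... | no ¬q = inj₂ (≰⇒> ¬q)
  ... | inj₁ a = a
  ... | inj₂ none = Detached.dual none hE′

no-excess : ∀ {n r} {G : BipGraph n} {S} → OneSided r G S → # (∁ (nb G S)) ≡ 0 → Fam r G
no-excess {n} {r} {G} {S} o e≡0 = S , hS , (λ u p y → nb-adj {G = G} {S} (in-F′ y) p) , λ u p → ≤-antisym (T-deg (inT u p)) (mind u)
  where
  open OneSided o
  open Dualise o
  in-F′ : ∀ y → y ∈ F′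
  in-F′ y with ∈-or-∉ F′ y
  ... | inj₁ p = p
  ... | inj₂ p = true≢false p (#-0 {P = E′} e≡0 y)
  inT : ∀ u → u ∉ S → u ∈ T
  inT u p with T-or-Q u p
  ... | inj₁ t = t
  ... | inj₂ q = ⊥-elim (<⇒≱ (#-∈ {P = Q} u q) (≤-trans #Q (≤-reflexive (trans (cong (r *_) e≡0) (*-zeroʳ r)))))

-- The last hypothesis is the size condition of `TwoSided` with `E` replaced by the bound from
-- `Dual`; it also covers both applications of `OneSided`.
near-full : ∀ {n r} {G : BipGraph n} → Sat r G → (∀ u → suc r ≤ deg G full u) → (∀ y → suc r ≤ deg (G ᵀ) full y) →
  edges G ≤ r * n + suc r * (n ∸ r) → r ≤ n → ∀ {S} → # S ≡ r →
  (2 + r) * (2 * (suc (r + r * r) * # (∁ (nb G S)) + suc r) + # (∁ (nb G S))) + r + 2 < n → Fam r G ⊎ Fam r (G ᵀ)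
near-full {n} {r} {G} sat mind mind′ few r≤n {S} hS large = go (1 ≤? # (∁ (nb G S)))
  where
  e′ = # (∁ (nb G S))
  o : OneSided r G S
  o = record { sat = sat ; mind = mind ; hS = hS ; few = few ; r≤n = r≤n ; large = arith r n e′ large }
    where
    arith : ∀ r n e → (2 + r) * (2 * (suc (r + r * r) * e + suc r) + e) + r + 2 < n → 2 * (suc (r + r * r) * e + suc r) + 2 < n
    arith r n e h = lin ((1 + r) * (2 * (suc (r + r * r) * e + suc r)) + (2 + r) * e + r) h (solve (r ∷ n ∷ e ∷ []))
  go : _ → Fam r G ⊎ Fam r (G ᵀ)
  go (no ¬p) = inj₁ (no-excess o (n≤0⇒n≡0 (≤-pred (≰⇒> ¬p))))
  go (yes p) = go′ (1 ≤? # (∁ (nb (G ᵀ) S′)))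
    where
    open Dual (Dualise.dual o p) renaming (cpl to S×S′)
    large′ : (2 + r) * (# (∁ (nb (G ᵀ) S′)) + e′) + r < n
    large′ = ≤-trans (s≤s (+-monoˡ-≤ r (*-monoʳ-≤ (2 + r) (+-monoˡ-≤ e′ bound)))) (≤-trans (s≤s (m≤m+n _ 2)) large)
    o′ : # (∁ (nb (G ᵀ) S′)) ≡ 0 → OneSided r (G ᵀ) S′
    o′ e≡0 = record { sat = Sat-ᵀ sat ; mind = mind′ ; hS = hS′ ; few = ≤-trans (≤-reflexive (edges-ᵀ G)) few ; r≤n = r≤n
      ; large = arith r n e′ (# (∁ (nb (G ᵀ) S′))) e≡0 large }
      where
      arith : ∀ r n e z → z ≡ 0 → (2 + r) * (2 * (suc (r + r * r) * e + suc r) + e) + r + 2 < n → 2 * (suc (r + r * r) * z + suc r) + 2 < n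
      arith r n e _ refl h = lin ((1 + r) * (2 * (suc (r + r * r) * e + suc r)) + 2 * (suc (r + r * r) * e) + (2 + r) * e + r) h (solve (r ∷ n ∷ e ∷ []))
    t : TwoSided r G S S′
    t = record { sat = sat ; mind = mind ; mind′ = mind′ ; hS = hS ; hS′ = hS′ ; cpl = S×S′ ; few = few ; r≤n = r≤n ; large = large′ }
    go′ : _ → Fam r G ⊎ Fam r (G ᵀ)
    go′ (no ¬q) = inj₂ (no-excess (o′ e≡0) e≡0)
      where e≡0 = n≤0⇒n≡0 (≤-pred (≰⇒> ¬q))
    go′ (yes q) = ⊥-elim (Contradiction.impossible t q p)

-- A vertex of degree r

module LowDegree {n r} {G : BipGraph n} (sat : Sat r G) (few : edges G ≤ r * n + suc r * (n ∸ r)) (large : r + (2 + r) ≤ n) where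

  r≤n : r ≤ n
  r≤n = ≤-trans (m≤m+n r _) large

  N : Fin n → Pred n
  N y u = G u y

  #N : ∀ y → # (N y) ≡ deg (G ᵀ) full y
  #N y = sym (deg-# (G ᵀ) full y)

  #N≥ : ∀ y → r ≤ # (N y)
  #N≥ y = ≤-trans (min-degree (Sat-ᵀ sat) r≤n y) (≤-reflexive (sym (#N y)))

  -- `X` consists of neighbours of `y`, of which there are at most r. This excludes one shape, makes
  -- `X` the whole neighbourhood, and places `X′` in its common neighbourhood.
  star : ∀ {y} → deg (G ᵀ) full y ≤ r → ∀ {u} → u ∉ N y → suc r ≤ deg G (nb G (N y)) u
  star {y} low {u} u≁y = go size
    where
    k = Sat.comp sat u y u≁y
    open Completion k
    go : (r ≤ # X × suc r ≤ # X′) ⊎ (suc r ≤ # X × r ≤ # X′) → suc r ≤ deg G (nb G (N y)) u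
    go (inj₂ (a , _)) = contra-< (≤-trans a (≤-trans (#-mono {P = X} {N y} X-adj) (≤-trans (≤-reflexive (#N y)) low)))
    go (inj₁ (a , h)) = ≤-trans h (⊆-deg {G = G} (λ z q → nb-intro λ x p →
      cpl x z (#-⊆-≥ {P = X} {N y} X-adj (≤-trans (≤-reflexive (#N y)) (≤-trans low a)) x p) q) X′-adj)

  module At {y₀ : Fin n} (low : deg (G ᵀ) full y₀ ≤ r) where
    S F′ E′ : Pred n
    S = N y₀
    F′ = nb G S
    E′ = ∁ F′

    hS : # S ≡ r
    hS = ≤-antisym (≤-trans (≤-reflexive (#N y₀)) low) (#N≥ y₀)

    -- The edges from `S` to `F′` and those given by `star` use up everything allowed except r per
    -- vertex of `E′`, and r is the minimum degree.
    E′-low : ∀ y → y ∈ E′ → deg (G ᵀ) full y ≤ r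
    E′-low = ∑[]-tight (λ y _ → min-degree (Sat-ᵀ sat) r≤n y)
      (≤-trans (arith r n (n ∸ r) (# F′) (# E′) (# (∁ S)) (∑[ S ] (deg G F′)) (∑[ ∁ S ] (deg G F′)) (∑[ E′ ] (deg (G ᵀ) full)) (edges G)
        dS d∁S few total (#-∁ F′) (trans (cong (_+ # (∁ S)) (sym hS)) (#-∁ S)) (m+[n∸m]≡n r≤n)) (≤-reflexive (sym (∑[]-const E′ r))))
      where
      dS : r * # F′ ≤ ∑[ S ] (deg G F′)
      dS = ≤-trans (≤-reflexive (trans (cong (_* # F′) (sym hS)) (trans (*-comm (# S) _) (sym (∑[]-const S (# F′))))))
        (∑[]-mono λ x p → ⊆-deg {G = G} {F′} (λ _ q → q) λ y q → nb-adj {G = G} {S} q p)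
      d∁S : suc r * # (∁ S) ≤ ∑[ ∁ S ] (deg G F′)
      d∁S = ≤-trans (≤-reflexive (sym (∑[]-const (∁ S) (suc r)))) (∑[]-mono λ u p → star low (∁-∉ {P = S} p))
      total : edges G ≡ ∑[ S ] (deg G F′) + ∑[ ∁ S ] (deg G F′) + ∑[ E′ ] (deg (G ᵀ) full)
      total = trans (edges-deg G) (trans (handshake G full full) (trans (∑[]-split full F′ _)
        (cong (_+ ∑[ E′ ] (deg (G ᵀ) full)) (trans (sym (handshake G full F′)) (∑[]-split full S _)))))
      arith : ∀ r n k f e m a b c g → r * f ≤ a → suc r * m ≤ b → g ≤ r * n + suc r * k → g ≡ a + b + c → f + e ≡ n →
        r + m ≡ n → r + k ≡ n → c ≤ r * e
      arith r n k f e m a b c g h₁ h₂ h₃ h₄ h₅ h₆ h₇ with +-cancelˡ-≡ r m k (trans h₆ (sym h₇))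
      arith r n k f e m a b c g h₁ h₂ h₃ refl refl h₆ h₇ | refl = lin 0 (h₁ ⊕ h₂ ⊕ h₃) (solve (r ∷ f ∷ e ∷ m ∷ a ∷ b ∷ c ∷ []))

    -- `w` has degree r too, so `star` applies to it. The r + 1 neighbours this gives to each vertex
    -- outside `N w` lie in `I`: a vertex of `E′` complete to `N w` has no other neighbours. Some
    -- `x` of `S` outside `N w` is complete to `I`, so `I` has only r + 1 vertices and all vertices
    -- outside `N w` are complete to it.
    no-other : ∀ {w} → w ∈ E′ → ⊥
    no-other {w} w∈E′ = go (nb-false {G = G} {S} (∁-∉ {P = F′} w∈E′))
      where
      w-low = E′-low w w∈E′
      I : Pred n
      I = F′ ∩ nb G (N w)
      #Nw : # (N w) ≡ r
      #Nw = ≤-antisym (≤-trans (≤-reflexive (#N w)) w-low) (#N≥ w)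
      into-I : ∀ {u} → u ∉ N w → nb G (N w) ∩ G u ⊆ I ∩ G u
      into-I {u} u∉ y p with ∈-or-∉ F′ y
      ... | inj₁ f = ∧-intro (∧-intro f (∧-left p)) (∧-right {nb G (N w) y} p)
      ... | inj₂ e = true≢false (#-⊆-≥ {P = N w} {N y} (λ x q → nb-adj {G = G} {N w} (∧-left p) q)
                       (≤-trans (≤-reflexive (#N y)) (≤-trans (E′-low y e) (≤-reflexive (sym #Nw)))) u (∧-right {nb G (N w) y} p)) u∉
      deg-I : ∀ {u} → u ∉ N w → suc r ≤ # (I ∩ G u)
      deg-I {u} u∉ = ≤-trans (star w-low u∉) (≤-trans (≤-reflexive (deg-# G _ u)) (#-mono (into-I u∉)))
      go : ∃[ x ] (x ∈ S × G x w ≡ false) → ⊥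
      go (x , x∈S , x≁w) = Sat.freeᵀ sat (∁ (N w)) I cpl′ #∁ (≤-trans (deg-I x≁w) (#-mono {P = I ∩ G x} λ y → ∧-left))
        where
        #∁ : 2 + r ≤ # (∁ (N w))
        #∁ = +-cancelˡ-≤ r _ _ (≤-trans large (≤-reflexive (sym (trans (cong (_+ # (∁ (N w))) (sym #Nw)) (#-∁ (N w))))))
        #I : # I ≤ suc r
        #I = ≮⇒≥ λ big → Sat.free sat (N w ∪⟦ x ⟧) I c (≤-reflexive (sym (trans (#-insert {P = N w} {x} x≁w) (cong suc #Nw)))) big
          where
          c : Complete G (N w ∪⟦ x ⟧) I
          c v y m q with ∪-case {P = N w} {x} {v} m
          ... | inj₁ p    = nb-adj {G = G} {N w} (∧-right {F′ y} q) p
          ... | inj₂ refl = nb-adj {G = G} {S} (∧-left q) x∈S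
        cpl′ : Complete G (∁ (N w)) I
        cpl′ u y p q = ∧-right {I y} (#-⊆-≥ {P = I ∩ G u} {I} (λ z → ∧-left) (≤-trans #I (deg-I (∁-∉ {P = N w} p))) y q)

    in-F′ : ∀ y → y ∈ F′
    in-F′ y with ∈-or-∉ F′ y
    ... | inj₁ p = p
    ... | inj₂ p = ⊥-elim (no-other p)

    fam : Fam r G
    fam = S , hS , (λ u p y → nb-adj {G = G} {S} (in-F′ y) p) , λ u p → ≤-antisym
      (≤-trans (deg-mono G {full} {F′} u λ y _ → in-F′ y) (deg-nb sat hS p))
      (≤-trans (star low p) (deg-mono G {F′} {full} u λ _ _ → refl))

∨-inj₁ : ∀ {a b} → a ≡ true → a ∨ b ≡ true
∨-inj₁ refl = refl

∨-inj₂ : ∀ {a b} → b ≡ true → a ∨ b ≡ true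
∨-inj₂ {true}  refl = refl
∨-inj₂ {false} refl = refl

∨-elim : ∀ {a b} → a ∨ b ≡ true → a ≡ true ⊎ b ≡ true
∨-elim {true}  _ = inj₁ refl
∨-elim {false} h = inj₂ h

-- Finding a nearly full set

-- The Kővári–Sós–Turán argument: peel off one common neighbour at a time.
kst : ∀ {n} (G : BipGraph n) {D c} k {A P : Pred n} → (∀ x → x ∈ A → k ≤ deg G P x) → # P ≤ D →
  (∀ X → X ⊆ P → k ≤ # X → # (A ∩ nb (G ᵀ) X) ≤ c) → # A ≤ c * D ^ k
kst G {D} {c} zero {A} {P} rich small bound = ≤-trans
  (#-mono {P = A} {A ∩ nb (G ᵀ) (λ _ → false)} λ x p → ∧-intro p (nb-intro λ _ ()))
  (≤-trans (bound (λ _ → false) (λ _ ()) z≤n) (≤-reflexive (sym (*-identityʳ c))))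
kst G {D} {c} (suc k) {A} {P} rich small bound = begin
  # A                            ≤⟨ #≤∑deg (G ᵀ) P A (λ x p → ≤-trans (s≤s z≤n) (rich x p)) ⟩
  ∑[ P ] (deg (G ᵀ) A)           ≤⟨ ∑[]-mono each ⟩
  ∑[ P ] (λ _ → c * D ^ k)       ≡⟨ ∑[]-const P _ ⟩
  c * D ^ k * # P                ≤⟨ *-monoʳ-≤ (c * D ^ k) small ⟩
  c * D ^ k * D                  ≡⟨ assoc c (D ^ k) D ⟩
  c * (D * D ^ k)                ∎
  where
  open ≤-Reasoning
  assoc : ∀ a b c → a * b * c ≡ a * (c * b)
  assoc = solve-∀
  each : ∀ v → v ∈ P → deg (G ᵀ) A v ≤ c * D ^ k
  each v v∈P = ≤-trans (≤-reflexive (deg-# (G ᵀ) A v)) (kst G k rich′ (≤-trans (#-mono {P = P ∖ ⟦ v ⟧} λ x → ∧-left) small) bound′)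
    where
    rich′ : ∀ x → x ∈ A ∩ (G ᵀ) v → k ≤ deg G (P ∖ ⟦ v ⟧) x
    rich′ x p = +-cancelˡ-≤ 1 _ _ (begin
      suc k                                               ≤⟨ rich x (∧-left p) ⟩
      deg G P x                                           ≡⟨ deg-split G P ⟦ v ⟧ x ⟩
      deg G (P ∩ ⟦ v ⟧) x + deg G (P ∖ ⟦ v ⟧) x           ≤⟨ +-monoˡ-≤ _ (≤-trans (deg≤# G _ x) (≤-trans (#-mono {P = P ∩ ⟦ v ⟧} λ y q → ∧-right {P y} q) (≤-reflexive (#-⟦⟧ v)))) ⟩
      1 + deg G (P ∖ ⟦ v ⟧) x                             ∎)
    bound′ : ∀ X → X ⊆ P ∖ ⟦ v ⟧ → k ≤ # X → # ((A ∩ (G ᵀ) v) ∩ nb (G ᵀ) X) ≤ c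
    bound′ X s h = ≤-trans (#-mono {P = (A ∩ (G ᵀ) v) ∩ nb (G ᵀ) X} {A ∩ nb (G ᵀ) (X ∪⟦ v ⟧)} sub)
      (bound (X ∪⟦ v ⟧) sup (≤-trans (s≤s h) (≤-reflexive (sym (#-insert {P = X} {v} v∉X)))))
      where
      v∉X : v ∉ X
      v∉X with bool-cases (X v)
      ... | inj₂ q = q
      ... | inj₁ q = true≢false (⟦⟧-refl v) (∖-∉ {P = P} {⟦ v ⟧} (s v q))
      sup : X ∪⟦ v ⟧ ⊆ P
      sup x m with ∪-case {P = X} {v} {x} m
      ... | inj₁ q    = ∧-left (s x q)
      ... | inj₂ refl = v∈P
      sub : (A ∩ (G ᵀ) v) ∩ nb (G ᵀ) X ⊆ A ∩ nb (G ᵀ) (X ∪⟦ v ⟧)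
      sub x p = ∧-intro (∧-left (∧-left p)) (nb-intro adj)
        where
        adj : ∀ y → y ∈ X ∪⟦ v ⟧ → G x y ≡ true
        adj y m with ∪-case {P = X} {v} {y} m
        ... | inj₁ q    = nb-adj {G = G ᵀ} {X} (∧-right {A x ∧ G x v} p) q
        ... | inj₂ refl = ∧-right {A x} (∧-left p)

-- A × B cannot be covered by two relations that are sparse from A and from B respectively.
cover : ∀ {n} K m (R R′ : BipGraph n) {A B : Pred n} → (∀ x y → x ∈ A → y ∈ B → R x y ≡ true ⊎ R′ y x ≡ true) →
  (∀ x → x ∈ A → K * deg R full x ≤ m) → (∀ y → y ∈ B → K * deg R′ full y ≤ m) → K * # A ≤ 2 * m ⊎ K * # B ≤ 2 * m
cover {n} K m R R′ {A} {B} all sparse sparse′ = go (K * # A ≤? 2 * m) (K * # B ≤? 2 * m)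
  where
  open ≤-Reasoning
  row : ∀ x → x ∈ A → # B ≤ deg R full x + deg (R′ ᵀ) B x
  row x p = ≤-trans (#-∪ {P = B} {full ∩ R x} {B ∩ (R′ ᵀ) x} pt) (≤-reflexive (sym (cong₂ _+_ (deg-# R full x) (deg-# (R′ ᵀ) B x))))
    where
    pt : ∀ y → y ∈ B → y ∈ full ∩ R x ⊎ y ∈ B ∩ (R′ ᵀ) x
    pt y q with all x y p q
    ... | inj₁ a = inj₁ a
    ... | inj₂ a = inj₂ (∧-intro q a)
  sum : K * (# A * # B) ≤ m * # A + m * # B
  sum = begin
    K * (# A * # B)                                                ≡⟨ cong (K *_) (trans (*-comm (# A) _) (sym (∑[]-const A (# B)))) ⟩
    K * ∑[ A ] (λ _ → # B)                                         ≤⟨ K ⊗ ∑[]-mono row ⟩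
    K * ∑[ A ] (λ x → deg R full x + deg (R′ ᵀ) B x)               ≡⟨ cong (K *_) (trans (∑[]-+ A _ _) (cong (∑[ A ] (deg R full) +_) (handshake (R′ ᵀ) A B))) ⟩
    K * (∑[ A ] (deg R full) + ∑[ B ] (deg R′ A))                  ≤⟨ K ⊗ (≤-refl {∑[ A ] (deg R full)} ⊕ ∑[]-mono λ y _ → deg-mono R′ {A} {full} y λ _ _ → refl) ⟩
    K * (∑[ A ] (deg R full) + ∑[ B ] (deg R′ full))               ≡⟨ trans (*-distribˡ-+ K _ _) (sym (cong₂ _+_ (∑[]-* A K _) (∑[]-* B K _))) ⟩
    ∑[ A ] (λ x → K * deg R full x) + ∑[ B ] (λ y → K * deg R′ full y) ≤⟨ ∑[]-mono sparse ⊕ ∑[]-mono sparse′ ⟩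
    ∑[ A ] (λ _ → m) + ∑[ B ] (λ _ → m)                            ≡⟨ cong₂ _+_ (∑[]-const A m) (∑[]-const B m) ⟩
    m * # A + m * # B                                              ∎
  arith : ∀ K m a b → K * (a * b) ≤ m * a + m * b → 2 * m < K * a → 2 * m < K * b → a ≤ 0
  arith K m a b h h₁ h₂ = lin b (2 ⊗ h ⊕ a ⊗ h₂ ⊕ b ⊗ h₁) (solve (K ∷ m ∷ a ∷ b ∷ []))
  go : _ → _ → K * # A ≤ 2 * m ⊎ K * # B ≤ 2 * m
  go (yes p) _ = inj₁ p
  go (no _) (yes q) = inj₂ q
  go (no ¬p) (no ¬q) = ⊥-elim (<⇒≱ (≰⇒> ¬p) (≤-trans (K ⊗ arith K m (# A) (# B) sum (≰⇒> ¬p) (≰⇒> ¬q)) (≤-trans (≤-reflexive (*-zeroʳ K)) z≤n)))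

-- A vertex is low below lowDegree and big above n / bigDegree; at most bigCodegree vertices share r + 1
-- neighbours with a given low vertex, so those that are not big have at most n / K² neighbours altogether.
lowDegree bigCodegree bigDegree : ℕ → ℕ → ℕ
lowDegree r K = suc (2 * r) * K
bigCodegree r K = suc (suc r * lowDegree r K ^ suc r)
bigDegree r K = K * (K * bigCodegree r K)

-- K measures smallness: a set X is negligible when K * # X is at most a multiple of n depending on r only.
record Dense {n} (r K : ℕ) (G : BipGraph n) : Set where
  field
    sat   : Sat r G
    mind  : ∀ u → suc r ≤ deg G full u
    mind′ : ∀ y → suc r ≤ deg (G ᵀ) full y
    few   : edges G ≤ suc (2 * r) * n
    1≤K   : 1 ≤ K
    1≤n   : 1 ≤ n
    n≥Big : suc r * (K * (bigDegree r K * suc (2 * r))) ≤ n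
    n≥low : K * (K * lowDegree r K) ≤ n

Dense-ᵀ : ∀ {n r K} {G : BipGraph n} → Dense r K G → Dense r K (G ᵀ)
Dense-ᵀ {G = G} d = record
  { sat = Sat-ᵀ sat ; mind = mind′ ; mind′ = mind ; few = ≤-trans (≤-reflexive (edges-ᵀ G)) few
  ; 1≤K = 1≤K ; 1≤n = 1≤n ; n≥Big = n≥Big ; n≥low = n≥low }
  where open Dense d

module Half {n r K} {G : BipGraph n} (ctx : Dense r K G) where
  open Dense ctx

  D c Q : ℕ
  D = lowDegree r K
  c = bigCodegree r K
  Q = bigDegree r K

  d : Fin n → ℕ
  d = deg G full

  L Big : Pred n
  L u = d u ≤ᵇ D
  Big u = n ≤ᵇ Q * d u

  r<D : suc r ≤ D
  r<D = ≤-trans (s≤s (m≤m+n r _)) (≤-trans (≤-reflexive (sym (*-identityʳ _))) (*-monoʳ-≤ (suc (2 * r)) 1≤K))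

  low : ∀ {u} → d u ≤ suc r → u ∈ L
  low h = ≤ᵇ-true (≤-trans h r<D)

  ∑d : ∀ P → ∑[ P ] d ≤ suc (2 * r) * n
  ∑d P = ≤-trans (≤-trans (∑[]-⊆ {P = P} {full} d (λ _ _ → refl)) (≤-reflexive (sym (edges-deg G)))) few

  #∁L : K * # (∁ L) ≤ n
  #∁L = *-cancelˡ-≤ (suc (2 * r)) (begin
    suc (2 * r) * (K * # (∁ L))     ≡⟨ sym (*-assoc (suc (2 * r)) K _) ⟩
    D * # (∁ L)                     ≡⟨ sym (∑[]-const (∁ L) D) ⟩
    ∑[ ∁ L ] (λ _ → D)              ≤⟨ ∑[]-mono (λ u p → <⇒≤ (≤ᵇ-false⁻¹ (∁-∉ {P = L} p))) ⟩
    ∑[ ∁ L ] d                      ≤⟨ ∑d (∁ L) ⟩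
    suc (2 * r) * n                 ∎)
    where open ≤-Reasoning

  #Big : # Big ≤ Q * suc (2 * r)
  #Big = *-cancelʳ-≤ _ _ n {{>-nonZero 1≤n}} (begin
    # Big * n                       ≡⟨ *-comm (# Big) n ⟩
    n * # Big                       ≡⟨ sym (∑[]-const Big n) ⟩
    ∑[ Big ] (λ _ → n)              ≤⟨ ∑[]-mono (λ u p → ≤ᵇ-true⁻¹ p) ⟩
    ∑[ Big ] (λ u → Q * d u)        ≡⟨ ∑[]-* Big Q d ⟩
    Q * ∑[ Big ] d                  ≤⟨ *-monoʳ-≤ Q (∑d Big) ⟩
    Q * (suc (2 * r) * n)           ≡⟨ sym (*-assoc Q _ n) ⟩
    Q * suc (2 * r) * n             ∎)
    where open ≤-Reasoning

  KBig : suc r * (K * # Big) ≤ n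
  KBig = ≤-trans (*-monoʳ-≤ (suc r) (*-monoʳ-≤ K #Big)) n≥Big

  A : Fin n → Pred n
  A u x = suc r ≤ᵇ deg G (G u) x

  -- `kst` inside the bounded neighbourhood of `u`: any r + 1 of its vertices have at most r + 1
  -- common neighbours.
  #A : ∀ {u} → u ∈ L → # (A u) ≤ c
  #A {u} p = ≤-trans (kst G (suc r) {A u} {G u} (λ x q → ≤ᵇ-true⁻¹ q) (≤-trans (≤-reflexive (sym (deg-# G full u))) (≤ᵇ-true⁻¹ p))
    (λ X s h → ≤-trans (#-mono {P = A u ∩ nb (G ᵀ) X} λ x q → ∧-right {A u x} q) (nb-small (Sat-ᵀ sat) h))) (n≤1+n _)

  -- The pairs whose completion may use a vertex that is not big but shares r + 1 neighbours with
  -- `u`.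
  bad : BipGraph n
  bad u y = 1 ≤ᵇ deg (G ᵀ) (A u ∖ Big) y

  -- At most `c` vertices contribute, each of degree below n / `Q`, and `Q` is K² times `c`. The
  -- successor in `bigCodegree` keeps `c` positive for the cancellation.
  bad-sparse : ∀ {u} → u ∈ L → K * (K * deg bad full u) ≤ n
  bad-sparse {u} p = *-cancelˡ-≤ c (begin
    c * (K * (K * deg bad full u))           ≡⟨ assoc c K (deg bad full u) ⟩
    Q * deg bad full u                       ≤⟨ Q ⊗ (≤-trans (≤-reflexive (deg-# bad full u)) (#≤∑deg G (A u ∖ Big) (bad u) λ y q → ≤ᵇ-true⁻¹ q)) ⟩
    Q * ∑[ A u ∖ Big ] (deg G (bad u))       ≤⟨ Q ⊗ ∑[]-mono (λ x _ → deg-mono G {bad u} {full} x λ _ _ → refl) ⟩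
    Q * ∑[ A u ∖ Big ] d                     ≡⟨ sym (∑[]-* (A u ∖ Big) Q d) ⟩
    ∑[ A u ∖ Big ] (λ x → Q * d x)           ≤⟨ ∑[]-mono (λ x q → <⇒≤ (≤ᵇ-false⁻¹ (∖-∉ {P = A u} {Big} q))) ⟩
    ∑[ A u ∖ Big ] (λ _ → n)                 ≡⟨ ∑[]-const (A u ∖ Big) n ⟩
    n * # (A u ∖ Big)                        ≤⟨ *-monoʳ-≤ n (≤-trans (#-mono {P = A u ∖ Big} λ x → ∧-left) (#A p)) ⟩
    n * c                                    ≡⟨ *-comm n c ⟩
    c * n                                    ∎)
    where
    open ≤-Reasoning
    assoc : ∀ c K b → c * (K * (K * b)) ≡ K * (K * c) * b
    assoc = solve-∀

  rel : BipGraph n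
  rel u y = bad u y ∨ G u y

  K≤ : ∀ {x m} → K * (K * x) ≤ m → K * x ≤ m
  K≤ {x} h = ≤-trans (≤-trans (≤-reflexive (sym (*-identityˡ (K * x)))) (*-monoˡ-≤ (K * x) 1≤K)) h

  rel-sparse : ∀ {u} → u ∈ L → K * deg rel full u ≤ 2 * n
  rel-sparse {u} p = ≤-trans (K ⊗ split) (arith K (deg bad full u) (d u) n
      (K≤ (bad-sparse p)) (≤-trans (K ⊗ ≤ᵇ-true⁻¹ p) (K≤ n≥low)))
    where
    split : deg rel full u ≤ deg bad full u + d u
    split = ≤-trans (≤-reflexive (deg-# rel full u)) (≤-trans (#-∪ {P = full ∩ rel u} {full ∩ bad u} {full ∩ G u} λ y q → ∨-elim {bad u y} q)
      (≤-reflexive (sym (cong₂ _+_ (deg-# bad full u) (deg-# G full u)))))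
    arith : ∀ K a b n → K * a ≤ n → K * b ≤ n → K * (a + b) ≤ 2 * n
    arith K a b n h₁ h₂ = lin 0 (h₁ ⊕ h₂) (solve (K ∷ a ∷ b ∷ n ∷ []))

  bad-intro : ∀ {u y} {X X′ : Pred n} → Complete G X X′ → (∀ z → z ∈ X′ → G u z ≡ true) → suc r ≤ # X′ →
    (∀ x → x ∈ X → G x y ≡ true) → X ⊆ Big ⊎ bad u y ≡ true
  bad-intro {u} {y} {X} {X′} cpl X′-adj h X-adj with ⊆? X Big
  ... | inside s = inj₁ s
  ... | outside x p q = inj₂ (≤ᵇ-true (deg-∈ {G = G ᵀ} {A u ∖ Big} {y} {x}
    (∖-intro {P = A u} {Big} (≤ᵇ-true (≤-trans h (⊆-deg {G = G} {X′} {G u} X′-adj λ z m → cpl x z p m))) q) (X-adj x p)))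

  Good′ : Pred n
  Good′ y = r ≤ᵇ deg (G ᵀ) Big y

-- Edge counts and completions when most vertices of one class have r big neighbours

record NearFull {n} (r K c : ℕ) (G : BipGraph n) : Set where
  field
    S    : Pred n
    hS   : # S ≡ r
    most : K * # (∁ (nb G S)) ≤ c * n

module Waste {n r K} {G : BipGraph n} (ctx : Dense r K G) ζ
  (few-bad : K * # (Half.L (Dense-ᵀ ctx) ∖ Half.Good′ ctx) ≤ ζ * n) where
  open Dense ctx
  open Half ctx
  private module T = Half (Dense-ᵀ ctx)

  #∁Good′ : K * # (∁ Good′) ≤ suc ζ * n
  #∁Good′ = ≤-trans (K ⊗ #-∪ {P = ∁ Good′} {∁ T.L} {T.L ∖ Good′} pt) (≤-trans (≤-reflexive (*-distribˡ-+ K _ _)) (T.#∁L ⊕ few-bad))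
    where
    pt : ∀ y → y ∈ ∁ Good′ → y ∈ ∁ T.L ⊎ y ∈ T.L ∖ Good′
    pt y p with ∈-or-∉ T.L y
    ... | inj₁ l = inj₂ (∧-intro l p)
    ... | inj₂ l = inj₁ l

  Over Fat : Pred n
  Over y = suc r ≤ᵇ deg (G ᵀ) Big y
  Fat u = ∁ Big u ∧ (2 + r ≤ᵇ d u)

  -- The shortfall from r n edges at the big vertices and minimum degree r + 1 at n others. Since (2
  -- r + 1) n edges are allowed, it bounds every surplus below.
  waste : ℕ
  waste = r * # (∁ Good′) + suc r * # Big

  #waste : K * waste ≤ suc (r * suc ζ) * n
  #waste = arith K r (# (∁ Good′)) (# Big) (suc ζ) n #∁Good′ KBig
    where
    arith : ∀ K r g b z n → K * g ≤ z * n → suc r * (K * b) ≤ n → K * (r * g + suc r * b) ≤ suc (r * z) * n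
    arith K r g b z n h₁ h₂ = lin 0 (r ⊗ h₁ ⊕ h₂) (solve (K ∷ r ∷ g ∷ b ∷ z ∷ n ∷ []))

  big-side : r * # Good′ + # Over ≤ ∑[ Big ] d
  big-side = begin
    r * # Good′ + # Over                                       ≡⟨ cong₂ _+_ (sym (∑[]-const Good′ r)) (sym (trans (∑[]-const Over 1) (+-identityʳ _))) ⟩
    ∑[ Good′ ] (λ _ → r) + ∑[ Over ] (λ _ → 1)                 ≡⟨ cong₂ _+_ (∑[]-∩ full Good′ _) (∑[]-∩ full Over _) ⟩
    ∑[ full ] (λ y → bit (Good′ y) * r) + ∑[ full ] (λ y → bit (Over y) * 1) ≡⟨ sym (∑[]-+ full _ _) ⟩
    ∑[ full ] (λ y → bit (Good′ y) * r + bit (Over y) * 1)     ≤⟨ ∑[]-mono (λ y _ → pt y) ⟩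
    ∑[ full ] (deg (G ᵀ) Big)                                  ≡⟨ sym (handshake G Big full) ⟩
    ∑[ Big ] d                                                 ∎
    where
    open ≤-Reasoning
    pt : ∀ y → bit (Good′ y) * r + bit (Over y) * 1 ≤ deg (G ᵀ) Big y
    pt y with bool-cases (Good′ y) | bool-cases (Over y)
    ... | inj₁ p | inj₁ q rewrite p | q = ≤-trans (≤-reflexive (trans (cong (_+ 1) (*-identityˡ r)) (+-comm r 1))) (≤ᵇ-true⁻¹ q)
    ... | inj₁ p | inj₂ q rewrite p | q = ≤-trans (≤-reflexive (trans (+-identityʳ _) (*-identityˡ r))) (≤ᵇ-true⁻¹ p)
    ... | inj₂ p | inj₁ q = ⊥-elim (<⇒≱ (≤ᵇ-false⁻¹ p) (≤-trans (n≤1+n r) (≤ᵇ-true⁻¹ q)))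
    ... | inj₂ p | inj₂ q rewrite p | q = z≤n

  small-side : # Over + ∑[ ∁ Big ] d ≤ waste + suc r * # (∁ Big)
  small-side = arith r n (# Good′) (# (∁ Good′)) (# Big) (# (∁ Big)) (# Over) (∑[ Big ] d) (∑[ ∁ Big ] d)
      big-side (≤-trans (≤-reflexive (sym (∑[]-split full Big d))) (∑d full)) (#-∁ Good′) (#-∁ Big)
    where
    arith : ∀ r n g g′ b b′ o x y → r * g + o ≤ x → x + y ≤ suc (2 * r) * n → g + g′ ≡ n → b + b′ ≡ n →
      o + y ≤ r * g′ + suc r * b + suc r * b′
    arith r n g g′ b b′ o x y h₁ h₂ h₃ h₄ = lin 0 (h₁ ⊕ h₂ ⊕ r ⊗ ≤-reflexive (sym h₃) ⊕ suc r ⊗ ≤-reflexive (sym h₄))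
      (solve (r ∷ n ∷ g ∷ g′ ∷ b ∷ b′ ∷ o ∷ x ∷ y ∷ []))

  #Over+#Fat : # Over + # Fat ≤ waste
  #Over+#Fat = arith (# Over) (# Fat) (∑[ ∁ Big ] d) waste (suc r * # (∁ Big)) small-side fat
    where
    open ≤-Reasoning
    fat : suc r * # (∁ Big) + # Fat ≤ ∑[ ∁ Big ] d
    fat = begin
      suc r * # (∁ Big) + # Fat                                              ≡⟨ cong₂ _+_ (sym (∑[]-const (∁ Big) (suc r))) (sym (trans (∑[]-const Fat 1) (+-identityʳ _))) ⟩
      ∑[ ∁ Big ] (λ _ → suc r) + ∑[ Fat ] (λ _ → 1)                          ≡⟨ cong (∑[ ∁ Big ] (λ _ → suc r) +_) (∑[]-∩ (∁ Big) (λ u → 2 + r ≤ᵇ d u) _) ⟩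
      ∑[ ∁ Big ] (λ _ → suc r) + ∑[ ∁ Big ] (λ u → bit (2 + r ≤ᵇ d u) * 1)   ≡⟨ sym (∑[]-+ (∁ Big) _ _) ⟩
      ∑[ ∁ Big ] (λ u → suc r + bit (2 + r ≤ᵇ d u) * 1)                      ≤⟨ ∑[]-mono (λ u _ → pt u) ⟩
      ∑[ ∁ Big ] d                                                           ∎
      where
      pt : ∀ u → suc r + bit (2 + r ≤ᵇ d u) * 1 ≤ d u
      pt u with bool-cases (2 + r ≤ᵇ d u)
      ... | inj₁ p rewrite p = ≤-trans (≤-reflexive (+-comm (suc r) 1)) (≤ᵇ-true⁻¹ p)
      ... | inj₂ p rewrite p = ≤-trans (≤-reflexive (+-identityʳ _)) (mind u)
    arith : ∀ o f y w b → o + y ≤ w + b → b + f ≤ y → o + f ≤ w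
    arith o f y w b h₁ h₂ = lin 0 (h₁ ⊕ h₂) (solve (o ∷ f ∷ y ∷ w ∷ b ∷ []))

  ∑-small : ∀ {C} → C ⊆ ∁ Big → ∑[ C ] d ≤ suc r * # C + waste
  ∑-small {C} s = arith r (# C) (# (∁ Big ∖ C)) (# (∁ Big)) (# Over) (∑[ C ] d) (∑[ ∁ Big ∖ C ] d) (∑[ ∁ Big ] d) waste small-side rest
    (≤-trans (∑[]-⊆ {P = C} {∁ Big ∩ C} d (λ u p → ∧-intro (s u p) p) ⊕ ≤-refl) (≤-reflexive (sym (∑[]-split (∁ Big) C d))))
    (≤-trans (≤-reflexive (#-split (∁ Big) C)) (#-mono {P = ∁ Big ∩ C} (λ u → ∧-right {∁ Big u}) ⊕ ≤-refl))
    where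
    rest : suc r * # (∁ Big ∖ C) ≤ ∑[ ∁ Big ∖ C ] d
    rest = ≤-trans (≤-reflexive (sym (∑[]-const (∁ Big ∖ C) (suc r)))) (∑[]-mono λ u _ → mind u)
    arith : ∀ r a b m o x y z w → o + z ≤ w + suc r * m → suc r * b ≤ y → x + y ≤ z → m ≤ a + b → x ≤ suc r * a + w
    arith r a b m o x y z w h₁ h₂ h₃ h₄ = lin o (h₁ ⊕ h₂ ⊕ h₃ ⊕ suc r ⊗ h₄) (solve (r ∷ a ∷ b ∷ m ∷ o ∷ x ∷ y ∷ z ∷ w ∷ []))

  Typ Typ′ : Pred n
  Typ u = ∁ Big u ∧ not (2 + r ≤ᵇ d u)
  Typ′ y = Good′ y ∧ not (Over y)

  #∁Typ : K * # (∁ Typ) ≤ (2 + r * suc ζ) * n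
  #∁Typ = arith K r (# (∁ Typ)) (# Big) (# Over) (# Fat) waste (suc ζ) n (#-∪ {P = ∁ Typ} {Big} {Fat} pt) #Over+#Fat #waste KBig
    where
    pt : ∀ u → u ∈ ∁ Typ → u ∈ Big ⊎ u ∈ Fat
    pt u p with Big u | 2 + r ≤ᵇ d u
    ... | true  | _    = inj₁ refl
    ... | false | true = inj₂ refl
    arith : ∀ K r t b o f w z n → t ≤ b + f → o + f ≤ w → K * w ≤ suc (r * z) * n → suc r * (K * b) ≤ n → K * t ≤ (2 + r * z) * n
    arith K r t b o f w z n h₁ h₂ h₃ h₄ = lin (r * (K * b) + K * o) (K ⊗ h₁ ⊕ K ⊗ h₂ ⊕ h₃ ⊕ h₄) (solve (K ∷ r ∷ t ∷ b ∷ o ∷ f ∷ w ∷ z ∷ n ∷ []))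

  #∁Typ′ : K * # (∁ Typ′) ≤ (2 + ζ + r * suc ζ) * n
  #∁Typ′ = arith K r (# (∁ Typ′)) (# (∁ Good′)) (# Over) (# Fat) waste ζ n (#-∪ {P = ∁ Typ′} {∁ Good′} {Over} pt) #Over+#Fat #waste #∁Good′
    where
    pt : ∀ y → y ∈ ∁ Typ′ → y ∈ ∁ Good′ ⊎ y ∈ Over
    pt y p with Good′ y | Over y
    ... | false | _    = inj₁ refl
    ... | true  | true = inj₂ refl
    arith : ∀ K r t g o f w z n → t ≤ g + o → o + f ≤ w → K * w ≤ suc (r * suc z) * n → K * g ≤ suc z * n → K * t ≤ (2 + z + r * suc z) * n
    arith K r t g o f w z n h₁ h₂ h₃ h₄ = lin (K * f) (K ⊗ h₁ ⊕ K ⊗ h₂ ⊕ h₃ ⊕ h₄) (solve (K ∷ r ∷ t ∷ g ∷ o ∷ f ∷ w ∷ z ∷ n ∷ []))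

  Typ-low : ∀ {u} → u ∈ Typ → d u ≤ suc r
  Typ-low {u} p = ≤-pred (≤ᵇ-false⁻¹ (not-false (∧-right {∁ Big u} p)))

  Typ′-big : ∀ {y} → y ∈ Typ′ → deg (G ᵀ) Big y ≡ r
  Typ′-big {y} p = ≤-antisym (≤-pred (≤ᵇ-false⁻¹ (not-false (∧-right {Good′ y} p)))) (≤ᵇ-true⁻¹ (∧-left p))

module Average {n r K} {G : BipGraph n} (ctx : Dense r K G) where
  open Dense ctx
  open Half ctx
  private module T = Half (Dense-ᵀ ctx)

  Rem : Fin n → Pred n
  Rem u y = T.L y ∧ T.bad y u

  -- Double counting over pairs (u , y) with T.bad y u.
  average : ∀ {W} → n < K * # W → ∃[ u ] (u ∈ W × K * # (Rem u) ≤ n)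
  average {W} big = go (∑[]-< {P = W} {λ u → K * # (Rem u)} {λ _ → suc n} (≰⇒> not-all))
    where
    open ≤-Reasoning
    go : ∃[ u ] (u ∈ W × K * # (Rem u) < suc n) → ∃[ u ] (u ∈ W × K * # (Rem u) ≤ n)
    go (u , p , q) = u , p , ≤-pred q
    total : K * ∑[ W ] (λ u → K * # (Rem u)) ≤ n * n
    total = begin
      K * ∑[ W ] (λ u → K * # (Rem u))          ≡⟨ cong (K *_) (trans (∑[]-cong λ u _ → cong (K *_) (sym (deg-# (T.bad ᵀ) T.L u))) (∑[]-* W K _)) ⟩
      K * (K * ∑[ W ] (deg (T.bad ᵀ) T.L))      ≡⟨ cong (λ k → K * (K * k)) (handshake (T.bad ᵀ) W T.L) ⟩
      K * (K * ∑[ T.L ] (deg T.bad W))          ≤⟨ K ⊗ (K ⊗ ∑[]-mono λ y _ → deg-mono T.bad {W} {full} y λ _ _ → refl) ⟩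
      K * (K * ∑[ T.L ] (deg T.bad full))       ≡⟨ sym (trans (∑[]-* T.L K _) (cong (K *_) (∑[]-* T.L K _))) ⟩
      ∑[ T.L ] (λ y → K * (K * deg T.bad full y)) ≤⟨ ∑[]-mono (λ y p → T.bad-sparse p) ⟩
      ∑[ T.L ] (λ _ → n)                        ≡⟨ ∑[]-const T.L n ⟩
      n * # T.L                                 ≤⟨ *-monoʳ-≤ n (#≤n T.L) ⟩
      n * n                                     ∎
    not-all : ∑[ W ] (λ _ → suc n) ≤ ∑[ W ] (λ u → K * # (Rem u)) → ⊥
    not-all h = <⇒≱ {0} (s≤s z≤n) (arith K n (# W) (∑[ W ] (λ u → K * # (Rem u))) total (≤-trans (≤-reflexive (sym (∑[]-const W (suc n)))) h) big)
      where
      arith : ∀ K n w s → K * s ≤ n * n → suc n * w ≤ s → n < K * w → 1 ≤ 0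
      arith K n w s h₁ h₂ h₃ = lin (2 * n) (h₁ ⊕ K ⊗ h₂ ⊕ suc n ⊗ h₃) (solve (K ∷ n ∷ w ∷ s ∷ []))

  Star : Fin n → Pred n
  Star u = nb (G ᵀ) (G u) ∖ ⟦ u ⟧

  #Star : ∀ u → # (Star u) ≤ r
  #Star u = ≤-pred (≤-trans (≤-reflexive (sym (#-remove {P = nb (G ᵀ) (G u)} u (nb-intro λ y q → q))))
    (nb-small (Sat-ᵀ sat) (≤-trans (mind u) (≤-reflexive (deg-# G full u)))))

  -- When `X′` has r + 1 vertices it is the whole neighbourhood of `u`. Then `X` lies in the star,
  -- which has at most r vertices, so `X` is the star.
  through : ∀ {u y} → d u ≤ suc r → G u y ≡ false →
    (r ≤ # (Star u) × y ∈ nb G (Star u)) ⊎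
    (Σ (Pred n) λ X → Σ (Pred n) λ X′ → Complete G X X′ × X ⊆ (G ᵀ) y × X′ ⊆ G u × suc r ≤ # X × r ≤ # X′)
  through {u} {y} du u≁y = go size
    where
    open Completion (Sat.comp sat u y u≁y)
    go : (r ≤ # X × suc r ≤ # X′) ⊎ (suc r ≤ # X × r ≤ # X′) → _
    go (inj₂ (a , b)) = inj₂ (X , X′ , cpl , X-adj , X′-adj , a , b)
    go (inj₁ (a , b)) = inj₁ (≤-trans a (#-mono {P = X} {Star u} sub) , nb-intro λ x p → X-adj x (#-⊆-≥ {P = X} {Star u} sub (≤-trans (#Star u) a) x p))
      where
      N⊆X′ : G u ⊆ X′
      N⊆X′ = #-⊆-≥ {P = X′} {G u} X′-adj (≤-trans (≤-reflexive (sym (deg-# G full u))) (≤-trans du b))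
      sub : X ⊆ Star u
      sub x p = ∖-intro {P = nb (G ᵀ) (G u)} {⟦ u ⟧} (nb-intro λ z q → cpl x z p (N⊆X′ z q))
        (⟦⟧-≢ {x = u} {x} λ { refl → true≢false (X-adj x p) u≁y })

  -- The other shape would need r big neighbours of `u`, which are lacking, or a bad pair, which is
  -- rare. So every generic `y` is completed through the star.
  isolated-star : ∀ {u} → 4 ≤ K → d u ≤ suc r → deg G T.Big u < r → K * # (Rem u) ≤ n → NearFull r K 3 G
  isolated-star {u} 4≤K du poor rare = record { S = Star u ; hS = ≤-antisym (#Star u) (proj₁ (on-star (proj₂ y₀))) ; most = most }
    where
    Gen : Pred n
    Gen y = (T.L y ∧ not (G u y)) ∧ not (Rem u y)
    #∁Gen : # (∁ Gen) ≤ # (∁ T.L) + # (G u) + # (Rem u)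
    #∁Gen = #-∪₃ {P = ∁ Gen} {∁ T.L} {G u} {Rem u} λ y → pt (T.L y) (G u y) (Rem u y)
      where
      pt : ∀ a b c → not ((a ∧ not b) ∧ not c) ≡ true → not a ≡ true ⊎ b ≡ true ⊎ c ≡ true
      pt false b c h = inj₁ refl
      pt true true c h = inj₂ (inj₁ refl)
      pt true false true h = inj₂ (inj₂ refl)
    K∁Gen : K * # (∁ Gen) ≤ 3 * n
    K∁Gen = arith K (# (∁ Gen)) (# (∁ T.L)) (# (G u)) (# (Rem u)) n #∁Gen T.#∁L
        (≤-trans (K ⊗ ≤-trans (≤-reflexive (sym (deg-# G full u))) (≤-trans du r<D)) (K≤ n≥low)) rare
      where
      arith : ∀ K g a b c n → g ≤ a + b + c → K * a ≤ n → K * b ≤ n → K * c ≤ n → K * g ≤ 3 * n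
      arith K g a b c n h h₁ h₂ h₃ = lin 0 (K ⊗ h ⊕ h₁ ⊕ h₂ ⊕ h₃) (solve (K ∷ g ∷ a ∷ b ∷ c ∷ n ∷ []))
    on-star : ∀ {y} → y ∈ Gen → r ≤ # (Star u) × y ∈ nb G (Star u)
    on-star {y} p = go (through du (not-false (∧-right {T.L y} (∧-left p))))
      where
      go : _ → r ≤ # (Star u) × y ∈ nb G (Star u)
      go (inj₁ s) = s
      go (inj₂ (X , X′ , cpl , X-adj , X′-adj , a , b)) = ⊥-elim (go′ (T.bad-intro {y} {u} {X′} {X} (λ x z p q → cpl z x q p) X-adj a X′-adj))
        where
        go′ : X′ ⊆ T.Big ⊎ T.bad y u ≡ true → ⊥
        go′ (inj₁ s) = <⇒≱ poor (≤-trans b (⊆-deg {G = G} {X′} {T.Big} s X′-adj))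
        go′ (inj₂ q) = true≢false (∧-intro (∧-left (∧-left p)) q) (not-false (∧-right {T.L y ∧ not (G u y)} p))
    y₀ : ∃[ y ] y ∈ Gen
    -- At most 3 n / K vertices are not generic, so `4 ≤ K` leaves one; its completion shows that
    -- the star has r vertices.
    y₀ = #-∃ (arith K n (# Gen) (# (∁ Gen)) K∁Gen (#-∁ Gen) 1≤n 4≤K)
      where
      arith : ∀ K n g h → K * h ≤ 3 * n → g + h ≡ n → 1 ≤ n → 4 ≤ K → 1 ≤ g
      arith K n zero h h₁ refl h₂ h₃ = ⊥-elim (<⇒≱ h₂ (lin {x = h} {y = 0} 0 (h₁ ⊕ h ⊗ h₃) (solve (K ∷ h ∷ []))))
      arith K n (suc g) h _ _ _ _ = s≤s z≤n
    most : K * # (∁ (nb G (Star u))) ≤ 3 * n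
    most = ≤-trans (K ⊗ #-mono {P = ∁ (nb G (Star u))} {∁ Gen} pt) K∁Gen
      where
      pt : ∀ y → y ∈ ∁ (nb G (Star u)) → y ∈ ∁ Gen
      pt y p with ∈-or-∉ Gen y
      ... | inj₂ q = q
      ... | inj₁ q = true≢false (proj₂ (on-star q)) (∁-∉ {P = nb G (Star u)} p)

-- The balanced case: typical vertices and their partners

τ β : ℕ → ℕ → ℕ
τ r ζ = 4 + ζ + 2 * (r * suc ζ)
-- Non-generic vertices cost 2 + τ and vertices outside `Pair` cost (3 + r) τ. The remaining 4
-- exceeds what `cover` permits for two relations of sparseness 2 n / K.
β r ζ = 6 + τ r ζ + (3 + r) * τ r ζ

-- Both classes consist, up to negligible sets, of vertices with r big neighbours and a single other one.
record Balanced {n} (r K ζ : ℕ) (G : BipGraph n) : Set where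
  field
    ctx  : Dense r K G
    few  : K * # (Half.L (Dense-ᵀ ctx) ∖ Half.Good′ ctx) ≤ ζ * n
    few′ : K * # (Half.L ctx ∖ Half.Good′ (Dense-ᵀ ctx)) ≤ ζ * n

Balanced-ᵀ : ∀ {n r K ζ} {G : BipGraph n} → Balanced r K ζ G → Balanced r K ζ (G ᵀ)
Balanced-ᵀ b = record { ctx = Dense-ᵀ ctx ; few = few′ ; few′ = few }
  where open Balanced b

module Typical {n r K ζ} {G : BipGraph n} (b : Balanced r K ζ G) where
  open Balanced b
  open Dense ctx using (mind)
  open Half ctx using (Big; d)
  private
    module T = Half (Dense-ᵀ ctx)
    module W = Waste ctx ζ few
    module Wᵀ = Waste (Dense-ᵀ ctx) ζ few′

  Ty : Pred n
  Ty u = W.Typ u ∧ Wᵀ.Typ′ u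

  #∁Ty : K * # (∁ Ty) ≤ τ r ζ * n
  #∁Ty = arith K r ζ (# (∁ Ty)) (# (∁ W.Typ)) (# (∁ Wᵀ.Typ′)) n (#-∪ {P = ∁ Ty} {∁ W.Typ} {∁ Wᵀ.Typ′} λ u → pt (W.Typ u) (Wᵀ.Typ′ u)) W.#∁Typ Wᵀ.#∁Typ′
    where
    pt : ∀ a b → not (a ∧ b) ≡ true → not a ≡ true ⊎ not b ≡ true
    pt false b h = inj₁ refl
    pt true  b h = inj₂ h
    arith : ∀ K r z a b c n → a ≤ b + c → K * b ≤ (2 + r * suc z) * n → K * c ≤ (2 + z + r * suc z) * n → K * a ≤ (4 + z + 2 * (r * suc z)) * n
    arith K r z a b c n h h₁ h₂ = lin 0 (K ⊗ h ⊕ h₁ ⊕ h₂) (solve (K ∷ r ∷ z ∷ a ∷ b ∷ c ∷ n ∷ []))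

  Ty-deg : ∀ {u} → u ∈ Ty → d u ≤ suc r
  Ty-deg p = W.Typ-low (∧-left p)

  Ty-Big : ∀ {u} → u ∈ Ty → deg G T.Big u ≡ r
  Ty-Big {u} p = Wᵀ.Typ′-big (∧-right {W.Typ u} p)

  Ty-∁Big : ∀ {u} → u ∈ Ty → u ∈ ∁ Big
  Ty-∁Big p = ∧-left (∧-left p)

  Ty-partner : ∀ {u} → u ∈ Ty → deg G (∁ T.Big) u ≤ 1
  Ty-partner {u} p = +-cancelˡ-≤ r _ _ (begin
    r + deg G (∁ T.Big) u                   ≡⟨ cong (_+ deg G (∁ T.Big) u) (sym (Ty-Big p)) ⟩
    deg G T.Big u + deg G (∁ T.Big) u       ≡⟨ sym (deg-split G full T.Big u) ⟩
    d u                                     ≤⟨ Ty-deg p ⟩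
    suc r                                   ≡⟨ +-comm 1 r ⟩
    r + 1                                   ∎)
    where open ≤-Reasoning

  ∑-stray : ∑[ ∁ Big ∖ Ty ] d ≤ suc r * # (∁ Ty) + W.waste
  ∑-stray = ≤-trans (W.∑-small {∁ Big ∖ Ty} λ u → ∧-left) (+-monoˡ-≤ W.waste (*-monoʳ-≤ (suc r) (#-mono {P = ∁ Big ∖ Ty} {∁ Ty} λ u → ∧-right {∁ Big u})))

  #stray : K * ∑[ ∁ Big ∖ Ty ] d ≤ (2 + r) * τ r ζ * n
  #stray = arith K r ζ (# (∁ Ty)) W.waste (∑[ ∁ Big ∖ Ty ] d) n ∑-stray #∁Ty W.#waste
    where
    arith : ∀ K r z a w s n → s ≤ suc r * a + w → K * a ≤ (4 + z + 2 * (r * suc z)) * n → K * w ≤ suc (r * suc z) * n →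
      K * s ≤ (2 + r) * (4 + z + 2 * (r * suc z)) * n
    arith K r z a w s n h h₁ h₂ = lin ((3 + z + r * suc z) * n) (K ⊗ h ⊕ suc r ⊗ h₁ ⊕ h₂) (solve (K ∷ r ∷ z ∷ a ∷ w ∷ s ∷ n ∷ []))

module Balance {n r K ζ} {G : BipGraph n} (b : Balanced r K ζ G) (K-large : 2 + τ r ζ ≤ K) where
  open Balanced b
  open Dense ctx using (sat; 1≤n; mind; mind′; 1≤K; n≥low)
  open Half ctx
  open Typical b
  open Average ctx
  private
    module T = Half (Dense-ᵀ ctx)
    module Tᵀ = Typical (Balanced-ᵀ b)

  Pair : Pred n
  Pair y = Tᵀ.Ty y ∧ (1 ≤ᵇ deg (G ᵀ) Ty y)

  -- A typical vertex without typical neighbour has a neighbour that is neither big nor typical, and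
  -- the total degree of such vertices is negligible.
  #∁Pair : K * # (∁ Pair) ≤ (3 + r) * τ r ζ * n
  #∁Pair = arith K r (τ r ζ) (# (∁ Pair)) (# (∁ Tᵀ.Ty)) (# Single) (∑[ ∁ Big ∖ Ty ] d) n
      (#-∪ {P = ∁ Pair} {∁ Tᵀ.Ty} {Single} λ y → pt (Tᵀ.Ty y) (1 ≤ᵇ deg (G ᵀ) Ty y)) #Single Tᵀ.#∁Ty #stray
    where
    Single : Pred n
    Single y = Tᵀ.Ty y ∧ not (1 ≤ᵇ deg (G ᵀ) Ty y)
    pt : ∀ a b → not (a ∧ b) ≡ true → not a ≡ true ⊎ (a ∧ not b) ≡ true
    pt false b h = inj₁ refl
    pt true  b h = inj₂ h
    stray-nbr : ∀ y → y ∈ Single → 1 ≤ deg (G ᵀ) (∁ Big ∖ Ty) y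
    stray-nbr y p = arith (deg (G ᵀ) full y) (deg (G ᵀ) Big y) (deg (G ᵀ) (∁ Big) y) (deg (G ᵀ) (∁ Big ∩ Ty) y) (deg (G ᵀ) (∁ Big ∖ Ty) y) r
        (mind′ y) (Tᵀ.Ty-Big (∧-left p)) (deg-split (G ᵀ) full Big y) (deg-split (G ᵀ) (∁ Big) Ty y)
        (≤-trans (s≤s (deg-mono (G ᵀ) {∁ Big ∩ Ty} {Ty} y λ u → ∧-right {∁ Big u})) (≤ᵇ-false⁻¹ (not-false (∧-right {Tᵀ.Ty y} p))))
      where
      arith : ∀ d b b′ s t r → suc r ≤ d → b ≡ r → d ≡ b + b′ → b′ ≡ s + t → s < 1 → 1 ≤ t
      arith d b b′ s t r h refl refl refl h₂ = lin 0 (h ⊕ h₂) (solve (r ∷ s ∷ t ∷ []))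
    #Single : # Single ≤ ∑[ ∁ Big ∖ Ty ] d
    #Single = ≤-trans (#≤∑deg G (∁ Big ∖ Ty) Single stray-nbr) (∑[]-mono λ u _ → deg-mono G {Single} {full} u λ _ _ → refl)
    arith : ∀ K r t a b c s n → a ≤ b + c → c ≤ s → K * b ≤ t * n → K * s ≤ (2 + r) * t * n → K * a ≤ (3 + r) * t * n
    arith K r t a b c s n h h₁ h₂ h₃ = lin 0 (K ⊗ h ⊕ K ⊗ h₁ ⊕ h₂ ⊕ h₃) (solve (K ∷ r ∷ t ∷ a ∷ b ∷ c ∷ s ∷ n ∷ []))

  pivot : ∃[ u ] (u ∈ Ty × K * # (Rem u) ≤ n)
  pivot = average (arith K n (τ r ζ) (# Ty) (# (∁ Ty)) #∁Ty (#-∁ Ty) K-large 1≤n)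
    where
    arith : ∀ K n t a b → K * b ≤ t * n → a + b ≡ n → 2 + t ≤ K → 1 ≤ n → n < K * a
    arith K n t a b h refl h₁ h₂ = lin 0 (h ⊕ (a + b) ⊗ h₁ ⊕ h₂) (solve (K ∷ t ∷ a ∷ b ∷ []))

  -- A generic `y` is completed with `u₀` through `P`, and then all its neighbours lie in `F`, or
  -- through the star `S`. Whichever prevails yields a nearly full set; `Mixed` excludes that
  -- neither does.
  module Pivot {u₀} (u₀∈Ty : u₀ ∈ Ty) (rare : K * # (Rem u₀) ≤ n) where
    P S F : Pred n
    P y = T.Big y ∧ G u₀ y
    S = Star u₀
    F = nb (G ᵀ) P

    #P : # P ≡ r
    #P = trans (sym (deg-# G T.Big u₀)) (Ty-Big u₀∈Ty)

    Jb Gen : Pred n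
    Jb y = not (1 ≤ᵇ deg (G ᵀ) (∁ F) y)
    Gen y = (Tᵀ.Ty y ∧ not (G u₀ y)) ∧ not (Rem u₀ y)

    Jb-elim : ∀ {y u} → y ∈ Jb → G u y ≡ true → u ∈ F
    Jb-elim {y} {u} p a with ∈-or-∉ F u
    ... | inj₁ q = q
    ... | inj₂ q = true≢false (≤ᵇ-true (deg-∈ {G = G ᵀ} {∁ F} q a)) (not-false p)

    Jb-intro : ∀ {y} → (∀ u → G u y ≡ true → u ∈ F) → y ∈ Jb
    Jb-intro {y} h with bool-cases (1 ≤ᵇ deg (G ᵀ) (∁ F) y)
    ... | inj₂ q = not-true q
    ... | inj₁ q = go (deg-∃ {G = G ᵀ} {∁ F} (≤ᵇ-true⁻¹ q))
      where
      go : ∃[ u ] (u ∈ ∁ F × G u y ≡ true) → y ∈ Jb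
      go (u , p , a) = true≢false (h u a) (∁-∉ {P = F} p)

    -- A typical y completed by r big neighbours of u, which then are all of P, lies in Jb.
    absorbed : ∀ {y} {X X′ : Pred n} → y ∈ Tᵀ.Ty → Complete G X X′ → X ⊆ (G ᵀ) y → X′ ⊆ P → suc r ≤ # X → r ≤ # X′ → y ∈ Jb
    absorbed {y} {X} {X′} t cpl X-adj sub a b = Jb-intro λ u q → nb-intro λ z m →
      cpl u z (N⊆X u q) (#-⊆-≥ {P = X′} {P} sub (≤-trans (≤-reflexive #P) b) z m)
      where
      N⊆X : (G ᵀ) y ⊆ X
      N⊆X = #-⊆-≥ {P = X} {(G ᵀ) y} X-adj (≤-trans (≤-reflexive (sym (deg-# (G ᵀ) full y))) (≤-trans (Tᵀ.Ty-deg t) a))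

    #∁Gen : K * # (∁ Gen) ≤ (2 + τ r ζ) * n
    #∁Gen = arith K (τ r ζ) (# (∁ Gen)) (# (∁ Tᵀ.Ty)) (# (G u₀)) (# (Rem u₀)) n
        (#-∪₃ {P = ∁ Gen} {∁ Tᵀ.Ty} {G u₀} {Rem u₀} λ y → pt (Tᵀ.Ty y) (G u₀ y) (Rem u₀ y)) Tᵀ.#∁Ty
        (≤-trans (K ⊗ ≤-trans (≤-reflexive (sym (deg-# G full u₀))) (≤-trans (Ty-deg u₀∈Ty) r<D)) (K≤ n≥low)) rare
      where
      pt : ∀ a b c → not ((a ∧ not b) ∧ not c) ≡ true → not a ≡ true ⊎ b ≡ true ⊎ c ≡ true
      pt false b c h = inj₁ refl
      pt true true c h = inj₂ (inj₁ refl)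
      pt true false true h = inj₂ (inj₂ refl)
      arith : ∀ K t g a b c n → g ≤ a + b + c → K * a ≤ t * n → K * b ≤ n → K * c ≤ n → K * g ≤ (2 + t) * n
      arith K t g a b c n h h₁ h₂ h₃ = lin 0 (K ⊗ h ⊕ h₁ ⊕ h₂ ⊕ h₃) (solve (K ∷ t ∷ g ∷ a ∷ b ∷ c ∷ n ∷ []))

    dichotomy : ∀ {y} → y ∈ Gen → y ∉ Jb → r ≤ # S × y ∈ nb G S
    dichotomy {y} p y∉Jb = go (through (Ty-deg u₀∈Ty) (not-false (∧-right {Tᵀ.Ty y} (∧-left p))))
      where
      t : y ∈ Tᵀ.Ty
      t = ∧-left (∧-left p)
      go : _ → r ≤ # S × y ∈ nb G S
      go (inj₁ s) = s
      go (inj₂ (X , X′ , cpl , X-adj , X′-adj , a , b)) = ⊥-elim (go′ (T.bad-intro {y} {u₀} {X′} {X} (λ x z p q → cpl z x q p) X-adj a X′-adj))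
        where
        go′ : X′ ⊆ T.Big ⊎ T.bad y u₀ ≡ true → ⊥
        go′ (inj₂ q) = true≢false (∧-intro (T.low (Tᵀ.Ty-deg t)) q) (not-false (∧-right {Tᵀ.Ty y ∧ not (G u₀ y)} p))
        go′ (inj₁ s) = true≢false (absorbed {X = X} {X′} t cpl X-adj (λ z m → ∧-intro (s z m) (X′-adj z m)) a b) y∉Jb

    -- Each typical u has one partner outside T.Big, so partners transfer sizes between the classes.
    transfer : ∀ {B A} → B ⊆ Tᵀ.Ty → A ⊆ Ty → (∀ y → y ∈ B → 1 ≤ deg (G ᵀ) A y) → # B ≤ # A
    transfer {B} {A} s s′ h = begin
      # B                      ≤⟨ #≤∑deg G A B h ⟩
      ∑[ A ] (deg G B)         ≤⟨ ∑[]-mono (λ u p → ≤-trans (deg-mono G {B} {∁ T.Big} u λ y q → Tᵀ.Ty-∁Big (s y q)) (Ty-partner (s′ u p))) ⟩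
      ∑[ A ] (λ _ → 1)         ≡⟨ trans (∑[]-const A 1) (+-identityʳ _) ⟩
      # A                      ∎
      where open ≤-Reasoning

    JP : Pred n
    JP y = Jb y ∧ Pair y

    -- The typical neighbours of `JP` lie in `F`, and each serves at most one vertex of `JP`. So `F`
    -- misses no more vertices than `JP` does.
    dual : K * # (∁ JP) ≤ β r ζ * n → NearFull r K (β r ζ) (G ᵀ)
    dual h = record { S = P ; hS = #P ; most = ≤-trans (K ⊗ arith n (# JP) (# (∁ JP)) (# F) (# (∁ F)) (≤-trans #JP (#-mono {P = Ty ∩ F} λ u → ∧-right {Ty u})) (#-∁ JP) (#-∁ F)) h }
      where
      #JP : # JP ≤ # (Ty ∩ F)
      #JP = transfer {JP} {Ty ∩ F} (λ y p → ∧-left (∧-right {Jb y} p)) (λ u → ∧-left) λ y p → partner y p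
        where
        partner : ∀ y → y ∈ JP → 1 ≤ deg (G ᵀ) (Ty ∩ F) y
        partner y p = go (deg-∃ {G = G ᵀ} {Ty} (≤ᵇ-true⁻¹ (∧-right {Tᵀ.Ty y} (∧-right {Jb y} p))))
          where
          go : ∃[ u ] (u ∈ Ty × G u y ≡ true) → _
          go (u , t , a) = deg-∈ {G = G ᵀ} {Ty ∩ F} (∧-intro t (Jb-elim (∧-left p) a)) a
      arith : ∀ n a b c d → a ≤ c → a + b ≡ n → c + d ≡ n → d ≤ b
      arith n a b c d h refl h₂ = lin 0 (h ⊕ ≤-reflexive h₂) (solve (a ∷ b ∷ c ∷ d ∷ []))

    large : ∀ K r t g p b x n → x ≤ g + p + b → K * g ≤ (2 + t) * n → K * p ≤ (3 + r) * t * n → (6 + t + (3 + r) * t) * n < K * x → 4 * n < K * b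
    large K r t g p b x n h h₁ h₂ h₃ = lin 0 (K ⊗ h ⊕ h₁ ⊕ h₂ ⊕ h₃) (solve (K ∷ r ∷ t ∷ g ∷ p ∷ b ∷ x ∷ n ∷ []))

    module Left (jb : β r ζ * n < K * # (∁ JP)) where
      B₁ : Pred n
      B₁ y = Gen y ∧ not (Jb y)

      #B₁ : 4 * n < K * # B₁
      #B₁ = large K r (τ r ζ) (# (∁ Gen)) (# (∁ Pair)) (# B₁) (# (∁ JP)) n
          (#-∪₃ {P = ∁ JP} {∁ Gen} {∁ Pair} {B₁} λ y → pt (Jb y) (Pair y) (Gen y)) #∁Gen #∁Pair jb
        where
        pt : ∀ a b c → not (a ∧ b) ≡ true → not c ≡ true ⊎ not b ≡ true ⊎ (c ∧ not a) ≡ true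
        pt a     b     false h = inj₁ refl
        pt a     false true  h = inj₂ (inj₁ refl)
        pt false true  true  h = inj₂ (inj₂ refl)

      B₁-star : ∀ {y} → y ∈ B₁ → r ≤ # S × y ∈ nb G S
      B₁-star {y} p = dichotomy (∧-left p) (not-false (∧-right {Gen y} p))

      member : ∃[ y ] y ∈ B₁
      member = #-∃ {P = B₁} (arith K n (# B₁) #B₁)
        where
        arith : ∀ K n b → 4 * n < K * b → 1 ≤ b
        arith K n zero    h = ⊥-elim (<⇒≱ h (≤-trans (≤-reflexive (*-zeroʳ K)) z≤n))
        arith K n (suc b) h = s≤s z≤n

    module Mixed (jb : β r ζ * n < K * # (∁ JP)) (ja : β r ζ * n < K * # (∁ (nb G S))) where
      open Left jb

      B₂ A₂ : Pred n
      B₂ y = (Gen y ∧ Pair y) ∧ not (nb G S y)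
      A₂ u = Ty u ∧ (1 ≤ᵇ deg G B₂ u)

      #B₂ : 4 * n < K * # B₂
      #B₂ = large K r (τ r ζ) (# (∁ Gen)) (# (∁ Pair)) (# B₂) (# (∁ (nb G S))) n
          (#-∪₃ {P = ∁ (nb G S)} {∁ Gen} {∁ Pair} {B₂} λ y → pt (nb G S y) (Pair y) (Gen y)) #∁Gen #∁Pair ja
        where
        pt : ∀ a b c → not a ≡ true → not c ≡ true ⊎ not b ≡ true ⊎ ((c ∧ b) ∧ not a) ≡ true
        pt a     b     false h = inj₁ refl
        pt a     false true  h = inj₂ (inj₁ refl)
        pt false true  true  h = inj₂ (inj₂ refl)

      -- Each vertex of the star is adjacent to all of `B₁`, hence has degree above n / K, and `Q`
      -- is at least K.
      S⊆Big : S ⊆ Big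
      S⊆Big x p = ≤ᵇ-true (≤-trans (<⇒≤ (arith K n (# B₁) #B₁)) (≤-trans (*-monoʳ-≤ K B₁≤) (≤-trans (≤-reflexive (cong (_* d x) (sym (*-identityʳ K))))
          (*-monoˡ-≤ (d x) {K * 1} {Q} (K ⊗ ≤-trans 1≤K (≤-trans (≤-reflexive (sym (*-identityʳ K))) (K ⊗ s≤s z≤n)))))))
        where
        B₁≤ : # B₁ ≤ d x
        B₁≤ = ⊆-deg {G = G} {B₁} {full} (λ _ _ → refl) λ y q → nb-adj {G = G} {S} (proj₂ (B₁-star q)) p
        arith : ∀ K n b → 4 * n < K * b → n < K * b
        arith K n b h = lin (3 * n) h (solve (K ∷ n ∷ b ∷ []))

      #B₂≤#A₂ : # B₂ ≤ # A₂
      #B₂≤#A₂ = transfer {B₂} {A₂} (λ y p → ∧-left (∧-left (∧-left (∧-left p)))) (λ u → ∧-left) partner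
        where
        partner : ∀ y → y ∈ B₂ → 1 ≤ deg (G ᵀ) A₂ y
        partner y p = go (deg-∃ {G = G ᵀ} {Ty} (≤ᵇ-true⁻¹ (∧-right {Tᵀ.Ty y} (∧-right {Gen y} (∧-left p)))))
          where
          go : ∃[ u ] (u ∈ Ty × G u y ≡ true) → _
          go (u , t , a) = deg-∈ {G = G ᵀ} {A₂} (∧-intro t (≤ᵇ-true (deg-∈ {G = G} {B₂} p a))) a

      -- u ∈ A₂ sees P and a vertex outside the star, y₁ ∈ B₁ sees S and a vertex outside F.
      incompatible : ∀ u y₁ → u ∈ A₂ → y₁ ∈ B₁ → rel u y₁ ≡ true ⊎ T.rel y₁ u ≡ true
      incompatible u y₁ u∈A₂ y₁∈B₁ = go (bool-cases (G u y₁))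
        where
        t : u ∈ Ty
        t = ∧-left u∈A₂
        t₁ : y₁ ∈ Tᵀ.Ty
        t₁ = ∧-left (∧-left (∧-left y₁∈B₁))
        partner : ∃[ y ] (y ∈ B₂ × G u y ≡ true)
        partner = deg-∃ {G = G} {B₂} (≤ᵇ-true⁻¹ (∧-right {Ty u} u∈A₂))
        y₂ : Fin n
        y₂ = proj₁ partner
        y₂∈B₂ : y₂ ∈ B₂
        y₂∈B₂ = proj₁ (proj₂ partner)
        y₂∈Jb : y₂ ∈ Jb
        y₂∈Jb with bool-cases (Jb y₂)
        ... | inj₁ q = q
        ... | inj₂ q = true≢false (proj₂ (dichotomy (∧-left (∧-left y₂∈B₂)) q)) (not-false (∧-right {Gen y₂ ∧ Pair y₂} y₂∈B₂))
        u∈F : u ∈ F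
        u∈F = Jb-elim y₂∈Jb (proj₂ (proj₂ partner))
        big⊆P : (T.Big ∩ G u) ⊆ P
        big⊆P = #-⊆-≥ {P = P} {T.Big ∩ G u} (λ z m → ∧-intro (∧-left m) (nb-adj {G = G ᵀ} {P} u∈F m))
          (≤-trans (≤-reflexive (sym (deg-# G T.Big u))) (≤-trans (≤-reflexive (Ty-Big t)) (≤-reflexive (sym #P))))
        module Missing (u≁y₁ : G u y₁ ≡ false) where
          open Completion (Sat.comp sat u y₁ u≁y₁)
          go₁ : r ≤ # X → suc r ≤ # X′ → X ⊆ Big ⊎ bad u y₁ ≡ true → rel u y₁ ≡ true
          go₁ a h (inj₂ q) = ∨-inj₁ q
          go₁ a h (inj₁ s) = true≢false (nb-intro λ x p → cpl x y₂ (S⊆X x p) (N⊆X′ y₂ (proj₂ (proj₂ partner)))) (not-false (∧-right {Gen y₂ ∧ Pair y₂} y₂∈B₂))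
            where
            N⊆X′ : G u ⊆ X′
            N⊆X′ = #-⊆-≥ {P = X′} {G u} X′-adj (≤-trans (≤-reflexive (sym (deg-# G full u))) (≤-trans (Ty-deg t) h))
            big⊆X : (Big ∩ (G ᵀ) y₁) ⊆ X
            big⊆X = #-⊆-≥ {P = X} {Big ∩ (G ᵀ) y₁} (λ x p → ∧-intro (s x p) (X-adj x p))
              (≤-trans (≤-reflexive (sym (deg-# (G ᵀ) Big y₁))) (≤-trans (≤-reflexive (Tᵀ.Ty-Big t₁)) a))
            S⊆X : S ⊆ X
            S⊆X x p = big⊆X x (∧-intro (S⊆Big x p) (nb-adj {G = G} {S} (proj₂ (B₁-star y₁∈B₁)) p))
          go₂ : suc r ≤ # X → r ≤ # X′ → X′ ⊆ T.Big ⊎ T.bad y₁ u ≡ true → T.rel y₁ u ≡ true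
          go₂ a h (inj₂ q) = ∨-inj₁ q
          go₂ a h (inj₁ s) = true≢false (absorbed {X = X} {X′} t₁ cpl X-adj (λ z m → big⊆P z (∧-intro (s z m) (X′-adj z m))) a h)
            (not-false (∧-right {Gen y₁} y₁∈B₁))
          result : (r ≤ # X × suc r ≤ # X′) ⊎ (suc r ≤ # X × r ≤ # X′) → rel u y₁ ≡ true ⊎ T.rel y₁ u ≡ true
          result (inj₁ (a , h)) = inj₁ (go₁ a h (bad-intro {u} {y₁} {X} {X′} cpl X′-adj h X-adj))
          result (inj₂ (a , h)) = inj₂ (go₂ a h (T.bad-intro {y₁} {u} {X′} {X} (λ x z p q → cpl z x q p) X-adj a X′-adj))
        go : G u y₁ ≡ true ⊎ G u y₁ ≡ false → rel u y₁ ≡ true ⊎ T.rel y₁ u ≡ true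
        go (inj₁ q) = inj₁ (∨-inj₂ {bad u y₁} q)
        go (inj₂ q) = Missing.result q (Completion.size (Sat.comp sat u y₁ q))

      absurd : ⊥
      absurd = go (cover K (2 * n) rel T.rel {A₂} {B₁} incompatible
          (λ u p → rel-sparse (low (Ty-deg (∧-left p)))) λ y p → T.rel-sparse (T.low (Tᵀ.Ty-deg (∧-left (∧-left (∧-left p))))))
        where
        four : 2 * (2 * n) ≡ 4 * n
        four = solve (n ∷ [])
        go : K * # A₂ ≤ 2 * (2 * n) ⊎ K * # B₁ ≤ 2 * (2 * n) → ⊥
        go (inj₁ h) = <⇒≱ #B₂ (≤-trans (K ⊗ #B₂≤#A₂) (≤-trans h (≤-reflexive four)))
        go (inj₂ h) = <⇒≱ #B₁ (≤-trans h (≤-reflexive four))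

    result : NearFull r K (β r ζ) G ⊎ NearFull r K (β r ζ) (G ᵀ)
    result = go (K * # (∁ JP) ≤? β r ζ * n) (K * # (∁ (nb G S)) ≤? β r ζ * n)
      where
      go : _ → _ → NearFull r K (β r ζ) G ⊎ NearFull r K (β r ζ) (G ᵀ)
      go (yes h) _ = inj₂ (dual h)
      go (no ¬h) (no ¬h′) = ⊥-elim (Mixed.absurd (≰⇒> ¬h) (≰⇒> ¬h′))
      go (no ¬h) (yes h′) = inj₁ (record { S = S ; hS = ≤-antisym (#Star u₀) (proj₁ some) ; most = h′ })
        where
        some : r ≤ # S × proj₁ (Left.member (≰⇒> ¬h)) ∈ nb G S
        some = Left.B₁-star (≰⇒> ¬h) (proj₂ (Left.member (≰⇒> ¬h)))

-- With ζ = 4 the atypical vertices number at most (2 + 5 r) n / K. More than `ζ₀ r` n / K vertices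
-- with too few big neighbours therefore include more than n / K typical ones, as `average`
-- requires.
ζ₀ : ℕ → ℕ
ζ₀ r = 8 + 5 * r

NearFull-weaken : ∀ {n r K c c′} {G : BipGraph n} → c ≤ c′ → NearFull r K c G → NearFull r K c′ G
NearFull-weaken {n} h f = record { S = S ; hS = hS ; most = ≤-trans most (*-monoˡ-≤ n h) }
  where open NearFull f

3≤β : ∀ r z → 3 ≤ β r z
3≤β r z = s≤s (s≤s (s≤s z≤n))

-- If the other class also has few low vertices lacking r big neighbours, the balanced case applies.
-- If it has many, some typical one has few bad partners and `isolated-star` applies.
one-side-rich : ∀ {n r K} {G : BipGraph n} (ctx : Dense r K G) → 2 + τ r (ζ₀ r) ≤ K →
  K * # (Half.L (Dense-ᵀ ctx) ∖ Half.Good′ ctx) ≤ 4 * n → NearFull r K (β r (ζ₀ r)) G ⊎ NearFull r K (β r (ζ₀ r)) (G ᵀ)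
one-side-rich {n} {r} {K} {G} ctx K-large few = go (K * # Z ≤? ζ₀ r * n)
  where
  open Half ctx
  module W = Waste ctx 4 few
  module T = Half (Dense-ᵀ ctx)
  Z : Pred n
  Z = L ∖ T.Good′
  go : _ → NearFull r K (β r (ζ₀ r)) G ⊎ NearFull r K (β r (ζ₀ r)) (G ᵀ)
  go (yes few′) = Balance.Pivot.result b K-large (proj₁ (proj₂ p)) (proj₂ (proj₂ p))
    where
    b : Balanced r K (ζ₀ r) G
    b = record { ctx = ctx ; few = ≤-trans few (*-monoˡ-≤ n (m≤m+n 4 (4 + 5 * r))) ; few′ = few′ }
    p = Balance.pivot b K-large
  go (no many) = inj₁ (NearFull-weaken (3≤β r (ζ₀ r)) (isolated-star (≤-trans (m≤m+n 4 _) (≤-trans (m≤n+m _ 2) K-large))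
      (W.Typ-low (∧-right {Z u} u∈)) (≤ᵇ-false⁻¹ (∖-∉ {P = L} {T.Good′} (∧-left u∈))) (proj₂ (proj₂ p))))
    where
    open Average ctx
    p = average {Z ∩ W.Typ} (arith K r n (# Z) (# (Z ∩ W.Typ)) (# (∁ W.Typ)) (#-∪ {P = Z} {Z ∩ W.Typ} {∁ W.Typ} pt) W.#∁Typ (≰⇒> many))
      where
      pt : ∀ u → u ∈ Z → u ∈ Z ∩ W.Typ ⊎ u ∈ ∁ W.Typ
      pt u p with ∈-or-∉ W.Typ u
      ... | inj₁ t = inj₁ (∧-intro p t)
      ... | inj₂ t = inj₂ t
      arith : ∀ K r n z w t → z ≤ w + t → K * t ≤ (2 + r * 5) * n → (8 + 5 * r) * n < K * z → n < K * w
      arith K r n z w t h₁ h₂ h₃ = lin (5 * n) (K ⊗ h₁ ⊕ h₂ ⊕ h₃) (solve (K ∷ r ∷ n ∷ z ∷ w ∷ t ∷ []))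
    u = proj₁ p
    u∈ : u ∈ Z ∩ W.Typ
    u∈ = proj₁ (proj₂ p)

-- Two low vertices that both lack r big neighbours cannot be completed through big vertices, so
-- such pairs lie in sparse relations. By `cover`, one class has few such vertices.
exists-near-full : ∀ {n r K} {G : BipGraph n} → Dense r K G → 2 + τ r (ζ₀ r) ≤ K →
  NearFull r K (β r (ζ₀ r)) G ⊎ NearFull r K (β r (ζ₀ r)) (G ᵀ)
exists-near-full {n} {r} {K} {G} ctx K-large = go (cover K (2 * n) rel T.rel {L ∖ T.Good′} {T.L ∖ Good′} pairs
    (λ u p → rel-sparse (∧-left p)) λ y p → T.rel-sparse (∧-left p))
  where
  open Dense ctx using (sat)
  open Half ctx
  module T = Half (Dense-ᵀ ctx)
  four : 2 * (2 * n) ≡ 4 * n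
  four = solve (n ∷ [])
  go : _ → NearFull r K (β r (ζ₀ r)) G ⊎ NearFull r K (β r (ζ₀ r)) (G ᵀ)
  go (inj₁ h) = swap (one-side-rich (Dense-ᵀ ctx) K-large (≤-trans h (≤-reflexive four)))
  go (inj₂ h) = one-side-rich ctx K-large (≤-trans h (≤-reflexive four))
  pairs : ∀ u y → u ∈ L ∖ T.Good′ → y ∈ T.L ∖ Good′ → rel u y ≡ true ⊎ T.rel y u ≡ true
  pairs u y p q = adj (bool-cases (G u y))
    where
    poor : deg G T.Big u < r
    poor = ≤ᵇ-false⁻¹ (∖-∉ {P = L} {T.Good′} p)
    poor′ : deg (G ᵀ) Big y < r
    poor′ = ≤ᵇ-false⁻¹ (∖-∉ {P = T.L} {Good′} q)
    module Missing (u≁y : G u y ≡ false) where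
      open Completion (Sat.comp sat u y u≁y)
      go₁ : r ≤ # X → X ⊆ Big ⊎ bad u y ≡ true → rel u y ≡ true
      go₁ a (inj₁ s) = ⊥-elim (<⇒≱ poor′ (≤-trans a (⊆-deg {G = G ᵀ} {X} {Big} s X-adj)))
      go₁ a (inj₂ b) = ∨-inj₁ b
      go₂ : r ≤ # X′ → X′ ⊆ T.Big ⊎ T.bad y u ≡ true → T.rel y u ≡ true
      go₂ a (inj₁ s) = ⊥-elim (<⇒≱ poor (≤-trans a (⊆-deg {G = G} {X′} {T.Big} s X′-adj)))
      go₂ a (inj₂ b) = ∨-inj₁ b
      result : (r ≤ # X × suc r ≤ # X′) ⊎ (suc r ≤ # X × r ≤ # X′) → rel u y ≡ true ⊎ T.rel y u ≡ true
      result (inj₁ (a , h)) = inj₁ (go₁ a (bad-intro {u} {y} {X} {X′} cpl X′-adj h X-adj))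
      result (inj₂ (a , h)) = inj₂ (go₂ h (T.bad-intro {y} {u} {X′} {X} (λ x z p q → cpl z x q p) X-adj a X′-adj))
    adj : G u y ≡ true ⊎ G u y ≡ false → rel u y ≡ true ⊎ T.rel y u ≡ true
    adj (inj₁ a) = inj₁ (∨-inj₂ {bad u y} a)
    adj (inj₂ a) = Missing.result a (Completion.size (Sat.comp sat u y a))

-- Choice of the constants and of the threshold

coefficient offset : ℕ → ℕ
coefficient r = (2 + r) * (2 * suc (r + r * r) + 1)
offset r = (2 + r) * (2 * suc r) + r + 2

-- The left side is `coefficient r * e + offset r`. The bound on K keeps the first summand at most n
-- / 2, the bound on n keeps the second below n / 2.
near-full-size : ∀ n r e K b → 1 ≤ b → 2 * coefficient r * b ≤ K → 2 * offset r + 1 ≤ n → K * e ≤ b * n →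
  (2 + r) * (2 * (suc (r + r * r) * e + suc r) + e) + r + 2 < n
near-full-size n r e K b 1≤b K≥ n≥ h = arith n e (coefficient r) (offset r) n≥
    (*-cancelˡ-≤ b {{>-nonZero 1≤b}} (≤-trans (≤-trans (≤-reflexive (assoc b (coefficient r) e)) (*-monoˡ-≤ e K≥)) h)) (expand r e)
  where
  assoc : ∀ b c e → b * (2 * c * e) ≡ 2 * c * b * e
  assoc = solve-∀
  expand : ∀ r e → (2 + r) * (2 * (suc (r + r * r) * e + suc r) + e) + r + 2 ≡ (2 + r) * (2 * suc (r + r * r) + 1) * e + ((2 + r) * (2 * suc r) + r + 2)
  expand = solve-∀
  arith : ∀ n e c o {x} → 2 * o + 1 ≤ n → 2 * c * e ≤ n → x ≡ c * e + o → x < n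
  arith n e c o h₁ h₂ refl = *-cancelˡ-< 2 (c * e + o) n (lin 0 (h₁ ⊕ h₂) (solve (n ∷ e ∷ c ∷ o ∷ [])))

extremal : ∀ {n r} K {G : BipGraph n} → 2 * coefficient r * β r (ζ₀ r) ≤ K → 2 + τ r (ζ₀ r) ≤ K →
  suc r * (K * (bigDegree r K * suc (2 * r))) ≤ n → K * (K * lowDegree r K) ≤ n → 2 * offset r + 1 ≤ n → r + (2 + r) ≤ n →
  Sat r G → edges G ≤ r * n + suc r * (n ∸ r) → Fam r G ⊎ Fam r (G ᵀ)
extremal {n} {r} K {G} K≥₁ K≥₂ n≥₁ n≥₂ n≥₃ n≥₄ sat few = go (scan {A = Fam r G} {B = λ y → suc r ≤ deg (G ᵀ) full y} full low′)
                                                            (scan {A = Fam r (G ᵀ)} {B = λ u → suc r ≤ deg G full u} full low)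
  where
  r≤n : r ≤ n
  r≤n = ≤-trans (m≤m+n r _) n≥₄
  fewᵀ : edges (G ᵀ) ≤ r * n + suc r * (n ∸ r)
  fewᵀ = ≤-trans (≤-reflexive (edges-ᵀ G)) few
  low′ : ∀ y → y ∈ full → Fam r G ⊎ suc r ≤ deg (G ᵀ) full y
  low′ y _ with suc r ≤? deg (G ᵀ) full y
  ... | yes h = inj₂ h
  ... | no ¬h = inj₁ (LowDegree.At.fam sat few n≥₄ (≤-pred (≰⇒> ¬h)))
  low : ∀ u → u ∈ full → Fam r (G ᵀ) ⊎ suc r ≤ deg G full u
  low u _ with suc r ≤? deg G full u
  ... | yes h = inj₂ h
  ... | no ¬h = inj₁ (LowDegree.At.fam (Sat-ᵀ sat) fewᵀ n≥₄ (≤-pred (≰⇒> ¬h)))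
  close : ∀ e → K * e ≤ β r (ζ₀ r) * n → (2 + r) * (2 * (suc (r + r * r) * e + suc r) + e) + r + 2 < n
  close e h = near-full-size n r e K (β r (ζ₀ r)) (s≤s z≤n) K≥₁ n≥₃ h
  go : Fam r G ⊎ (∀ y → y ∈ full → suc r ≤ deg (G ᵀ) full y) → Fam r (G ᵀ) ⊎ (∀ u → u ∈ full → suc r ≤ deg G full u) → Fam r G ⊎ Fam r (G ᵀ)
  go (inj₁ f) _ = inj₁ f
  go (inj₂ _) (inj₁ f) = inj₂ f
  go (inj₂ mind′) (inj₂ mind) = finish (exists-near-full ctx K≥₂)
    where
    ctx : Dense r K G
    ctx = record { sat = sat ; mind = λ u → mind u refl ; mind′ = λ y → mind′ y refl ; few = ≤-trans few few′
      ; 1≤K = ≤-trans (s≤s z≤n) K≥₂ ; 1≤n = ≤-trans (m≤n+m 1 (2 * offset r)) n≥₃ ; n≥Big = n≥₁ ; n≥low = n≥₂ }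
      where
      few′ : r * n + suc r * (n ∸ r) ≤ suc (2 * r) * n
      few′ = ≤-trans (+-monoʳ-≤ (r * n) (*-monoʳ-≤ (suc r) (m∸n≤m n r))) (≤-reflexive (collect r n))
        where
        collect : ∀ r n → r * n + suc r * n ≡ suc (2 * r) * n
        collect = solve-∀
    finish : NearFull r K (β r (ζ₀ r)) G ⊎ NearFull r K (β r (ζ₀ r)) (G ᵀ) → Fam r G ⊎ Fam r (G ᵀ)
    finish (inj₁ f) = near-full sat (λ u → mind u refl) (λ y → mind′ y refl) few r≤n (NearFull.hS f) (close _ (NearFull.most f))
    finish (inj₂ f) = swap (near-full (Sat-ᵀ sat) (λ y → mind′ y refl) (λ u → mind u refl) fewᵀ r≤n (NearFull.hS f) (close _ (NearFull.most f)))

sum-bounds : ∀ a b c d {n} → a + b + c + d ≤ n → a ≤ n × b ≤ n × c ≤ n × d ≤ n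
sum-bounds a b c d h =
    ≤-trans (≤-trans (m≤m+n a b) (≤-trans (m≤m+n (a + b) c) (m≤m+n (a + b + c) d))) h
  , ≤-trans (≤-trans (m≤n+m b a) (≤-trans (m≤m+n (a + b) c) (m≤m+n (a + b + c) d))) h
  , ≤-trans (≤-trans (m≤n+m c (a + b)) (m≤m+n (a + b + c) d)) h
  , ≤-trans (m≤n+m d (a + b + c)) h

Extremal : ℕ → ℕ → Set
Extremal r N = r + (2 + r) ≤ N ×
  (∀ n → N ≤ n → (G : BipGraph n) → Sat r G → edges G ≤ r * n + suc r * (n ∸ r) → Fam r G ⊎ Fam r (G ᵀ))

extremal-from : ∀ r K → 2 * coefficient r * β r (ζ₀ r) ≤ K → 2 + τ r (ζ₀ r) ≤ K → ∃[ N ] Extremal r N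
extremal-from r K K≥₁ K≥₂ = a + b + c + (r + (2 + r)) , m≤n+m _ (a + b + c) , λ n N≤n G →
  (λ (h₁ , h₂ , h₃ , h₄) → extremal K K≥₁ K≥₂ h₁ h₂ h₃ h₄) (sum-bounds a b c (r + (2 + r)) N≤n)
  where
  a = suc r * (K * (bigDegree r K * suc (2 * r)))
  b = K * (K * lowDegree r K)
  c = 2 * offset r + 1

extremal-threshold : ∀ r → ∃[ N ] Extremal r N
extremal-threshold r = extremal-from r (2 * coefficient r * β r (ζ₀ r) + (2 + τ r (ζ₀ r))) (m≤m+n _ _) (m≤n+m _ (2 * coefficient r * β r (ζ₀ r)))

-- The extremal family

member⇒∈ : ∀ {n} {S : Subset n} {u} → Vec.lookup S u ≡ true → u Subset.∈ S
member⇒∈ {S = S} {u} = lookup⇒[]= u S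

#-lookup : ∀ {n} (S : Subset n) → ∣ S ∣ ≡ # (Vec.lookup S)
#-lookup S = trans (go S) (sym (#-sum (Vec.lookup S)))
  where
  go : ∀ {n} (S : Subset n) → ∣ S ∣ ≡ sumFin n (λ x → bit (Vec.lookup S x))
  go Vec.[]          = refl
  go (true  Vec.∷ S) = cong suc (go S)
  go (false Vec.∷ S) = go S

oriented⇒Fam : ∀ {n r} {G : BipGraph n} → FamilyOriented G (suc r) (2 + r) → Fam r G
oriented⇒Fam {G = G} (S , size , dominating , rest) = Vec.lookup S , trans (sym (#-lookup S)) size
  , (λ u p → dominating u (member⇒∈ {S = S} p))
  , λ u p → trans (sym (degree-full G u)) (rest u λ q → true≢false ([]=⇒lookup q) p)

Fam⇒oriented : ∀ {n r} {G : BipGraph n} → Fam r G → FamilyOriented G (suc r) (2 + r)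
Fam⇒oriented {G = G} (S , size , dominating , rest) = Vec.tabulate S
  , trans (#-lookup (Vec.tabulate S)) (trans (#-cong (lookup∘tabulate S)) size)
  , (λ u p → dominating u (trans (sym (lookup∘tabulate S u)) ([]=⇒lookup p)))
  , λ u p → trans (degree-full G u) (rest u (out p))
  where
  out : ∀ {u} → ¬ (u Subset.∈ Vec.tabulate S) → u ∉ S
  out {u} p with bool-cases (S u)
  ... | inj₂ q = q
  ... | inj₁ q = ⊥-elim (p (member⇒∈ {S = Vec.tabulate S} (trans (lookup∘tabulate S u) q)))

Fam-edges : ∀ {n r} {G : BipGraph n} → Fam r G → edges G ≡ r * n + suc r * (n ∸ r)
Fam-edges {n} {r} {G} (S , size , dominating , rest) = begin
  edges G                                               ≡⟨ trans (edges-deg G) (∑[]-split full S _) ⟩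
  ∑[ S ] (deg G full) + ∑[ ∁ S ] (deg G full)           ≡⟨ cong₂ _+_ (∑[]-cong full-row) (∑[]-cong λ u p → rest u (∁-∉ {P = S} p)) ⟩
  ∑[ S ] (λ _ → n) + ∑[ ∁ S ] (λ _ → suc r)             ≡⟨ cong₂ _+_ (∑[]-const S n) (∑[]-const (∁ S) (suc r)) ⟩
  n * # S + suc r * # (∁ S)                             ≡⟨ cong₂ _+_ (trans (cong (n *_) size) (*-comm n r)) (cong (suc r *_) #∁S) ⟩
  r * n + suc r * (n ∸ r)                               ∎
  where
  open ≡-Reasoning
  full-row : ∀ u → u ∈ S → deg G full u ≡ n
  full-row u p = trans (deg-# G full u) (trans (#-cong (dominating u p)) (#-full n))
  #∁S : # (∁ S) ≡ n ∸ r
  #∁S = trans (sym (m+n∸m≡n (# S) _)) (cong₂ _∸_ (#-∁ S) size)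

-- Adding u y to a member of the family completes the r dominating vertices, u, its r + 1 neighbours and y.
Fam-completes : ∀ {n r} {G H : BipGraph n} → Fam r G → (∀ x z → G x z ≡ true → H x z ≡ true) →
  ∀ u y → G u y ≡ false → H u y ≡ true → ContainsKOriented H (suc r) (2 + r)
Fam-completes {r = r} {G} {H} (S , size , dominating , rest) G⊆H u y u≁y Huy =
  f , g , fi , gi , λ i j → adj (f i) (g j) (fm i) (gm j)
  where
  u∉S : u ∉ S
  u∉S with bool-cases (S u)
  ... | inj₂ q = q
  ... | inj₁ q = true≢false (dominating u q y) u≁y
  chosen = choose (suc r) (S ∪⟦ u ⟧) (≤-reflexive (sym (trans (#-insert {P = S} u∉S) (cong suc size))))
  chosen′ = choose (2 + r) (G u ∪⟦ y ⟧) (≤-reflexive (sym (trans (#-insert {P = G u} u≁y) (cong suc (trans (sym (deg-# G full u)) (rest u u∉S))))))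
  f = proj₁ chosen
  fi = proj₁ (proj₂ chosen)
  fm = proj₂ (proj₂ chosen)
  g = proj₁ chosen′
  gi = proj₁ (proj₂ chosen′)
  gm = proj₂ (proj₂ chosen′)
  adj : ∀ x z → x ∈ S ∪⟦ u ⟧ → z ∈ G u ∪⟦ y ⟧ → H x z ≡ true
  adj x z p q with ∪-case {P = S} {u} {x} p | ∪-case {P = G u} {y} {z} q
  ... | inj₁ s    | _         = G⊆H x z (dominating x s z)
  ... | inj₂ refl | inj₁ a    = G⊆H x z a
  ... | inj₂ refl | inj₂ refl = Huy

addEdge-old : ∀ {n} (G : BipGraph n) u y x z → G x z ≡ true → addEdge G u y x z ≡ true
addEdge-old G u y x z h with x ≟ u | z ≟ y
... | yes _ | yes _ = refl
... | yes _ | no _  = h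
... | no _  | yes _ = h
... | no _  | no _  = h

addEdge-new : ∀ {n} (G : BipGraph n) u y → addEdge G u y u y ≡ true
addEdge-new G u y with u ≟ u | y ≟ y
... | yes _ | yes _ = refl
... | no ¬p | _     = ⊥-elim (¬p refl)
... | yes _ | no ¬p = ⊥-elim (¬p refl)

family⇒saturated : ∀ {n r} {G : BipGraph n} → InFamily G (suc r) (2 + r) → Saturated G (suc r) (2 + r)
family⇒saturated {r = r} {G} (no-K , fam) = no-K , λ u y u≁y → add fam u y u≁y
  where
  add : FamilyOriented G (suc r) (2 + r) ⊎ FamilyOriented (G ᵀ) (suc r) (2 + r) →
    ∀ u y → G u y ≡ false → ContainsK (addEdge G u y) (suc r) (2 + r)
  add (inj₁ o) u y u≁y = inj₁ (Fam-completes (oriented⇒Fam o) (addEdge-old G u y) u y u≁y (addEdge-new G u y))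
  add (inj₂ o) u y u≁y = inj₂ (Fam-completes {G = G ᵀ} {addEdge G u y ᵀ} (oriented⇒Fam o) (λ x z → addEdge-old G u y z x) y u u≁y (addEdge-new G u y))

family-edges : ∀ {n r} {G : BipGraph n} → InFamily G (suc r) (2 + r) → edges G ≡ r * n + suc r * (n ∸ r)
family-edges (_ , inj₁ o) = Fam-edges (oriented⇒Fam o)
family-edges {G = G} (_ , inj₂ o) = trans (sym (edges-ᵀ G)) (Fam-edges (oriented⇒Fam o))

-- r dominating vertices in each class and a perfect matching of the remaining ones.
first : ∀ {n} → ℕ → Pred n
first r x = toℕ x <ᵇ r

example : ∀ n → ℕ → BipGraph n
example n r x y = first r x ∨ (first r y ∨ ⟦ x ⟧ y)

#-first : ∀ {n r} → r ≤ n → # {n} (first r) ≡ r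
#-first {n} {r} h = trans (#-sum {n} (first r)) (go h)
  where
  go : ∀ {n r} → r ≤ n → sumFin n (λ x → bit (first r x)) ≡ r
  go {zero}  z≤n     = refl
  go {suc n} z≤n     = go {n} z≤n
  go         (s≤s h) = cong suc (go h)

example-Fam : ∀ {n r} → r ≤ n → Fam r (example n r)
example-Fam {n} {r} h = first r , #-first h , (λ u p y → ∨-inj₁ p) , λ u p → trans (deg-# (example n r) full u)
  (trans (#-cong {P = full ∩ example n r u} {first r ∪⟦ u ⟧} λ y → cong (_∨ (first r y ∨ ⟦ u ⟧ y)) p)
    (trans (#-insert {P = first r} {u} p) (cong suc (#-first h))))

-- Any r + 1 vertices of a class include one that is not dominating, and its degree is only r + 1.
example-free : ∀ {n r} → r ≤ n → ¬ ContainsK (example n r) (suc r) (2 + r)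
example-free {n} {r} r≤n = λ { (inj₁ (f , g , fi , gi , h)) → impossible (λ x y a → row a) (f , fi) (g , gi) h
                             ; (inj₂ (f , g , fi , gi , h)) → impossible (λ x y a → column a) (f , fi) (g , gi) h }
  where
  row : ∀ {x y} → example n r x y ≡ true → x ∉ first r → y ∈ first r ∪⟦ x ⟧
  row {x} {y} a p = trans (cong (_∨ (first r y ∨ ⟦ x ⟧ y)) (sym p)) a
  column : ∀ {x y} → example n r y x ≡ true → x ∉ first r → y ∈ first r ∪⟦ x ⟧
  column {x} {y} a p with ∨-elim {first r y} a
  ... | inj₁ q = ∪-old {P = first r} {x} q
  ... | inj₂ b with ∨-elim {first r x} b
  ...   | inj₁ q = true≢false q p
  ...   | inj₂ q with ⟦⟧-≡ {x = y} {x} q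
  ...     | refl = ∪-new {P = first r} {x}
  impossible : ∀ {H : BipGraph n} → (∀ x y → H x y ≡ true → x ∉ first r → y ∈ first r ∪⟦ x ⟧) →
    (f : Σ (Fin (suc r) → Fin n) (Injective _≡_ _≡_)) (g : Σ (Fin (2 + r) → Fin n) (Injective _≡_ _≡_)) →
    (∀ i j → H (proj₁ f i) (proj₁ g j) ≡ true) → ⊥
  impossible {H} star (f , fi) (g , gi) h = go (⊆? (image f) (first r))
    where
    go : Inclusion (image f) (first r) → ⊥
    go (inside s) = contra-< (≤-trans (#-image f fi) (≤-trans (#-mono s) (≤-reflexive (#-first r≤n))))
    go (outside x p q) = contra-< (≤-trans (#-image g gi) (≤-trans (#-mono sub) (≤-reflexive (trans (#-insert {P = first r} {x} q) (cong suc (#-first r≤n))))))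
      where
      sub : image g ⊆ first r ∪⟦ x ⟧
      sub y m = at (image-elim f p) (image-elim g m)
        where
        at : ∃[ i ] f i ≡ x → ∃[ j ] g j ≡ y → y ∈ first r ∪⟦ x ⟧
        at (i , refl) (j , refl) = star (f i) (g j) (h i j) q

example-family : ∀ {n r} → r ≤ n → InFamily (example n r) (suc r) (2 + r)
example-family h = example-free h , inj₁ (Fam⇒oriented (example-Fam h))

count-formula : ∀ n r → r ≤ n → (2 * (2 + r) ∸ 3) * n ∸ suc r * r ≡ r * n + suc r * (n ∸ r)
count-formula n r h = trans (cong₂ (λ a b → a * b ∸ suc r * r) coefficient-≡ (sym (m+[n∸m]≡n h)))
  (trans (cong (_∸ suc r * r) (rearrange r (n ∸ r))) (trans (m+n∸n≡m _ (suc r * r)) (cong (λ m → r * m + suc r * (n ∸ r)) (m+[n∸m]≡n h))))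
  where
  coefficient-≡ : 2 * (2 + r) ∸ 3 ≡ suc (2 * r)
  coefficient-≡ = cong (_∸ 3) (four r)
    where
    four : ∀ r → 2 * (2 + r) ≡ 4 + 2 * r
    four = solve-∀
  rearrange : ∀ r k → suc (2 * r) * (r + k) ≡ r * (r + k) + suc r * k + suc r * r
  rearrange = solve-∀

-- The saturation number and its extremal graphs

module Conclusion r N (margin : r + (2 + r) ≤ N)
  (bound : ∀ n → N ≤ n → (G : BipGraph n) → Sat r G → edges G ≤ r * n + suc r * (n ∸ r) → Fam r G ⊎ Fam r (G ᵀ)) where

  family : ∀ n → N ≤ n → (G : BipGraph n) → Saturated G (suc r) (2 + r) → edges G ≤ r * n + suc r * (n ∸ r) → InFamily G (suc r) (2 + r)
  family n N≤n G sat few = proj₁ sat , orient (bound n N≤n G (saturated⇒Sat sat) few)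
    where
    orient : Fam r G ⊎ Fam r (G ᵀ) → FamilyOriented G (suc r) (2 + r) ⊎ FamilyOriented (G ᵀ) (suc r) (2 + r)
    orient (inj₁ f) = inj₁ (Fam⇒oriented f)
    orient (inj₂ f) = inj₂ (Fam⇒oriented f)

  r≤N : r ≤ N
  r≤N = ≤-trans (m≤m+n r (2 + r)) margin

  number : ∀ n → N ≤ n → IsSatNumber n (suc r) (2 + r) (r * n + suc r * (n ∸ r))
  number n N≤n = (example n r , family⇒saturated member , family-edges member) , minimal
    where
    member : InFamily (example n r) (suc r) (2 + r)
    member = example-family (≤-trans r≤N N≤n)
    minimal : (G : BipGraph n) → Saturated G (suc r) (2 + r) → r * n + suc r * (n ∸ r) ≤ edges G
    -- A saturated graph with no more edges than the claimed minimum lies in the family, whose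
    -- members all have exactly that many.
    minimal G sat = go (≤-total (edges G) (r * n + suc r * (n ∸ r)))
      where
      go : _ → r * n + suc r * (n ∸ r) ≤ edges G
      go (inj₂ h) = h
      go (inj₁ h) = ≤-reflexive (sym (family-edges (family n N≤n G sat h)))

  conclusion : ∀ m n → N ≤ n → m ≡ r * n + suc r * (n ∸ r) →
    IsSatNumber n (suc r) (2 + r) m × ((G : BipGraph n) → (Saturated G (suc r) (2 + r) × edges G ≡ m) ⇔ InFamily G (suc r) (2 + r))
  conclusion m n N≤n refl = number n N≤n , λ G →
    mk⇔ (λ (sat , e) → family n N≤n G sat (≤-reflexive e)) (λ m → family⇒saturated m , family-edges m)

theorem1p2 : (t : ℕ) → 1 < t →
    ∃[ N ] ((n : ℕ) → N ≤ n →
    IsSatNumber n (t ∸ 1) t ((2 * t ∸ 3) * n ∸ (t ∸ 1) * (t ∸ 2)) ×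
    ((G : BipGraph n) →
    (Saturated G (t ∸ 1) t × edges G ≡ (2 * t ∸ 3) * n ∸ (t ∸ 1) * (t ∸ 2))
    ⇔ InFamily G (t ∸ 1) t))
theorem1p2 (suc (suc r)) (s≤s (s≤s z≤n)) = go (extremal-threshold r)
  where
  go : ∃[ N ] Extremal r N → _
  go (N , margin , bound) = N , λ n N≤n → C.conclusion _ n N≤n (count-formula n r (≤-trans C.r≤N N≤n))
    where module C = Conclusion r N margin bound
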